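{- Let $\mathbf{a}$ and $\mathbf{b}$ be two admissible compositions such that $\zeta(\mathbf{a})_{n,n}=\zeta(\mathbf{b})_{n,n}$ for all integers $n\geqslant0$. Then $\mathbf{b}=\mathbf{a}$ or $\mathbf{b}=\overline{\mathbf{a}}$.
   Context: A composition is a finite sequence $\mathbf{a}=(a_1,\ldots,a_r)$ of positive integers ($r\geqslant0$); it is admissible if $r=0$ or $a_1\geqslant2$. Its binary word is $\mathbf{w}(\mathbf{a})=0^{a_1-1}1\cdots0^{a_r-1}1$ ($0^u$ = $u$ zeros). The dual of a word $\varepsilon_1\cdots\varepsilon_k$ is $\overline{\varepsilon_k}\cdots\overline{\varepsilon_1}$ with $\overline0=1,\overline1=0$; for admissible $\mathbf{a}$, $\overline{\mathbf{a}}$ is the admissible composition whose word is the dual of $\mathbf{w}(\mathbf{a})$. For non-empty admissible $\mathbf{a}$ and $n\geqslant 0$, $\zeta(\mathbf{a})_{n,n}=\sum_{n_1>\cdots>n_r>n}\binom{n_1+n}{n}^{ -1}n_1^{ -a_1}\cdots n_r^{ -a_r}$, and $\zeta(\varnothing)_{n,n}=\binom{2n}{n}^{ -1}$. -}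

module Defs where

open import Data.Bool using (Bool; true; false; not; if_then_else_)
open import Data.List using (List; []; _∷_; _++_; [_]; replicate; reverse; map; concatMap)
open import Data.List.Relation.Unary.All using (All)
open import Data.Nat using (ℕ; zero; suc; _≤_; _^_; _<ᵇ_; _∸_)
open import Data.Nat.Combinatorics using (_C_)
open import Data.Integer using (+_)
open import Data.Rational using (ℚ; _/_; 0ℚ; 1ℚ; _+_; _*_; _-_; ∣_∣; _<_)
open import Data.Product using (Σ; _×_)
open import Data.Unit using (⊤)

Composition : Set
Composition = List ℕ

Admissible : Composition → Set
Admissible []       = ⊤
Admissible (a ∷ as) = 2 ≤ a × All (1 ≤_) as

-- binary word w(a) = 0^{a1-1} 1 ... 0^{ar-1} 1   (false = 0, true = 1)
word : Composition → List Bool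
word = concatMap (λ a → replicate (a ∸ 1) false ++ [ true ])

dualWord : List Bool → List Bool
dualWord w = reverse (map not w)

-- decode a word ending in 1 back into the composition
-- (k counts the zeros read since the last 1)
fromWordAux : ℕ → List Bool → Composition
fromWordAux k []            = []
fromWordAux k (true ∷ w)    = suc k ∷ fromWordAux 0 w
fromWordAux k (false ∷ w)   = fromWordAux (suc k) w

fromWord : List Bool → Composition
fromWord = fromWordAux 0

dual : Composition → Composition
dual a = fromWord (dualWord (word a))

-- reciprocal of a natural number (only used at positive arguments)
recip : ℕ → ℚ
recip zero    = 0ℚ
recip (suc j) = + 1 / suc j

sumTo : (ℕ → ℚ) → ℕ → ℚ
sumTo f zero    = 0ℚ
sumTo f (suc m) = sumTo f m + f m

sumBetween : ℕ → ℕ → (ℕ → ℚ) → ℚ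
sumBetween lo hi f = sumTo (λ k → if lo <ᵇ k then f k else 0ℚ) hi

inner : Composition → ℕ → ℕ → ℚ
inner []       m n = 1ℚ
inner (a ∷ as) m n = sumBetween n m (λ k → recip (k ^ a) * inner as k n)

zetaPartial : ℕ → Composition → ℕ → ℚ
zetaPartial N []       n = recip ((n Data.Nat.+ n) C n)
zetaPartial N (a ∷ as) n =
  sumBetween n (suc N) (λ k → recip ((k Data.Nat.+ n) C n) * recip (k ^ a) * inner as k n)

-- ζ(a)_{n,n} = ζ(b)_{n,n} as real numbers: the difference of the partial
-- sums tends to 0 (both series converge for admissible compositions)
ZetaEq : Composition → Composition → ℕ → Set
ZetaEq a b n = ∀ (ε : ℚ) → 0ℚ < ε →
  Σ ℕ λ M → ∀ N → M ≤ N → ∣ zetaPartial N a n - zetaPartial N b n ∣ < ε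

{-# OPTIONS --safe #-}
module Submission where

open import Defs
open import Data.Bool using (Bool; true; false; not; if_then_else_)
open import Data.Bool.Properties using (not-involutive)
open import Data.Empty using (⊥; ⊥-elim)
import Data.Integer as ℤ
import Data.Integer.Properties as ℤₚ
open import Data.List using (List; []; _∷_; _++_; [_]; replicate; reverse; map; length; upTo; cartesianProductWith)
open import Data.List.Membership.Propositional using (_∈_; _∉_)
open import Data.List.Membership.Propositional.Properties using (∈-cartesianProductWith⁺; ∈-cartesianProductWith⁻; ∈-upTo⁺; ∈-upTo⁻)
open import Data.List.Properties using (unfold-reverse; reverse-++; map-++; ++-assoc; ++-cancelˡ; ++-cancelʳ; ++-identityʳ; ∷-injectiveˡ; ∷-injectiveʳ; ≡-dec)
open import Data.List.Relation.Unary.All using (All; []; _∷_)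
import Data.List.Relation.Unary.All as All
open import Data.List.Relation.Unary.Any using (here; there)
open import Data.Maybe using (Maybe; just; nothing)
open import Data.Nat as ℕ using (ℕ; zero; suc)
open import Data.Nat.Combinatorics using (_C_; nCk+nC[k+1]≡[n+1]C[k+1]; nCk≡nC[n∸k]; nCn≡1; k>n⇒nCk≡0)
import Data.Nat.Properties as ℕₚ
open import Data.Product using (Σ; ∃; _×_; _,_; proj₁; proj₂)
open import Data.Rational using (ℚ; 0ℚ; 1ℚ; _+_; _*_; _-_; -_; _≤_; _<_; ∣_∣; 1/_; NonZero; ≢-nonZero; toℚᵘ; nonNegative; positive)
import Data.Rational.Properties as ℚₚ
import Data.Rational.Unnormalised as ℚᵘ
import Data.Rational.Unnormalised.Properties as ℚᵘₚ
open import Data.Sum using (_⊎_; inj₁; inj₂; [_,_]′)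
open import Data.Unit using (tt)
open import Function using (_∘_; id; case_of_)
open import Relation.Binary.PropositionalEquality using (_≡_; _≢_; refl; sym; trans; cong; cong₂; subst; module ≡-Reasoning)
open import Relation.Nullary using (¬_; yes; no; contradiction)
open import Tactic.RingSolver using (solve-∀)
open import Tactic.RingSolver.Core.AlmostCommutativeRing using (AlmostCommutativeRing; fromCommutativeRing)

-- Let Z_a(n) be the diagonal double tail.  Removing the extreme letters of the word of a gives, in ℝ,
--   Z_a(n-1) = Z_a(n) + n^(-p-1) Z_s(n) + n^(-q-1) Z_r(n) + n^(-p-q-2) Z_u(n)
-- for w(a) = 0 1^p w(u) 0^q 1 with w(s) = w(u) 0^q 1 and w(r) = 0 1^p w(u) (with obvious changes for u = ∅), while
-- Z_∅(n-1) = (4 - 2/n) Z_∅(n).  Iterating, Z_a is a combination with coefficients φ_J(a) ∈ ℕ of Apéry-like sums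
--   Y_J(n) = ∑_{n < n_1 < ⋯ < n_l} n_1^(-j_1) ⋯ n_l^(-j_l) / binom(2 n_l, n_l).
-- The Y_J are linearly independent over ℚ[n]: eliminating from a minimal relation and its shift leads to
-- κ(n) R(n-1) + ∑_j c_j n^(-j) = R(n) with R rational, which is impossible because the pole at 0 would propagate to
-- infinitely many integers.  Hence equal tails have equal coefficients φ_J.  The degrees p+1, q+1, p+q+2 and the
-- coefficients of u and s are then read off from φ, and by induction on the weight they determine w(a) up to
-- duality; the only ambiguity, x 0^q 1 = 0 1^q x, forces q = 1 and x = (01)^m, which is self-dual.
--
-- Real numbers are represented by their partial sums, as sequences modulo null sequences.

-- The recurrence comes from treating the two parameters of the double tail separately. Raising the
-- lower bound splits off the smallest index, that is the final block 0^q 1. Raising the binomial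
-- parameter to n rewrites the kernel as the next kernel times 1 + k/n, and the factor k cancels a
-- leading 0; once the first exponent is 1, the sum over the largest index telescopes and swallows
-- the following 1s. The recurrence determines a sequence only up to a constant in n, so iterating
-- it requires decay as n grows, uniformly in the truncation.
--
-- It matters that φ is natural-valued: contributions of different terms to one coefficient cannot
-- cancel, so every degree present in the recurrence is visible in the expansion. When p = q, the
-- contributions of s and r share a degree and only their sum is known; but exchanging p and q is
-- then harmless, and u up to duality suffices.
--
-- Linear independence has to be proved over ℚ[n] although the final relation has constant
-- coefficients, because elimination between a relation and its shift produces polynomial ones.

ℚ-ring : AlmostCommutativeRing _ _
ℚ-ring = fromCommutativeRing ℚₚ.+-*-commutativeRing zero?
  where
  zero? : ∀ x → Maybe (0ℚ ≡ x)
  zero? x with 0ℚ ℚₚ.≟ x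
  ... | yes p = just p
  ... | no _  = nothing

-- Rational numbers

*-integral : ∀ p {q} → p * q ≡ 0ℚ → p ≢ 0ℚ → q ≡ 0ℚ
*-integral p {q} pq≡0 p≢0 = begin
  q                 ≡⟨ ℚₚ.*-identityˡ q ⟨
  1ℚ * q            ≡⟨ cong (_* q) (ℚₚ.*-inverseˡ p) ⟨
  (1/ p * p) * q    ≡⟨ ℚₚ.*-assoc (1/ p) p q ⟩
  1/ p * (p * q)    ≡⟨ cong (1/ p *_) pq≡0 ⟩
  1/ p * 0ℚ         ≡⟨ ℚₚ.*-zeroʳ (1/ p) ⟩
  0ℚ                ∎
  where
  open ≡-Reasoning
  instance _ = ≢-nonZero p≢0

*-integralʳ : ∀ {p} q → p * q ≡ 0ℚ → q ≢ 0ℚ → p ≡ 0ℚ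
*-integralʳ {p} q eq = *-integral q (trans (ℚₚ.*-comm q p) eq)

*-≢0 : ∀ {p q} → p ≢ 0ℚ → q ≢ 0ℚ → p * q ≢ 0ℚ
*-≢0 {p} p≢0 q≢0 eq = q≢0 (*-integral p eq p≢0)

p-q≡0⇒p≡q : ∀ p q → p - q ≡ 0ℚ → p ≡ q
p-q≡0⇒p≡q p q eq = trans (lem p q) (trans (cong (_+ q) eq) (ℚₚ.+-identityˡ q))
  where
  lem : ∀ p q → p ≡ (p - q) + q
  lem = solve-∀ ℚ-ring

p≡q⇒p-q≡0 : ∀ {p q} → p ≡ q → p - q ≡ 0ℚ
p≡q⇒p-q≡0 {p} refl = ℚₚ.+-inverseʳ p

*-cancelˡ-≢0 : ∀ r {p q} → r ≢ 0ℚ → r * p ≡ r * q → p ≡ q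
*-cancelˡ-≢0 r {p} {q} r≢0 eq = p-q≡0⇒p≡q p q (*-integral r (trans (lem r p q) (p≡q⇒p-q≡0 eq)) r≢0)
  where
  lem : ∀ r p q → r * (p - q) ≡ r * p - r * q
  lem = solve-∀ ℚ-ring

-- Recursive rather than `+ n / 1`: `ι (suc n)` is `1ℚ + ι n` by definition, so ring identities in
-- `1ℚ + y` apply to consecutive integers without conversion.
ι : ℕ → ℚ
ι zero    = 0ℚ
ι (suc n) = 1ℚ + ι n

ι-+ : ∀ m n → ι (m ℕ.+ n) ≡ ι m + ι n
ι-+ zero    n = sym (ℚₚ.+-identityˡ (ι n))
ι-+ (suc m) n = trans (cong (_+_ 1ℚ) (ι-+ m n)) (sym (ℚₚ.+-assoc 1ℚ (ι m) (ι n)))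

ι-* : ∀ m n → ι (m ℕ.* n) ≡ ι m * ι n
ι-* zero    n = sym (ℚₚ.*-zeroˡ (ι n))
ι-* (suc m) n = trans (ι-+ n (m ℕ.* n)) (trans (cong (ι n +_) (ι-* m n)) (lem (ι m) (ι n)))
  where
  lem : ∀ x y → y + x * y ≡ (1ℚ + x) * y
  lem = solve-∀ ℚ-ring

0≤1 : 0ℚ ≤ 1ℚ
0≤1 = ℚₚ.nonNegative⁻¹ 1ℚ

0<1 : 0ℚ < 1ℚ
0<1 = ℚₚ.positive⁻¹ 1ℚ

0≤ι : ∀ n → 0ℚ ≤ ι n
0≤ι zero    = ℚₚ.≤-refl
0≤ι (suc n) = ℚₚ.+-mono-≤ 0≤1 (0≤ι n)

0<ι : ∀ n → 0ℚ < ι (suc n)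
0<ι n = ℚₚ.+-mono-<-≤ 0<1 (0≤ι n)

<⇒≢0 : ∀ {p} → 0ℚ < p → p ≢ 0ℚ
<⇒≢0 0<p refl = ℚₚ.<-irrefl refl 0<p

ι≢0 : ∀ n → ι (suc n) ≢ 0ℚ
ι≢0 n = <⇒≢0 (0<ι n)

+-cancelˡ : ∀ r {p q} → r + p ≡ r + q → p ≡ q
+-cancelˡ r {p} {q} eq = trans (sym (lem r p)) (trans (cong (- r +_) eq) (lem r q))
  where
  lem : ∀ r p → - r + (r + p) ≡ p
  lem = solve-∀ ℚ-ring

ι-injective : ∀ {m n} → ι m ≡ ι n → m ≡ n
ι-injective {zero}  {zero}  eq = refl
ι-injective {zero}  {suc n} eq = contradiction (sym eq) (ι≢0 n)
ι-injective {suc m} {zero}  eq = contradiction eq (ι≢0 m)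
ι-injective {suc m} {suc n} eq = cong suc (ι-injective (+-cancelˡ 1ℚ eq))

ι-mono : ∀ {m n} → m ℕ.≤ n → ι m ≤ ι n
ι-mono {n = n} ℕ.z≤n = 0≤ι n
ι-mono (ℕ.s≤s m≤n) = ℚₚ.+-monoʳ-≤ 1ℚ (ι-mono m≤n)

ι≃ : ∀ n → toℚᵘ (ι n) ℚᵘ.≃ ℚᵘ.mkℚᵘ (ℤ.+ n) 0
ι≃ zero    = ℚᵘₚ.≃-refl
ι≃ (suc n) = ℚᵘₚ.≃-trans (ℚₚ.toℚᵘ-homo-+ 1ℚ (ι n))
    (ℚᵘₚ.≃-trans (ℚᵘₚ.+-congʳ (toℚᵘ 1ℚ) (ι≃ n))
      (ℚᵘ.*≡* (cong (ℤ._* ℤ.+ 1) (trans (cong (λ z → ℤ.+ 1 ℤ.+ z) (ℤₚ.*-identityʳ (ℤ.+ n))) refl))))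

ι-recip : ∀ n → ι (suc n) * recip (suc n) ≡ 1ℚ
ι-recip n = ℚₚ.toℚᵘ-injective
  (ℚᵘₚ.≃-trans (ℚₚ.toℚᵘ-homo-* (ι (suc n)) (recip (suc n)))
  (ℚᵘₚ.≃-trans (ℚᵘₚ.*-cong (ι≃ (suc n)) (ℚₚ.toℚᵘ-fromℚᵘ (ℚᵘ.mkℚᵘ (ℤ.+ 1) n)))
    (ℚᵘ.*≡* (trans (ℤₚ.*-identityʳ _) (trans (ℤₚ.*-identityʳ (ℤ.+ suc n)) (sym (trans (ℤₚ.*-identityˡ _) (ℤₚ.*-identityˡ (ℤ.+ suc n)))))))))

recip-unique : ∀ n {p} → ι (suc n) * p ≡ 1ℚ → p ≡ recip (suc n)
recip-unique n eq = *-cancelˡ-≢0 (ι (suc n)) (ι≢0 n) (trans eq (sym (ι-recip n)))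

recip-* : ∀ m n → recip (m ℕ.* n) ≡ recip m * recip n
recip-* zero    n       = sym (ℚₚ.*-zeroˡ (recip n))
recip-* (suc m) zero    = trans (cong recip (ℕₚ.*-zeroʳ m)) (sym (ℚₚ.*-zeroʳ (recip (suc m))))
recip-* (suc m) (suc n) = sym (recip-unique (n ℕ.+ m ℕ.* suc n) (begin
  ι (suc m ℕ.* suc n) * (recip (suc m) * recip (suc n))            ≡⟨ cong (_* (recip (suc m) * recip (suc n))) (ι-* (suc m) (suc n)) ⟩
  (ι (suc m) * ι (suc n)) * (recip (suc m) * recip (suc n))        ≡⟨ lem (ι (suc m)) (ι (suc n)) (recip (suc m)) (recip (suc n)) ⟩
  (ι (suc m) * recip (suc m)) * (ι (suc n) * recip (suc n))        ≡⟨ cong₂ _*_ (ι-recip m) (ι-recip n) ⟩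
  1ℚ * 1ℚ                                                          ≡⟨⟩
  1ℚ                                                               ∎))
  where
  open ≡-Reasoning
  lem : ∀ a b c d → (a * b) * (c * d) ≡ (a * c) * (b * d)
  lem = solve-∀ ℚ-ring

0<recip : ∀ n → 0ℚ < recip (suc n)
0<recip n = ℚₚ.positive⁻¹ (recip (suc n)) {{ℚₚ.normalize-pos 1 (suc n)}}

0≤recip : ∀ n → 0ℚ ≤ recip n
0≤recip zero    = ℚₚ.≤-refl
0≤recip (suc n) = ℚₚ.<⇒≤ (0<recip n)

infixr 8 _^ℚ_

_^ℚ_ : ℚ → ℕ → ℚ
x ^ℚ zero  = 1ℚ
x ^ℚ suc n = x * x ^ℚ n

recip-^ : ∀ m n → recip (m ℕ.^ n) ≡ recip m ^ℚ n
recip-^ m zero    = refl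
recip-^ m (suc n) = trans (recip-* m (m ℕ.^ n)) (cong (recip m *_) (recip-^ m n))

^ℚ-+ : ∀ x m n → x ^ℚ (m ℕ.+ n) ≡ x ^ℚ m * x ^ℚ n
^ℚ-+ x zero    n = sym (ℚₚ.*-identityˡ _)
^ℚ-+ x (suc m) n = trans (cong (x *_) (^ℚ-+ x m n)) (sym (ℚₚ.*-assoc x (x ^ℚ m) (x ^ℚ n)))

^ℚ≢0 : ∀ {x} n → x ≢ 0ℚ → x ^ℚ n ≢ 0ℚ
^ℚ≢0 zero    x≢0 = <⇒≢0 0<1
^ℚ≢0 (suc n) x≢0 = *-≢0 x≢0 (^ℚ≢0 n x≢0)

-- Polynomial functions

-- Horner form of a function. The index counts coefficients, zero leading ones allowed, so it is
-- only an upper bound; it is the measure that drops whenever a root is divided out.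
data IsPoly : ℕ → (ℚ → ℚ) → Set where
  zeroP : ∀ {f} → (∀ x → f x ≡ 0ℚ) → IsPoly zero f
  stepP : ∀ {d f} (c : ℚ) {g : ℚ → ℚ} → IsPoly d g → (∀ x → f x ≡ c + x * g x) → IsPoly (suc d) f

Poly : (ℚ → ℚ) → Set
Poly f = ∃ λ d → IsPoly d f

IsPoly-cong : ∀ {d f g} → (∀ x → g x ≡ f x) → IsPoly d f → IsPoly d g
IsPoly-cong eq (zeroP z)     = zeroP λ x → trans (eq x) (z x)
IsPoly-cong eq (stepP c p e) = stepP c p λ x → trans (eq x) (e x)

Poly-cong : ∀ {f g} → (∀ x → g x ≡ f x) → Poly f → Poly g
Poly-cong eq (d , p) = d , IsPoly-cong eq p

Poly-const : ∀ c → Poly (λ _ → c)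
Poly-const c = 1 , stepP c (zeroP (λ _ → refl)) (lem c)
  where
  lem : ∀ c x → c ≡ c + x * 0ℚ
  lem = solve-∀ ℚ-ring

Poly-*x : ∀ {f} → Poly f → Poly (λ x → x * f x)
Poly-*x {f} (d , p) = suc d , stepP 0ℚ p (λ x → sym (ℚₚ.+-identityˡ (x * f x)))

Poly-+ : ∀ {f g} → Poly f → Poly g → Poly (λ x → f x + g x)
Poly-+ (_ , p) (_ , q) = go p q
  where
  lem : ∀ c d x u v → (c + x * u) + (d + x * v) ≡ (c + d) + x * (u + v)
  lem = solve-∀ ℚ-ring
  go : ∀ {d e f g} → IsPoly d f → IsPoly e g → Poly (λ x → f x + g x)
  go {g = g} (zeroP z) q = _ , IsPoly-cong (λ x → trans (cong (_+ g x) (z x)) (ℚₚ.+-identityˡ (g x))) q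
  go {f = f} p@(stepP _ _ _) (zeroP z) = _ , IsPoly-cong (λ x → trans (cong (f x +_) (z x)) (ℚₚ.+-identityʳ (f x))) p
  go (stepP c {g₁} p e) (stepP d {g₂} q e′) with go p q
  ... | k , r = suc k , stepP (c + d) r (λ x → trans (cong₂ _+_ (e x) (e′ x)) (lem c d x (g₁ x) (g₂ x)))

Poly-scale : ∀ c {f} → Poly f → Poly (λ x → c * f x)
Poly-scale c (_ , p) = _ , go p
  where
  lem : ∀ c d x u → c * (d + x * u) ≡ c * d + x * (c * u)
  lem = solve-∀ ℚ-ring
  go : ∀ {d f} → IsPoly d f → IsPoly d (λ x → c * f x)
  go (zeroP z)         = zeroP λ x → trans (cong (c *_) (z x)) (ℚₚ.*-zeroʳ c)
  go (stepP d {g} p e) = stepP (c * d) (go p) λ x → trans (cong (c *_) (e x)) (lem c d x (g x))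

Poly-* : ∀ {f g} → Poly f → Poly g → Poly (λ x → f x * g x)
Poly-* {g = g} (_ , p) q = go p
  where
  lem : ∀ c x u v → (c + x * u) * v ≡ c * v + x * (u * v)
  lem = solve-∀ ℚ-ring
  go : ∀ {d f} → IsPoly d f → Poly (λ x → f x * g x)
  go (zeroP z)         = 0 , zeroP λ x → trans (cong (_* g x) (z x)) (ℚₚ.*-zeroˡ (g x))
  go (stepP c {h} p e) = Poly-cong (λ x → trans (cong (_* g x) (e x)) (lem c x (h x) (g x)))
                                   (Poly-+ (Poly-scale c q) (Poly-*x (go p)))

Poly-- : ∀ {f g} → Poly f → Poly g → Poly (λ x → f x - g x)
Poly-- {f} {g} p q = Poly-cong (λ x → lem (f x) (g x)) (Poly-+ p (Poly-scale (- 1ℚ) q))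
  where
  lem : ∀ u v → u - v ≡ u + (- 1ℚ) * v
  lem = solve-∀ ℚ-ring

Poly-id : Poly id
Poly-id = Poly-cong (λ x → sym (ℚₚ.*-identityʳ x)) (Poly-*x (Poly-const 1ℚ))

Poly-^ : ∀ n → Poly (_^ℚ n)
Poly-^ zero    = Poly-const 1ℚ
Poly-^ (suc n) = Poly-*x (Poly-^ n)

Poly-pred : ∀ {f} → Poly f → Poly (λ x → f (x - 1ℚ))
Poly-pred (_ , p) = go p
  where
  go : ∀ {d f} → IsPoly d f → Poly (λ x → f (x - 1ℚ))
  go (zeroP z)         = 0 , zeroP λ x → z (x - 1ℚ)
  go (stepP c {g} p e) = Poly-cong (λ x → e (x - 1ℚ))
    (Poly-+ (Poly-const c) (Poly-* (Poly-- Poly-id (Poly-const 1ℚ)) (go p)))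

Poly-sumTo : ∀ {f : ℕ → ℚ → ℚ} n → (∀ i → Poly (f i)) → Poly (λ x → sumTo (λ i → f i x) n)
Poly-sumTo zero    p = Poly-const 0ℚ
Poly-sumTo (suc n) p = Poly-+ (Poly-sumTo n p) (p n)

-- Synthetic division by `x - r`, read off the Horner form.
factor : ∀ {d f} r → IsPoly (suc d) f → ∃ λ q → IsPoly d q × (∀ x → f x ≡ f r + (x - r) * q x)
factor {zero} {f} r (stepP c {g} (zeroP z) e) = (λ _ → 0ℚ) , zeroP (λ _ → refl) , λ x →
  trans (constant x) (trans (sym (constant r)) (lem (f r) x r))
  where
  constant : ∀ x → f x ≡ c
  constant x = trans (e x) (trans (cong (λ y → c + x * y) (z x)) (lem₀ c x))
    where
    lem₀ : ∀ c x → c + x * 0ℚ ≡ c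
    lem₀ = solve-∀ ℚ-ring
  lem : ∀ u x r → u ≡ u + (x - r) * 0ℚ
  lem = solve-∀ ℚ-ring
factor {suc d} {f} r (stepP c {g} p e) with factor r p
... | q , isq , eq = (λ x → g r + x * q x) , stepP (g r) isq (λ _ → refl) , λ x →
  trans (e x) (trans (cong (λ y → c + x * y) (eq x)) (trans (lem c x r (g r) (q x)) (cong (_+ (x - r) * (g r + x * q x)) (sym (e r)))))
  where
  lem : ∀ c x r u v → c + x * (u + (x - r) * v) ≡ (c + r * u) + (x - r) * (u + x * v)
  lem = solve-∀ ℚ-ring

factor-root : ∀ {d f} r → IsPoly (suc d) f → f r ≡ 0ℚ → ∃ λ q → IsPoly d q × (∀ x → f x ≡ (x - r) * q x)
factor-root r p fr≡0 with factor r p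
... | q , isq , eq = q , isq , λ x → trans (eq x) (trans (cong (_+ (x - r) * q x) fr≡0) (ℚₚ.+-identityˡ _))

-- Each root met along the sequence is divided out and lowers the index, so the search ends. The
-- zeros before the first nonroot are recorded because the pole argument works at the end of an
-- initial run of zeros.
firstNonroot : ∀ {d f} (r : ℕ → ℚ) → (∀ {i j} → r i ≡ r j → i ≡ j) → IsPoly d f →
  (∀ x → f x ≡ 0ℚ) ⊎ (∃ λ i → f (r i) ≢ 0ℚ × (∀ j → j ℕ.< i → f (r j) ≡ 0ℚ))
firstNonroot r inj (zeroP z) = inj₁ z
firstNonroot {f = f} r inj p@(stepP _ _ _) with f (r 0) ℚₚ.≟ 0ℚ
... | no f≢0  = inj₂ (0 , f≢0 , λ _ ())
... | yes f≡0 with factor-root (r 0) p f≡0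
... | q , isq , eq with firstNonroot (r ∘ suc) (λ e → ℕₚ.suc-injective (inj e)) isq
... | inj₁ q≡0 = inj₁ λ x → trans (eq x) (trans (cong ((x - r 0) *_) (q≡0 x)) (ℚₚ.*-zeroʳ (x - r 0)))
... | inj₂ (i , q≢0 , below) = inj₂ (suc i , f≢0 , below′)
  where
  f≢0 : f (r (suc i)) ≢ 0ℚ
  f≢0 e = *-≢0 (λ e′ → case inj (p-q≡0⇒p≡q (r (suc i)) (r 0) e′) of λ ()) q≢0 (trans (sym (eq (r (suc i)))) e)
  below′ : ∀ j → j ℕ.< suc i → f (r j) ≡ 0ℚ
  below′ zero    _           = f≡0
  below′ (suc j) (ℕ.s≤s j<i) = trans (eq (r (suc j))) (trans (cong ((r (suc j) - r 0) *_) (below j j<i)) (ℚₚ.*-zeroʳ (r (suc j) - r 0)))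

-- Identities are obtained only at large natural numbers; this carries them to all rationals, in
-- particular to 0 and the negative integers, where poles are examined.
eventually-zero⇒zero : ∀ {f} n₀ → Poly f → (∀ n → n₀ ℕ.≤ n → f (ι n) ≡ 0ℚ) → ∀ x → f x ≡ 0ℚ
eventually-zero⇒zero n₀ (_ , p) zeros with firstNonroot (λ i → ι (n₀ ℕ.+ i)) (λ e → ℕₚ.+-cancelˡ-≡ n₀ _ _ (ι-injective e)) p
... | inj₁ z = z
... | inj₂ (i , f≢0 , _) = contradiction (zeros (n₀ ℕ.+ i) (ℕₚ.m≤m+n n₀ i)) f≢0

eventually-≡⇒≡ : ∀ {f g} n₀ → Poly f → Poly g → (∀ n → n₀ ℕ.≤ n → f (ι n) ≡ g (ι n)) → ∀ x → f x ≡ g x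
eventually-≡⇒≡ {f} {g} n₀ p q eq x = p-q≡0⇒p≡q (f x) (g x)
  (eventually-zero⇒zero n₀ (Poly-- p q) (λ n n₀≤n → p≡q⇒p-q≡0 (eq n n₀≤n)) x)

-- Whether a root exists is not decided here, hence the double negation.
eventually-nonzero : ∀ {f} → Poly f → ¬ (∀ x → f x ≡ 0ℚ) → ¬ ¬ (∃ λ n₀ → ∀ n → n₀ ℕ.≤ n → f (ι n) ≢ 0ℚ)
eventually-nonzero (_ , p) = go p
  where
  go : ∀ {d f} → IsPoly d f → ¬ (∀ x → f x ≡ 0ℚ) → ¬ ¬ (∃ λ n₀ → ∀ n → n₀ ℕ.≤ n → f (ι n) ≢ 0ℚ)
  go (zeroP z) f≢0 _ = f≢0 z
  go {f = f} p@(stepP _ _ _) f≢0 k = k (0 , λ n _ root → root-found n root)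
    where
    root-found : ∀ r → f (ι r) ≢ 0ℚ
    root-found r root with factor-root (ι r) p root
    ... | q , isq , eq = go isq
      (λ q≡0 → f≢0 λ x → trans (eq x) (trans (cong ((x - ι r) *_) (q≡0 x)) (ℚₚ.*-zeroʳ (x - ι r))))
      (λ (n₀ , nz) → k (n₀ ℕ.+ suc r , λ n le fn≡0 → *-≢0
        (λ e → ℕₚ.<-irrefl (sym (ι-injective (p-q≡0⇒p≡q (ι n) (ι r) e))) (ℕₚ.≤-trans (ℕₚ.m≤n+m (suc r) n₀) le))
        (nz n (ℕₚ.≤-trans (ℕₚ.m≤m+n n₀ (suc r)) le))
        (trans (sym (eq (ι n))) fn≡0)))

factor-root-Poly : ∀ {f} r → Poly f → f r ≡ 0ℚ → ∃ λ q → Poly q × (∀ x → f x ≡ (x - r) * q x)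
factor-root-Poly r (zero , zeroP z) _ = (λ _ → 0ℚ) , Poly-const 0ℚ , λ x → trans (z x) (sym (ℚₚ.*-zeroʳ (x - r)))
factor-root-Poly r (suc d , p) fr≡0 with factor-root r p fr≡0
... | q , isq , eq = q , (d , isq) , eq

-- Nothing can be divided at `x = r` itself, but `r + 1`, `r + 2`, ... already give infinitely many
-- roots of `f`.
cancel-linear : ∀ {f} r → Poly f → (∀ x → (x - r) * f x ≡ 0ℚ) → ∀ x → f x ≡ 0ℚ
cancel-linear {f} r (_ , p) zeros = [ id , (λ (i , f≢0 , _) → contradiction (root i) f≢0) ]′ (firstNonroot s s-injective p)
  where
  s : ℕ → ℚ
  s i = r + ι (suc i)
  s-injective : ∀ {i j} → s i ≡ s j → i ≡ j
  s-injective {i} {j} e = ℕₚ.suc-injective (ι-injective {suc i} {suc j} (+-cancelˡ r e))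
  lem : ∀ r y → r + y - r ≡ y
  lem = solve-∀ ℚ-ring
  root : ∀ i → f (s i) ≡ 0ℚ
  root i = *-integral (s i - r) (zeros (s i)) (λ e → ι≢0 i (trans (sym (lem r (ι (suc i)))) e))

-- A first-order difference equation without rational solution.

-- With R = P / Q the equation reads α(x) R(x-1) + N(x) = β(x) R(x).  At x = 0 it forces a pole of R at 0
-- or at -1, and at the other integers it propagates that pole to the right of 0 or to the left of -1.
-- At the end of the resulting run of zeros of Q, the polynomials P and Q have a common root.
no-rational-solution : ∀ {d Q P α β N} → IsPoly d Q → Poly P → Poly α → Poly β → Poly N →
  α 0ℚ ≡ 0ℚ → β 0ℚ ≡ 0ℚ → N 0ℚ ≢ 0ℚ →
  (∀ k → α (ι (suc k)) ≢ 0ℚ) → (∀ k → β (- ι (suc k)) ≢ 0ℚ) →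
  (∀ x → α x * (P (x - 1ℚ) * Q x) + N x * (Q x * Q (x - 1ℚ)) ≡ β x * (P x * Q (x - 1ℚ))) →
  ∀ x → Q x ≡ 0ℚ
no-rational-solution (zeroP z) _ _ _ _ _ _ _ _ _ _ = z
no-rational-solution {suc d} {Q} {P} {α} {β} {N} isQ isP isα isβ isN α0 β0 N0 α≢0 β≢0 eq = result
  where
  open ≡-Reasoning

  -- A common root is divided out. The equation for the quotients is first obtained multiplied by
  -- `x - r` and `x - (1ℚ + r)`; both factors are cancelled, and the recursion continues with a
  -- denominator of smaller index.
  reduce : ∀ r → Q r ≡ 0ℚ → P r ≡ 0ℚ → ∀ x → Q x ≡ 0ℚ
  reduce r Qr Pr with factor-root r isQ Qr | factor-root-Poly r isP Pr
  ... | Q₁ , isQ₁ , eqQ | P₁ , isP₁ , eqP = λ x → trans (eqQ x) (trans (cong ((x - r) *_) (Q₁≡0 x)) (ℚₚ.*-zeroʳ (x - r)))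
    where
    F : ℚ → ℚ
    F x = α x * (P₁ (x - 1ℚ) * Q₁ x) + N x * (Q₁ x * Q₁ (x - 1ℚ)) - β x * (P₁ x * Q₁ (x - 1ℚ))
    isF : Poly F
    isF = Poly-- (Poly-+ (Poly-* isα (Poly-* (Poly-pred isP₁) (d , isQ₁)))
                         (Poly-* isN (Poly-* (d , isQ₁) (Poly-pred (d , isQ₁)))))
                 (Poly-* isβ (Poly-* isP₁ (Poly-pred (d , isQ₁))))
    lem : ∀ u v a b n p p′ q q′ →
      u * (v * (a * (p′ * q) + n * (q * q′) - b * (p * q′))) ≡
      (a * ((v * p′) * (u * q)) + n * ((u * q) * (v * q′))) - b * ((u * p) * (v * q′))
    lem = solve-∀ ℚ-ring
    shift : ∀ x r → x - (1ℚ + r) ≡ x - 1ℚ - r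
    shift = solve-∀ ℚ-ring
    vanish : ∀ x → (x - r) * ((x - (1ℚ + r)) * F x) ≡ 0ℚ
    vanish x = trans (cong (λ v → (x - r) * (v * F x)) (shift x r)) (trans (lem (x - r) (x - 1ℚ - r) (α x) (β x) (N x) (P₁ x) (P₁ (x - 1ℚ)) (Q₁ x) (Q₁ (x - 1ℚ)))
      (trans (cong₂ _-_
        (cong₂ _+_ (cong (α x *_) (cong₂ _*_ (sym (eqP (x - 1ℚ))) (sym (eqQ x))))
                   (cong (N x *_) (cong₂ _*_ (sym (eqQ x)) (sym (eqQ (x - 1ℚ))))))
        (cong (β x *_) (cong₂ _*_ (sym (eqP x)) (sym (eqQ (x - 1ℚ))))))
      (p≡q⇒p-q≡0 (eq x))))
    F≡0 : ∀ x → F x ≡ 0ℚ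
    F≡0 = cancel-linear (1ℚ + r) isF (cancel-linear r (Poly-* (Poly-- Poly-id (Poly-const (1ℚ + r))) isF) vanish)
    Q₁≡0 : ∀ x → Q₁ x ≡ 0ℚ
    Q₁≡0 = no-rational-solution isQ₁ isP₁ isα isβ isN α0 β0 N0 α≢0 β≢0 (λ x → p-q≡0⇒p≡q _ _ (F≡0 x))

  -- If `Q` vanishes at 0, ..., k but not at k + 1, then at x = k + 1 the factor `Q (x - 1ℚ)` kills
  -- the `N` term and the right-hand side. What remains, `α x * (P (ι k) * Q x)`, is 0, so k is a
  -- common root.
  upwards : Q 0ℚ ≡ 0ℚ → ∀ x → Q x ≡ 0ℚ
  upwards Q0 = [ id , run ]′ (firstNonroot ι ι-injective isQ)
    where
    lem : ∀ y → 1ℚ + y - 1ℚ ≡ y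
    lem = solve-∀ ℚ-ring
    lem₁ : ∀ a n q → a ≡ a + n * (q * 0ℚ)
    lem₁ = solve-∀ ℚ-ring
    lem₂ : ∀ b p → b * (p * 0ℚ) ≡ 0ℚ
    lem₂ = solve-∀ ℚ-ring
    main : ∀ k x → x - 1ℚ ≡ ι k → Q (ι k) ≡ 0ℚ → α x * (P (ι k) * Q x) ≡ 0ℚ
    main k x x-1 Qk = begin
      α x * (P (ι k) * Q x)                                      ≡⟨ lem₁ (α x * (P (ι k) * Q x)) (N x) (Q x) ⟩
      α x * (P (ι k) * Q x) + N x * (Q x * 0ℚ)                   ≡⟨ cong₂ (λ u v → α x * (P u * Q x) + N x * (Q x * v)) x-1 (trans (cong Q x-1) Qk) ⟨
      α x * (P (x - 1ℚ) * Q x) + N x * (Q x * Q (x - 1ℚ))        ≡⟨ eq x ⟩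
      β x * (P x * Q (x - 1ℚ))                                   ≡⟨ cong (λ v → β x * (P x * v)) (trans (cong Q x-1) Qk) ⟩
      β x * (P x * 0ℚ)                                           ≡⟨ lem₂ (β x) (P x) ⟩
      0ℚ                                                         ∎
    run : (∃ λ i → Q (ι i) ≢ 0ℚ × (∀ j → j ℕ.< i → Q (ι j) ≡ 0ℚ)) → ∀ x → Q x ≡ 0ℚ
    run (zero , Q≢0 , _) = contradiction Q0 Q≢0
    run (suc k , Q≢0 , below) = reduce (ι k) Qk
      (*-integralʳ (Q (ι (suc k))) (*-integral (α (ι (suc k))) (main k (ι (suc k)) (lem (ι k)) Qk) (α≢0 k)) Q≢0)
      where
      Qk : Q (ι k) ≡ 0ℚ
      Qk = below k (ℕₚ.n<1+n k)

  -- If `Q` vanishes at -1, ..., -(k + 1) but not at -(k + 2), then at x = -(k + 1) the left-hand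
  -- side vanishes, so `β x * (P x * Q (x - 1ℚ))` is 0 and x is a common root.
  downwards : Q (- ι 1) ≡ 0ℚ → ∀ x → Q x ≡ 0ℚ
  downwards Q-1 = [ id , run ]′ (firstNonroot s s-injective isQ)
    where
    s : ℕ → ℚ
    s i = - ι (suc i)
    s-injective : ∀ {i j} → s i ≡ s j → i ≡ j
    s-injective {i} {j} e = ℕₚ.suc-injective (ι-injective {suc i} {suc j} (ℚₚ.neg-injective e))
    lem₁ : ∀ y → - y - 1ℚ ≡ - (1ℚ + y)
    lem₁ = solve-∀ ℚ-ring
    lem : ∀ a n p q → a * (p * 0ℚ) + n * (0ℚ * q) ≡ 0ℚ
    lem = solve-∀ ℚ-ring
    main : ∀ x y → x - 1ℚ ≡ y → Q x ≡ 0ℚ → β x * (P x * Q y) ≡ 0ℚ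
    main x y x-1 Qx = begin
      β x * (P x * Q y)                                          ≡⟨ cong (λ v → β x * (P x * Q v)) x-1 ⟨
      β x * (P x * Q (x - 1ℚ))                                   ≡⟨ eq x ⟨
      α x * (P (x - 1ℚ) * Q x) + N x * (Q x * Q (x - 1ℚ))        ≡⟨ cong (λ v → α x * (P (x - 1ℚ) * v) + N x * (v * Q (x - 1ℚ))) Qx ⟩
      α x * (P (x - 1ℚ) * 0ℚ) + N x * (0ℚ * Q (x - 1ℚ))          ≡⟨ lem (α x) (N x) (P (x - 1ℚ)) (Q (x - 1ℚ)) ⟩
      0ℚ                                                         ∎
    run : (∃ λ i → Q (s i) ≢ 0ℚ × (∀ j → j ℕ.< i → Q (s j) ≡ 0ℚ)) → ∀ x → Q x ≡ 0ℚ
    run (zero , Q≢0 , _) = contradiction Q-1 Q≢0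
    run (suc k , Q≢0 , below) = reduce (s k) Qs
      (*-integralʳ (Q (s (suc k))) (*-integral (β (s k)) (main (s k) (s (suc k)) (lem₁ (ι (suc k))) Qs) (β≢0 k)) Q≢0)
      where
      Qs : Q (s k) ≡ 0ℚ
      Qs = below k (ℕₚ.n<1+n k)

  at-zero : Q 0ℚ * Q (- ι 1) ≡ 0ℚ
  at-zero = *-integral (N 0ℚ) (begin
    N 0ℚ * (Q 0ℚ * Q (0ℚ - 1ℚ))                                                   ≡⟨ lem (P (0ℚ - 1ℚ) * Q 0ℚ) (N 0ℚ * (Q 0ℚ * Q (0ℚ - 1ℚ))) ⟩
    0ℚ * (P (0ℚ - 1ℚ) * Q 0ℚ) + N 0ℚ * (Q 0ℚ * Q (0ℚ - 1ℚ))                       ≡⟨ cong (λ a → a * (P (0ℚ - 1ℚ) * Q 0ℚ) + N 0ℚ * (Q 0ℚ * Q (0ℚ - 1ℚ))) α0 ⟨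
    α 0ℚ * (P (0ℚ - 1ℚ) * Q 0ℚ) + N 0ℚ * (Q 0ℚ * Q (0ℚ - 1ℚ))                     ≡⟨ eq 0ℚ ⟩
    β 0ℚ * (P 0ℚ * Q (0ℚ - 1ℚ))                                                   ≡⟨ cong (_* (P 0ℚ * Q (0ℚ - 1ℚ))) β0 ⟩
    0ℚ * (P 0ℚ * Q (0ℚ - 1ℚ))                                                     ≡⟨ ℚₚ.*-zeroˡ (P 0ℚ * Q (0ℚ - 1ℚ)) ⟩
    0ℚ                                                                            ∎) N0
    where
    lem : ∀ u v → v ≡ 0ℚ * u + v
    lem = solve-∀ ℚ-ring

  result : ∀ x → Q x ≡ 0ℚ
  result with Q 0ℚ ℚₚ.≟ 0ℚ
  ... | yes Q0 = upwards Q0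
  ... | no Q0  = downwards (*-integral (Q 0ℚ) at-zero Q0)

-- Inequalities in ℚ.

*-monoˡ : ∀ r {p q} → 0ℚ ≤ r → p ≤ q → r * p ≤ r * q
*-monoˡ r 0≤r p≤q = ℚₚ.*-monoˡ-≤-nonNeg r {{nonNegative 0≤r}} p≤q

*-monoʳ : ∀ r {p q} → 0ℚ ≤ r → p ≤ q → p * r ≤ q * r
*-monoʳ r 0≤r p≤q = ℚₚ.*-monoʳ-≤-nonNeg r {{nonNegative 0≤r}} p≤q

*-mono : ∀ {p q r s} → 0ℚ ≤ q → 0ℚ ≤ r → p ≤ q → r ≤ s → p * r ≤ q * s
*-mono {q = q} {r} 0≤q 0≤r p≤q r≤s = ℚₚ.≤-trans (*-monoʳ r 0≤r p≤q) (*-monoˡ q 0≤q r≤s)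

0≤* : ∀ {p q} → 0ℚ ≤ p → 0ℚ ≤ q → 0ℚ ≤ p * q
0≤* {p} {q} 0≤p 0≤q = ℚₚ.≤-trans (ℚₚ.≤-reflexive (sym (ℚₚ.*-zeroʳ p))) (*-monoˡ p 0≤p 0≤q)

0≤+ : ∀ {p q} → 0ℚ ≤ p → 0ℚ ≤ q → 0ℚ ≤ p + q
0≤+ 0≤p 0≤q = ℚₚ.+-mono-≤ 0≤p 0≤q

0≤^ : ∀ {x} n → 0ℚ ≤ x → 0ℚ ≤ x ^ℚ n
0≤^ zero    _   = 0≤1
0≤^ (suc n) 0≤x = 0≤* 0≤x (0≤^ n 0≤x)

0≤q-p⇒p≤q : ∀ {p q} → 0ℚ ≤ q - p → p ≤ q
0≤q-p⇒p≤q {p} {q} 0≤ = ℚₚ.≤-trans (ℚₚ.≤-reflexive (sym (ℚₚ.+-identityʳ p)))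
  (ℚₚ.≤-trans (ℚₚ.+-monoʳ-≤ p 0≤) (ℚₚ.≤-reflexive (lem p q)))
  where
  lem : ∀ p q → p + (q - p) ≡ q
  lem = solve-∀ ℚ-ring

p≤p+q : ∀ {p q} → 0ℚ ≤ q → p ≤ p + q
p≤p+q {p} 0≤q = ℚₚ.≤-trans (ℚₚ.≤-reflexive (sym (ℚₚ.+-identityʳ p))) (ℚₚ.+-monoʳ-≤ p 0≤q)

-- Finite sums

sumTo-cong : ∀ {f g : ℕ → ℚ} n → (∀ i → i ℕ.< n → f i ≡ g i) → sumTo f n ≡ sumTo g n
sumTo-cong zero    eq = refl
sumTo-cong (suc n) eq = cong₂ _+_ (sumTo-cong n (λ i i<n → eq i (ℕₚ.m<n⇒m<1+n i<n))) (eq n (ℕₚ.n<1+n n))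

sumTo-+ : ∀ (f g : ℕ → ℚ) n → sumTo (λ i → f i + g i) n ≡ sumTo f n + sumTo g n
sumTo-+ f g zero    = refl
sumTo-+ f g (suc n) = trans (cong (_+ (f n + g n)) (sumTo-+ f g n)) (lem (sumTo f n) (sumTo g n) (f n) (g n))
  where
  lem : ∀ a b c d → (a + b) + (c + d) ≡ (a + c) + (b + d)
  lem = solve-∀ ℚ-ring

sumTo-*ˡ : ∀ c (f : ℕ → ℚ) n → sumTo (λ i → c * f i) n ≡ c * sumTo f n
sumTo-*ˡ c f zero    = sym (ℚₚ.*-zeroʳ c)
sumTo-*ˡ c f (suc n) = trans (cong (_+ c * f n) (sumTo-*ˡ c f n)) (sym (ℚₚ.*-distribˡ-+ c (sumTo f n) (f n)))

sumTo-0 : ∀ {f : ℕ → ℚ} n → (∀ i → i ℕ.< n → f i ≡ 0ℚ) → sumTo f n ≡ 0ℚ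
sumTo-0 zero    eq = refl
sumTo-0 (suc n) eq = cong₂ _+_ (sumTo-0 n (λ i i<n → eq i (ℕₚ.m<n⇒m<1+n i<n))) (eq n (ℕₚ.n<1+n n))

if-< : ∀ {m n} {x y : ℚ} → m ℕ.< n → (if m ℕ.<ᵇ n then x else y) ≡ x
if-< {zero}  {suc n} _           = refl
if-< {suc m} {suc n} (ℕ.s≤s m<n) = if-< {m} {n} m<n

if-≥ : ∀ {m n} {x y : ℚ} → n ℕ.≤ m → (if m ℕ.<ᵇ n then x else y) ≡ y
if-≥ {zero}  {zero}  _           = refl
if-≥ {suc m} {zero}  _           = refl
if-≥ {suc m} {suc n} (ℕ.s≤s n≤m) = if-≥ {m} {n} n≤m

sumBetween-empty : ∀ lo hi f → hi ℕ.≤ suc lo → sumBetween lo hi f ≡ 0ℚ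
sumBetween-empty lo hi f hi≤ = sumTo-0 hi (λ i i<hi → if-≥ {lo} {i} (ℕ.s≤s⁻¹ (ℕₚ.≤-trans i<hi hi≤)))

sumBetween-last : ∀ lo hi f → lo ℕ.< hi → sumBetween lo (suc hi) f ≡ sumBetween lo hi f + f hi
sumBetween-last lo hi f lo<hi = cong (_+_ (sumBetween lo hi f)) (if-< {lo} {hi} lo<hi)

sumBetween-first : ∀ lo hi f → suc lo ℕ.< hi → sumBetween lo hi f ≡ f (suc lo) + sumBetween (suc lo) hi f
sumBetween-first lo (suc hi) f (ℕ.s≤s lo<hi) = go (ℕₚ.m≤n⇒m<n∨m≡n lo<hi)
  where
  go : suc lo ℕ.< hi ⊎ suc lo ≡ hi → sumBetween lo (suc hi) f ≡ f (suc lo) + sumBetween (suc lo) (suc hi) f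
  go (inj₁ lt) = trans (sumBetween-last lo hi f lo<hi) (trans (cong (_+ f hi) (sumBetween-first lo hi f lt))
    (trans (ℚₚ.+-assoc (f (suc lo)) (sumBetween (suc lo) hi f) (f hi)) (cong (_+_ (f (suc lo))) (sym (sumBetween-last (suc lo) hi f lt)))))
  go (inj₂ refl) = trans (sumBetween-last lo hi f lo<hi)
    (trans (cong (_+ f hi) (sumBetween-empty lo hi f ℕₚ.≤-refl))
      (trans (ℚₚ.+-comm 0ℚ (f hi)) (cong (_+_ (f hi)) (sym (sumBetween-empty (suc lo) (suc hi) f ℕₚ.≤-refl)))))

-- One induction for two sums over the same range; equality, nonnegativity and scaling are instances
-- of `R`.
sumBetween-rec : ∀ {ℓ} (R : ℚ → ℚ → Set ℓ) {f g : ℕ → ℚ} {lo} → R 0ℚ 0ℚ →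
  (∀ {a b} k → lo ℕ.< k → R a b → R (a + f k) (b + g k)) → ∀ hi → R (sumBetween lo hi f) (sumBetween lo hi g)
sumBetween-rec R base step zero = base
sumBetween-rec R {f} {g} {lo} base step (suc hi) = go (ℕₚ.<-≤-connex lo hi)
  where
  go : lo ℕ.< hi ⊎ hi ℕ.≤ lo → R (sumBetween lo (suc hi) f) (sumBetween lo (suc hi) g)
  go (inj₁ lt) = subst (λ a → R a _) (sym (sumBetween-last lo hi f lt)) (subst (R _) (sym (sumBetween-last lo hi g lt))
    (step hi lt (sumBetween-rec R base step hi)))
  go (inj₂ ge) = subst (λ a → R a _) (sym (sumBetween-empty lo (suc hi) f (ℕ.s≤s ge))) (subst (R _) (sym (sumBetween-empty lo (suc hi) g (ℕ.s≤s ge))) base)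

sumBetween-cong : ∀ {f g : ℕ → ℚ} {lo} hi → (∀ k → lo ℕ.< k → f k ≡ g k) → sumBetween lo hi f ≡ sumBetween lo hi g
sumBetween-cong hi eq = sumBetween-rec _≡_ refl (λ k lt e → cong₂ _+_ e (eq k lt)) hi

sumBetween-nonneg : ∀ {f : ℕ → ℚ} {lo} hi → (∀ k → lo ℕ.< k → 0ℚ ≤ f k) → 0ℚ ≤ sumBetween lo hi f
sumBetween-nonneg {f} {lo} hi le = sumBetween-rec (λ a _ → 0ℚ ≤ a) {f} {f} {lo} ℚₚ.≤-refl (λ k lt e → 0≤+ e (le k lt)) hi

sumBetween-*ˡ : ∀ c (f : ℕ → ℚ) {lo} hi → sumBetween lo hi (λ k → c * f k) ≡ c * sumBetween lo hi f
sumBetween-*ˡ c f hi = sumBetween-rec (λ a b → a ≡ c * b) (sym (ℚₚ.*-zeroʳ c))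
  (λ {a} {b} k _ e → trans (cong (_+ c * f k) e) (sym (ℚₚ.*-distribˡ-+ c b (f k)))) hi

sumBetween-+ : ∀ (f g : ℕ → ℚ) {lo} hi → sumBetween lo hi (λ k → f k + g k) ≡ sumBetween lo hi f + sumBetween lo hi g
sumBetween-+ f g {lo} hi = trans (sumTo-cong hi (λ k _ → if-+ k)) (sumTo-+ (λ k → if lo ℕ.<ᵇ k then f k else 0ℚ) (λ k → if lo ℕ.<ᵇ k then g k else 0ℚ) hi)
  where
  if-+ : ∀ k → (if lo ℕ.<ᵇ k then f k + g k else 0ℚ) ≡ (if lo ℕ.<ᵇ k then f k else 0ℚ) + (if lo ℕ.<ᵇ k then g k else 0ℚ)
  if-+ k with lo ℕ.<ᵇ k
  ... | Data.Bool.true  = refl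
  ... | Data.Bool.false = refl

-- Null sequences

-- Same ε-form as `ZetaEq`, so that `ZetaEq a b n` is literally `Null` of the difference of the
-- partial sums.
Null : (ℕ → ℚ) → Set
Null f = ∀ (ε : ℚ) → 0ℚ < ε → Σ ℕ λ M → ∀ N → M ℕ.≤ N → ∣ f N ∣ < ε

-- Agreement from some index on is the useful form: splitting off the index `suc n` is an exact
-- identity only once `N` is at least `suc n`.
Null-≡ : ∀ {f g} M → (∀ N → M ℕ.≤ N → g N ≡ f N) → Null f → Null g
Null-≡ {f} {g} M₀ eq null ε 0<ε = go (null ε 0<ε)
  where
  go : (Σ ℕ λ M → ∀ N → M ℕ.≤ N → ∣ f N ∣ < ε) → Σ ℕ λ M → ∀ N → M ℕ.≤ N → ∣ g N ∣ < ε
  go (M , small) = M ℕ.+ M₀ , λ N le →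
    subst (λ y → ∣ y ∣ < ε) (sym (eq N (ℕₚ.≤-trans (ℕₚ.m≤n+m M₀ M) le))) (small N (ℕₚ.≤-trans (ℕₚ.m≤m+n M M₀) le))

Null-0 : Null (λ _ → 0ℚ)
Null-0 ε 0<ε = 0 , λ _ _ → 0<ε

halve : ∀ ε → 0ℚ < ε → 0ℚ < recip 2 * ε
halve ε 0<ε = ℚₚ.≤-<-trans (ℚₚ.≤-reflexive (sym (ℚₚ.*-zeroʳ (recip 2)))) (ℚₚ.*-monoʳ-<-pos (recip 2) 0<ε)

halves : ∀ ε → recip 2 * ε + recip 2 * ε ≡ ε
halves ε = trans (sym (ℚₚ.*-distribʳ-+ ε (recip 2) (recip 2))) (ℚₚ.*-identityˡ ε)

Null-+ : ∀ {f g} → Null f → Null g → Null (λ N → f N + g N)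
Null-+ {f} {g} nf ng ε 0<ε = go (nf (recip 2 * ε) (halve ε 0<ε)) (ng (recip 2 * ε) (halve ε 0<ε))
  where
  go : (Σ ℕ λ M → ∀ N → M ℕ.≤ N → ∣ f N ∣ < recip 2 * ε) → (Σ ℕ λ M → ∀ N → M ℕ.≤ N → ∣ g N ∣ < recip 2 * ε) →
       Σ ℕ λ M → ∀ N → M ℕ.≤ N → ∣ f N + g N ∣ < ε
  go (M , sf) (M′ , sg) = M ℕ.+ M′ , λ N le →
    ℚₚ.≤-<-trans (ℚₚ.∣p+q∣≤∣p∣+∣q∣ (f N) (g N))
      (ℚₚ.<-≤-trans (ℚₚ.+-mono-< (sf N (ℕₚ.≤-trans (ℕₚ.m≤m+n M M′) le)) (sg N (ℕₚ.≤-trans (ℕₚ.m≤n+m M′ M) le)))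
        (ℚₚ.≤-reflexive (halves ε)))

divide : ∀ c ε → 0ℚ < c → 0ℚ < ε → ∃ λ δ → 0ℚ < δ × c * δ ≡ ε
divide c ε 0<c 0<ε = 1/ c * ε , pos , trans (sym (ℚₚ.*-assoc c (1/ c) ε)) (trans (cong (_* ε) (ℚₚ.*-inverseʳ c)) (ℚₚ.*-identityˡ ε))
  where
  instance
    c-pos = positive 0<c
    c-nz  = ℚₚ.pos⇒nonZero c {{positive 0<c}}
  pos : 0ℚ < 1/ c * ε
  pos = ℚₚ.≤-<-trans (ℚₚ.≤-reflexive (sym (ℚₚ.*-zeroʳ (1/ c)))) (ℚₚ.*-monoʳ-<-pos (1/ c) {{ℚₚ.1/pos⇒pos c}} 0<ε)

Null-* : ∀ c {f} → Null f → Null (λ N → c * f N)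
-- `1ℚ + ∣ c ∣` rather than `∣ c ∣` stays positive when `c` is 0.
Null-* c {f} nf ε 0<ε = go (divide (1ℚ + ∣ c ∣) ε 0<c 0<ε)
  where
  0<c : 0ℚ < 1ℚ + ∣ c ∣
  0<c = ℚₚ.+-mono-<-≤ 0<1 (ℚₚ.0≤∣p∣ c)
  go : (∃ λ δ → 0ℚ < δ × (1ℚ + ∣ c ∣) * δ ≡ ε) → Σ ℕ λ M → ∀ N → M ℕ.≤ N → ∣ c * f N ∣ < ε
  go (δ , 0<δ , eq) = proj₁ (nf δ 0<δ) , λ N le →
    ℚₚ.≤-<-trans (ℚₚ.≤-reflexive (ℚₚ.∣p*q∣≡∣p∣*∣q∣ c (f N)))
    (ℚₚ.≤-<-trans (*-monoʳ ∣ f N ∣ (ℚₚ.0≤∣p∣ (f N)) (ℚₚ.≤-trans (ℚₚ.≤-reflexive (sym (ℚₚ.+-identityˡ ∣ c ∣))) (ℚₚ.+-monoˡ-≤ ∣ c ∣ 0≤1)))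
    (ℚₚ.<-≤-trans (ℚₚ.*-monoʳ-<-pos (1ℚ + ∣ c ∣) {{positive 0<c}} (proj₂ (nf δ 0<δ) N le)) (ℚₚ.≤-reflexive eq)))

Null-- : ∀ {f g} → Null f → Null g → Null (λ N → f N - g N)
Null-- {f} {g} nf ng = Null-≡ 0 (λ N _ → lem (f N) (g N)) (Null-+ nf (Null-* (- 1ℚ) ng))
  where
  lem : ∀ u v → u - v ≡ u + (- 1ℚ) * v
  lem = solve-∀ ℚ-ring

Null-const : ∀ {c} → Null (λ _ → c) → c ≡ 0ℚ
Null-const {c} null = go (c ℚₚ.≟ 0ℚ)
  where
  go : _ → c ≡ 0ℚ
  go (yes c≡0) = c≡0
  go (no c≢0)  = contradiction (proj₂ small (proj₁ small) ℕₚ.≤-refl) (ℚₚ.<-irrefl refl)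
    where
    0<∣c∣ : 0ℚ < ∣ c ∣
    0<∣c∣ = ℚₚ.≰⇒> (λ le → c≢0 (ℚₚ.∣p∣≡0⇒p≡0 c (ℚₚ.≤-antisym le (ℚₚ.0≤∣p∣ c))))
    small = null ∣ c ∣ 0<∣c∣

-- Reciprocal binomial coefficients

nC0≡1 : ∀ n → n C 0 ≡ 1
nC0≡1 n = trans (nCk≡nC[n∸k] {k = 0} {n = n} ℕ.z≤n) (nCn≡1 n)

absorption : ∀ n k → suc k ℕ.* (suc n C suc k) ≡ suc n ℕ.* (n C k)
absorption zero    zero    = refl
absorption zero    (suc k) = trans (cong (suc (suc k) ℕ.*_) (k>n⇒nCk≡0 {1} {suc (suc k)} (ℕ.s≤s (ℕ.s≤s ℕ.z≤n))))
  (trans (ℕₚ.*-zeroʳ (suc (suc k))) (sym (cong (1 ℕ.*_) (k>n⇒nCk≡0 {0} {suc k} (ℕ.s≤s ℕ.z≤n)))))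
absorption (suc n) zero    = trans (ℕₚ.*-identityˡ (suc (suc n) C 1)) (trans (sym (nCk+nC[k+1]≡[n+1]C[k+1] (suc n) 0))
  (trans (cong₂ ℕ._+_ (nC0≡1 (suc n)) (trans (sym (ℕₚ.*-identityˡ (suc n C 1))) (trans (absorption n 0) (trans (cong (suc n ℕ.*_) (nC0≡1 n)) (ℕₚ.*-identityʳ (suc n))))))
    (sym (trans (cong (suc (suc n) ℕ.*_) (nC0≡1 (suc n))) (ℕₚ.*-identityʳ (suc (suc n)))))))
absorption (suc n) (suc k) = begin
  suc (suc k) ℕ.* (suc (suc n) C suc (suc k))
    ≡⟨ cong (suc (suc k) ℕ.*_) (nCk+nC[k+1]≡[n+1]C[k+1] (suc n) (suc k)) ⟨
  suc (suc k) ℕ.* (X ℕ.+ (suc n C suc (suc k)))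
    ≡⟨ ℕₚ.*-distribˡ-+ (suc (suc k)) X (suc n C suc (suc k)) ⟩
  (X ℕ.+ suc k ℕ.* X) ℕ.+ suc (suc k) ℕ.* (suc n C suc (suc k))
    ≡⟨ cong₂ (λ u v → (X ℕ.+ u) ℕ.+ v) (absorption n k) (absorption n (suc k)) ⟩
  (X ℕ.+ suc n ℕ.* (n C k)) ℕ.+ suc n ℕ.* (n C suc k)
    ≡⟨ ℕₚ.+-assoc X (suc n ℕ.* (n C k)) (suc n ℕ.* (n C suc k)) ⟩
  X ℕ.+ (suc n ℕ.* (n C k) ℕ.+ suc n ℕ.* (n C suc k))
    ≡⟨ cong (X ℕ.+_) (ℕₚ.*-distribˡ-+ (suc n) (n C k) (n C suc k)) ⟨
  X ℕ.+ suc n ℕ.* ((n C k) ℕ.+ (n C suc k))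
    ≡⟨ cong (λ v → X ℕ.+ suc n ℕ.* v) (nCk+nC[k+1]≡[n+1]C[k+1] n k) ⟩
  X ℕ.+ suc n ℕ.* X ∎
  where
  open ≡-Reasoning
  X = suc n C suc k

[k+m]Cm≡[k+m]Ck : ∀ k m → (k ℕ.+ m) C m ≡ (k ℕ.+ m) C k
[k+m]Cm≡[k+m]Ck k m = trans (nCk≡nC[n∸k] (ℕₚ.m≤n+m m k)) (cong ((k ℕ.+ m) C_) (ℕₚ.m+n∸n≡m k m))

raise-lower : ∀ k m → suc m ℕ.* ((k ℕ.+ suc m) C suc m) ≡ suc (k ℕ.+ m) ℕ.* ((k ℕ.+ m) C m)
raise-lower k m = trans (cong (λ v → suc m ℕ.* (v C suc m)) (ℕₚ.+-suc k m)) (absorption (k ℕ.+ m) m)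

raise-upper : ∀ k m → suc k ℕ.* ((suc k ℕ.+ m) C m) ≡ suc (k ℕ.+ m) ℕ.* ((k ℕ.+ m) C m)
raise-upper k m = trans (cong (suc k ℕ.*_) ([k+m]Cm≡[k+m]Ck (suc k) m))
  (trans (absorption (k ℕ.+ m) k) (cong (suc (k ℕ.+ m) ℕ.*_) (sym ([k+m]Cm≡[k+m]Ck k m))))

[k+m]Cm≢0 : ∀ k m → (k ℕ.+ m) C m ≢ 0
[k+m]Cm≢0 zero    m eq = case trans (sym (nCn≡1 m)) eq of λ ()
[k+m]Cm≢0 (suc k) m eq = [k+m]Cm≢0 k m (ℕₚ.*-cancelˡ-≡ _ 0 (suc (k ℕ.+ m))
  (trans (sym (raise-upper k m)) (trans (cong (suc k ℕ.*_) eq) (trans (ℕₚ.*-zeroʳ (suc k)) (sym (ℕₚ.*-zeroʳ (suc (k ℕ.+ m))))))))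

-- The kernel of the double tail: `m` is the binomial parameter, `k` the largest summation index. On
-- the diagonal, `h n n` is the tail of the empty composition.
h : ℕ → ℕ → ℚ
h m k = recip ((k ℕ.+ m) C m)

recip-cross : ∀ {s t A B} → B ≢ 0 → A ≢ 0 → s ℕ.* A ≡ t ℕ.* B → recip A * ι t ≡ recip B * ι s
recip-cross {B = zero} B≢0 _ _ = contradiction refl B≢0
recip-cross {A = zero} _ A≢0 _ = contradiction refl A≢0
recip-cross {s} {t} {suc A} {suc B} _ _ eq = begin
  a * ι t                                  ≡⟨ lem₁ a (ι t) ⟩
  a * ι t * 1ℚ                             ≡⟨ cong (a * ι t *_) (ι-recip B) ⟨
  a * ι t * (ι (suc B) * b)                ≡⟨ lem₂ a (ι t) (ι (suc B)) b ⟩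
  a * b * (ι t * ι (suc B))                ≡⟨ cong (a * b *_) (trans (sym (ι-* t (suc B))) (trans (cong ι (sym eq)) (ι-* s (suc A)))) ⟩
  a * b * (ι s * ι (suc A))                ≡⟨ lem₃ a b (ι s) (ι (suc A)) ⟩
  b * ι s * (ι (suc A) * a)                ≡⟨ cong (b * ι s *_) (ι-recip A) ⟩
  b * ι s * 1ℚ                             ≡⟨ lem₁ b (ι s) ⟨
  b * ι s                                  ∎
  where
  open ≡-Reasoning
  a = recip (suc A)
  b = recip (suc B)
  lem₁ : ∀ a t → a * t ≡ a * t * 1ℚ
  lem₁ = solve-∀ ℚ-ring
  lem₂ : ∀ a t B b → a * t * (B * b) ≡ a * b * (t * B)
  lem₂ = solve-∀ ℚ-ring
  lem₃ : ∀ a b s A → a * b * (s * A) ≡ b * s * (A * a)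
  lem₃ = solve-∀ ℚ-ring

h-lower : ∀ m k → h (suc m) k * ι (suc (k ℕ.+ m)) ≡ h m k * ι (suc m)
h-lower m k = recip-cross {suc m} {suc (k ℕ.+ m)} ([k+m]Cm≢0 k m) ([k+m]Cm≢0 k (suc m)) (raise-lower k m)

h-upper : ∀ m k → h m (suc k) * ι (suc (k ℕ.+ m)) ≡ h m k * ι (suc k)
h-upper m k = recip-cross {suc k} {suc (k ℕ.+ m)} ([k+m]Cm≢0 k m) ([k+m]Cm≢0 (suc k) m) (raise-upper k m)

h≢0 : ∀ m k → h m k ≢ 0ℚ
h≢0 m k = go ((k ℕ.+ m) C m) ([k+m]Cm≢0 k m)
  where
  go : ∀ A → A ≢ 0 → recip A ≢ 0ℚ
  go zero    A≢0 = contradiction refl A≢0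
  go (suc A) _   = <⇒≢0 (0<recip A)

0≤h : ∀ m k → 0ℚ ≤ h m k
0≤h m k = 0≤recip ((k ℕ.+ m) C m)

pred-ι : ∀ n → ι (suc n) - 1ℚ ≡ ι n
pred-ι n = lem (ι n)
  where
  lem : ∀ y → 1ℚ + y - 1ℚ ≡ y
  lem = solve-∀ ℚ-ring

recip-ι : ∀ n → recip (suc n) * ι (suc n) ≡ 1ℚ
recip-ι n = trans (ℚₚ.*-comm (recip (suc n)) (ι (suc n))) (ι-recip n)

h-diagonal-half : ∀ n → h (suc n) n ≡ h (suc n) (suc n) + h (suc n) (suc n)
h-diagonal-half n = *-cancelˡ-≢0 (ι (suc n)) (ι≢0 n) (begin
  ι (suc n) * h (suc n) n                                       ≡⟨ ℚₚ.*-comm (ι (suc n)) (h (suc n) n) ⟩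
  h (suc n) n * ι (suc n)                                       ≡⟨ h-upper (suc n) n ⟨
  h (suc n) (suc n) * ι (suc n ℕ.+ suc n)                       ≡⟨ cong (h (suc n) (suc n) *_) (ι-+ (suc n) (suc n)) ⟩
  h (suc n) (suc n) * (ι (suc n) + ι (suc n))                   ≡⟨ lem (ι (suc n)) (h (suc n) (suc n)) ⟩
  ι (suc n) * (h (suc n) (suc n) + h (suc n) (suc n))           ∎)
  where
  open ≡-Reasoning
  lem : ∀ x y → y * (x + x) ≡ x * (y + y)
  lem = solve-∀ ℚ-ring

4x-2 : ℚ → ℚ
4x-2 x = (x + x - 1ℚ) + (x + x - 1ℚ)

h-diagonal : ∀ n → ι (suc n) * h n n ≡ 4x-2 (ι (suc n)) * h (suc n) (suc n)
h-diagonal n = begin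
  ι (suc n) * h n n                                             ≡⟨ ℚₚ.*-comm (ι (suc n)) (h n n) ⟩
  h n n * ι (suc n)                                             ≡⟨ h-lower n n ⟨
  h (suc n) n * ι (suc n ℕ.+ n)                                 ≡⟨ cong₂ _*_ (h-diagonal-half n) (ι-+ (suc n) n) ⟩
  (h (suc n) (suc n) + h (suc n) (suc n)) * (ι (suc n) + ι n)   ≡⟨ lem (ι n) (h (suc n) (suc n)) ⟩
  4x-2 (ι (suc n)) * h (suc n) (suc n)                          ∎
  where
  open ≡-Reasoning
  lem : ∀ x y → (y + y) * ((1ℚ + x) + x) ≡ (((1ℚ + x) + (1ℚ + x) - 1ℚ) + ((1ℚ + x) + (1ℚ + x) - 1ℚ)) * y
  lem = solve-∀ ℚ-ring

-- Apéry-like sums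

-- The list (d₁, …, d_l) encodes the exponents d₁+1, …, d_{l-1}+1, d_l+2: the exponent next to the
-- central binomial coefficient is never 1.
exponent : ℕ → List ℕ → ℕ
exponent d []      = suc (suc d)
exponent d (_ ∷ _) = suc d

-- The head of the list belongs to the smallest index, so passing from n to n + 1 splits off the
-- head. All indices are cut at `N`, like those of the truncated tails.
Y : List ℕ → ℕ → ℕ → ℚ
Y []      n N = h n n
Y (d ∷ J) n N = sumBetween n (suc N) (λ m → recip m ^ℚ exponent d J * Y J m N)

Y-step : ∀ d J n N → suc n ℕ.≤ N → Y (d ∷ J) n N ≡ Y (d ∷ J) (suc n) N + recip (suc n) ^ℚ exponent d J * Y J (suc n) N
Y-step d J n N n<N = trans (sumBetween-first n (suc N) (λ m → recip m ^ℚ exponent d J * Y J m N) (ℕ.s≤s n<N))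
  (ℚₚ.+-comm (recip (suc n) ^ℚ exponent d J * Y J (suc n) N) (Y (d ∷ J) (suc n) N))

sumTo-first : ∀ (f : ℕ → ℚ) n → sumTo f (suc n) ≡ f 0 + sumTo (f ∘ suc) n
sumTo-first f zero    = ℚₚ.+-comm 0ℚ (f 0)
sumTo-first f (suc n) = trans (cong (_+ f (suc n)) (sumTo-first f n)) (ℚₚ.+-assoc (f 0) (sumTo (f ∘ suc) n) (f (suc n)))

sumTo-truncate : ∀ (f : ℕ → ℚ) {m n} → m ℕ.≤ n → (∀ i → m ℕ.≤ i → i ℕ.< n → f i ≡ 0ℚ) → sumTo f n ≡ sumTo f m
sumTo-truncate f {m} {zero}  ℕ.z≤n zeros = refl
sumTo-truncate f {m} {suc n} m≤n zeros = go (ℕₚ.m≤n⇒m<n∨m≡n m≤n)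
  where
  go : m ℕ.< suc n ⊎ m ≡ suc n → sumTo f (suc n) ≡ sumTo f m
  go (inj₂ refl) = refl
  go (inj₁ (ℕ.s≤s m≤n)) = trans (cong₂ _+_ (sumTo-truncate f m≤n (λ i l u → zeros i l (ℕₚ.m<n⇒m<1+n u))) (zeros n m≤n (ℕₚ.n<1+n n)))
    (ℚₚ.+-identityʳ (sumTo f m))

-- For selecting, among the terms c_j n^(-j) of the final equation, the one with the highest pole at
-- 0.
last-nonzero : ∀ (c : ℕ → ℚ) B d → d ℕ.< B → c d ≢ 0ℚ →
  ∃ λ d* → d* ℕ.< B × c d* ≢ 0ℚ × (∀ i → d* ℕ.< i → i ℕ.< B → c i ≡ 0ℚ)
last-nonzero c (suc B) d d<B cd≢0 = go (c B ℚₚ.≟ 0ℚ) (ℕₚ.m≤n⇒m<n∨m≡n (ℕ.s≤s⁻¹ d<B))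
  where
  go : _ → d ℕ.< B ⊎ d ≡ B → _
  go (no c≢0)  _           = B , ℕₚ.n<1+n B , c≢0 , λ i l u → contradiction (ℕ.s≤s⁻¹ u) (ℕₚ.<⇒≱ l)
  go (yes c≡0) (inj₂ refl) = contradiction c≡0 cd≢0
  go (yes c≡0) (inj₁ d<B) with last-nonzero c B d d<B cd≢0
  ... | d* , d*<B , c≢0 , zeros = d* , ℕₚ.m<n⇒m<1+n d*<B , c≢0 , λ i l u → up i l (ℕₚ.m≤n⇒m<n∨m≡n (ℕ.s≤s⁻¹ u))
    where
    up : ∀ i → d* ℕ.< i → i ℕ.< B ⊎ i ≡ B → c i ≡ 0ℚ
    up i l (inj₁ u)    = zeros i l u
    up i l (inj₂ refl) = c≡0

-- Linear relations indexed by trees of exponent lists, and their shift in n.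

module Layers (B : ℕ) where

  data In : ℕ → List ℕ → Set where
    nil  : In 0 []
    cons : ∀ {i d J} → d ℕ.< B → In i J → In (suc i) (d ∷ J)

  layer : ℕ → List (List ℕ)
  layer zero    = [] ∷ []
  layer (suc i) = cartesianProductWith _∷_ (upTo B) (layer i)

  In⇒∈layer : ∀ {i J} → In i J → J ∈ layer i
  In⇒∈layer nil             = here refl
  In⇒∈layer (cons d<B inJ) = ∈-cartesianProductWith⁺ _∷_ (∈-upTo⁺ d<B) (In⇒∈layer inJ)

  ∈layer⇒In : ∀ i {J} → J ∈ layer i → In i J
  ∈layer⇒In zero    (here refl) = nil
  ∈layer⇒In (suc i) J∈ with ∈-cartesianProductWith⁻ _∷_ (upTo B) (layer i) J∈
  ... | d , J , d∈ , J∈′ , refl = cons (∈-upTo⁻ d∈) (∈layer⇒In i J∈′)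

  -- The sum over heads `d` is innermost, so the siblings `d ∷ J` of one parent `J` are already
  -- grouped as the recurrence of the `Y` requires.
  layerSum : ℕ → (List ℕ → ℚ) → ℚ
  layerSum zero    f = f []
  layerSum (suc i) f = layerSum i (λ J → sumTo (λ d → f (d ∷ J)) B)

  treeSum : ℕ → (List ℕ → ℚ) → ℚ
  treeSum L f = sumTo (λ i → layerSum i f) (suc L)

  layerSum-cong : ∀ i {f g : List ℕ → ℚ} → (∀ J → In i J → f J ≡ g J) → layerSum i f ≡ layerSum i g
  layerSum-cong zero    eq = eq [] nil
  layerSum-cong (suc i) eq = layerSum-cong i (λ J inJ → sumTo-cong B (λ d d<B → eq (d ∷ J) (cons d<B inJ)))

  layerSum-+ : ∀ i (f g : List ℕ → ℚ) → layerSum i (λ J → f J + g J) ≡ layerSum i f + layerSum i g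
  layerSum-+ zero    f g = refl
  layerSum-+ (suc i) f g = trans (layerSum-cong i (λ J _ → sumTo-+ (λ d → f (d ∷ J)) (λ d → g (d ∷ J)) B))
    (layerSum-+ i (λ J → sumTo (λ d → f (d ∷ J)) B) (λ J → sumTo (λ d → g (d ∷ J)) B))

  layerSum-*ˡ : ∀ i c (f : List ℕ → ℚ) → layerSum i (λ J → c * f J) ≡ c * layerSum i f
  layerSum-*ˡ zero    c f = refl
  layerSum-*ˡ (suc i) c f = trans (layerSum-cong i (λ J _ → sumTo-*ˡ c (λ d → f (d ∷ J)) B))
    (layerSum-*ˡ i c (λ J → sumTo (λ d → f (d ∷ J)) B))

  layerSum-0 : ∀ i {f : List ℕ → ℚ} → (∀ J → In i J → f J ≡ 0ℚ) → layerSum i f ≡ 0ℚ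
  layerSum-0 zero    eq = eq [] nil
  layerSum-0 (suc i) eq = layerSum-0 i (λ J inJ → sumTo-0 B (λ d d<B → eq (d ∷ J) (cons d<B inJ)))

  treeSum-cong : ∀ L {f g : List ℕ → ℚ} → (∀ i J → In i J → f J ≡ g J) → treeSum L f ≡ treeSum L g
  treeSum-cong L eq = sumTo-cong (suc L) (λ i _ → layerSum-cong i (eq i))

  treeSum-+ : ∀ L (f g : List ℕ → ℚ) → treeSum L (λ J → f J + g J) ≡ treeSum L f + treeSum L g
  treeSum-+ L f g = trans (sumTo-cong (suc L) (λ i _ → layerSum-+ i f g)) (sumTo-+ (λ i → layerSum i f) (λ i → layerSum i g) (suc L))

  treeSum-*ˡ : ∀ L c (f : List ℕ → ℚ) → treeSum L (λ J → c * f J) ≡ c * treeSum L f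
  treeSum-*ˡ L c f = trans (sumTo-cong (suc L) (λ i _ → layerSum-*ˡ i c f)) (sumTo-*ˡ c (λ i → layerSum i f) (suc L))

  treeSum-children : ∀ L (f : List ℕ → ℚ) → treeSum (suc L) f ≡ f [] + treeSum L (λ J → sumTo (λ d → f (d ∷ J)) B)
  treeSum-children L f = sumTo-first (λ i → layerSum i f) (suc L)

  -- Multiplying by W₀ clears the denominators of the recurrences of all Y J in the tree at once; κ and cofactor
  -- are the resulting polynomial coefficients.
  W₀ : ℚ → ℚ
  W₀ x = x * (x * x ^ℚ B)

  κ : List ℕ → ℚ → ℚ
  κ []      x = 4x-2 x * (x * x ^ℚ B)
  κ (_ ∷ _) x = W₀ x

  cofactor : ℕ → List ℕ → ℚ → ℚ
  cofactor d []      x = x ^ℚ (B ℕ.∸ d)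
  cofactor d (_ ∷ _) x = x * x ^ℚ (B ℕ.∸ d)

  ^-inverse : ∀ n d → ι (suc n) ^ℚ d * recip (suc n) ^ℚ d ≡ 1ℚ
  ^-inverse n zero    = refl
  ^-inverse n (suc d) = trans (lem (ι (suc n)) (ι (suc n) ^ℚ d) (recip (suc n)) (recip (suc n) ^ℚ d))
    (cong₂ _*_ (ι-recip n) (^-inverse n d))
    where
    lem : ∀ x y z w → x * y * (z * w) ≡ (x * z) * (y * w)
    lem = solve-∀ ℚ-ring

  x^B-split : ∀ x {d} → d ℕ.≤ B → x ^ℚ B ≡ x ^ℚ (B ℕ.∸ d) * x ^ℚ d
  x^B-split x {d} d≤B = trans (cong (x ^ℚ_) (sym (ℕₚ.m∸n+n≡m d≤B))) (^ℚ-+ x (B ℕ.∸ d) d)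

  W₀-recip : ∀ n d J → d ℕ.< B → W₀ (ι (suc n)) * recip (suc n) ^ℚ exponent d J ≡ cofactor d J (ι (suc n))
  W₀-recip n d J d<B = go J
    where
    x = ι (suc n)
    r = recip (suc n)
    c = x ^ℚ (B ℕ.∸ d)
    open ≡-Reasoning
    lem₁ : ∀ x r c p q → x * (x * (c * p)) * (r * (r * q)) ≡ c * ((x * r) * (x * r)) * (p * q)
    lem₁ = solve-∀ ℚ-ring
    lem₂ : ∀ x r c p q → x * (x * (c * p)) * (r * q) ≡ x * c * (x * r) * (p * q)
    lem₂ = solve-∀ ℚ-ring
    lem₃ : ∀ c → c * (1ℚ * 1ℚ) * 1ℚ ≡ c
    lem₃ = solve-∀ ℚ-ring
    lem₄ : ∀ c → c * 1ℚ * 1ℚ ≡ c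
    lem₄ = solve-∀ ℚ-ring
    go : ∀ J → W₀ x * r ^ℚ exponent d J ≡ cofactor d J x
    go [] = begin
      x * (x * x ^ℚ B) * (r * (r * r ^ℚ d))             ≡⟨ cong (λ y → x * (x * y) * (r * (r * r ^ℚ d))) (x^B-split x (ℕₚ.<⇒≤ d<B)) ⟩
      x * (x * (c * x ^ℚ d)) * (r * (r * r ^ℚ d))       ≡⟨ lem₁ x r c (x ^ℚ d) (r ^ℚ d) ⟩
      c * ((x * r) * (x * r)) * (x ^ℚ d * r ^ℚ d)       ≡⟨ cong₂ (λ u v → c * (u * u) * v) (ι-recip n) (^-inverse n d) ⟩
      c * (1ℚ * 1ℚ) * 1ℚ                                ≡⟨ lem₃ c ⟩
      c                                                 ∎
    go (_ ∷ _) = begin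
      x * (x * x ^ℚ B) * (r * r ^ℚ d)                   ≡⟨ cong (λ y → x * (x * y) * (r * r ^ℚ d)) (x^B-split x (ℕₚ.<⇒≤ d<B)) ⟩
      x * (x * (c * x ^ℚ d)) * (r * r ^ℚ d)             ≡⟨ lem₂ x r c (x ^ℚ d) (r ^ℚ d) ⟩
      x * c * (x * r) * (x ^ℚ d * r ^ℚ d)               ≡⟨ cong₂ (λ u v → x * c * u * v) (ι-recip n) (^-inverse n d) ⟩
      x * c * 1ℚ * 1ℚ                                   ≡⟨ lem₄ (x * c) ⟩
      x * c                                             ∎

  Coeffs : Set
  Coeffs = List ℕ → ℚ → ℚ

  relation : ℕ → Coeffs → ℕ → ℕ → ℚ
  relation L P n N = treeSum L (λ J → P J (ι n) * Y J n N)

  children : Coeffs → List ℕ → ℚ → ℚ → ℚ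
  children P J x y = sumTo (λ d → cofactor d J x * P (d ∷ J) y) B

  -- For `x = ι (suc n)` and `y = ι n` this is the coefficient of `Y J (suc n)` in `W₀ x` times the
  -- relation at `n`: the contribution of `J` itself plus what the `d ∷ J` pass on to their parent.
  shifted : Coeffs → List ℕ → ℚ → ℚ → ℚ
  shifted P J x y = κ J x * P J y + children P J x y

  VanishesAbove : ℕ → Coeffs → Set
  VanishesAbove L P = ∀ i J → L ℕ.< i → In i J → ∀ x → P J x ≡ 0ℚ

  children-vanish : ∀ {L P} → VanishesAbove L P → ∀ i J → L ℕ.≤ i → In i J → ∀ x y → children P J x y ≡ 0ℚ
  children-vanish {L} {P} van i J L≤i inJ x y = sumTo-0 B (λ d d<B →
    trans (cong (cofactor d J x *_) (van (suc i) (d ∷ J) (ℕ.s≤s L≤i) (cons d<B inJ) y)) (ℚₚ.*-zeroʳ (cofactor d J x)))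

  relation-shift : ∀ {L P} → VanishesAbove (suc L) P → ∀ n N → suc n ℕ.≤ N →
    W₀ (ι (suc n)) * relation (suc L) P n N ≡ treeSum (suc L) (λ J → shifted P J (ι (suc n)) (ι n) * Y J (suc n) N)
  relation-shift {L} {P} van n N n<N = begin
    W₀ x * relation (suc L) P n N
      ≡⟨ treeSum-*ˡ (suc L) (W₀ x) (λ J → P J (ι n) * Y J n N) ⟨
    treeSum (suc L) (λ J → W₀ x * (P J (ι n) * Y J n N))
      ≡⟨ treeSum-cong (suc L) each ⟩
    treeSum (suc L) (λ J → κ J x * P J (ι n) * Y J (suc n) N + rest J)
      ≡⟨ treeSum-+ (suc L) (λ J → κ J x * P J (ι n) * Y J (suc n) N) rest ⟩
    treeSum (suc L) (λ J → κ J x * P J (ι n) * Y J (suc n) N) + treeSum (suc L) rest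
      ≡⟨ cong (_+_ (treeSum (suc L) (λ J → κ J x * P J (ι n) * Y J (suc n) N))) regroup ⟩
    treeSum (suc L) (λ J → κ J x * P J (ι n) * Y J (suc n) N) + treeSum (suc L) (λ J → children P J x (ι n) * Y J (suc n) N)
      ≡⟨ treeSum-+ (suc L) (λ J → κ J x * P J (ι n) * Y J (suc n) N) (λ J → children P J x (ι n) * Y J (suc n) N) ⟨
    treeSum (suc L) (λ J → κ J x * P J (ι n) * Y J (suc n) N + children P J x (ι n) * Y J (suc n) N)
      ≡⟨ treeSum-cong (suc L) (λ _ J _ → sym (ℚₚ.*-distribʳ-+ (Y J (suc n) N) (κ J x * P J (ι n)) (children P J x (ι n)))) ⟩
    treeSum (suc L) (λ J → shifted P J x (ι n) * Y J (suc n) N) ∎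
    where
    open ≡-Reasoning
    x = ι (suc n)
    -- What `Y (d ∷ J)` contributes to `Y J` when its first index is split off; `regroup` collects
    -- it at the parent.
    rest : List ℕ → ℚ
    rest []      = 0ℚ
    rest (d ∷ J) = cofactor d J x * P (d ∷ J) (ι n) * Y J (suc n) N
    lem₁ : ∀ w p y z r → w * (p * (y + r * z)) ≡ w * p * y + w * r * p * z
    lem₁ = solve-∀ ℚ-ring
    lem₂ : ∀ x c p z → x * (x * c) * (p * z) ≡ p * (x * c) * (x * z)
    lem₂ = solve-∀ ℚ-ring
    lem₃ : ∀ x c p z k → p * (x * c) * (k * z) ≡ k * (x * c) * p * z + 0ℚ
    lem₃ = solve-∀ ℚ-ring
    each : ∀ i J → In i J → W₀ x * (P J (ι n) * Y J n N) ≡ κ J x * P J (ι n) * Y J (suc n) N + rest J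
    each _ [] _ = trans (lem₂ x (x ^ℚ B) (P [] (ι n)) (h n n))
      (trans (cong (P [] (ι n) * (x * x ^ℚ B) *_) (h-diagonal n))
        (lem₃ x (x ^ℚ B) (P [] (ι n)) (h (suc n) (suc n)) (4x-2 x)))
    each _ (d ∷ J) (cons d<B _) = trans (cong (λ y → W₀ x * (P (d ∷ J) (ι n) * y)) (Y-step d J n N n<N))
      (trans (lem₁ (W₀ x) (P (d ∷ J) (ι n)) (Y (d ∷ J) (suc n) N) (Y J (suc n) N) (recip (suc n) ^ℚ exponent d J))
        (cong (λ c → W₀ x * P (d ∷ J) (ι n) * Y (d ∷ J) (suc n) N + c * P (d ∷ J) (ι n) * Y J (suc n) N) (W₀-recip n d J d<B)))
    sum-rest : ∀ J → sumTo (λ d → rest (d ∷ J)) B ≡ children P J x (ι n) * Y J (suc n) N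
    sum-rest J = trans (sumTo-cong B (λ d _ → ℚₚ.*-comm (cofactor d J x * P (d ∷ J) (ι n)) (Y J (suc n) N)))
      (trans (sumTo-*ˡ (Y J (suc n) N) (λ d → cofactor d J x * P (d ∷ J) (ι n)) B) (ℚₚ.*-comm (Y J (suc n) N) (children P J x (ι n))))
    -- The coefficients vanish above the top layer, so its lists receive nothing from children, and
    -- the sum over parents may be extended from depth `L` to `suc L`.
    top : layerSum (suc L) (λ J → children P J x (ι n) * Y J (suc n) N) ≡ 0ℚ
    top = layerSum-0 (suc L) (λ J inJ → trans (cong (_* Y J (suc n) N) (children-vanish van (suc L) J ℕₚ.≤-refl inJ x (ι n))) (ℚₚ.*-zeroˡ (Y J (suc n) N)))
    regroup : treeSum (suc L) rest ≡ treeSum (suc L) (λ J → children P J x (ι n) * Y J (suc n) N)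
    regroup = trans (treeSum-children L rest) (trans (ℚₚ.+-identityˡ (treeSum L (λ J → sumTo (λ d → rest (d ∷ J)) B)))
      (trans (treeSum-cong L (λ _ J _ → sum-rest J))
        (trans (sym (ℚₚ.+-identityʳ (treeSum L (λ J → children P J x (ι n) * Y J (suc n) N))))
          (cong (_+_ (treeSum L (λ J → children P J x (ι n) * Y J (suc n) N))) (sym top)))))

-- Linear independence of the Apéry-like sums over ℚ[n]

module Elimination (B : ℕ) where

  open Layers B

  -- The coefficients of Q(n) R(n-1) − Q(n-1) R(n) for the relation R given by P: when Q is a coefficient of the
  -- top layer, that coefficient is eliminated.
  cross : Coeffs → (ℚ → ℚ) → Coeffs
  cross P Q J x = Q x * shifted P J x (x - 1ℚ) - W₀ x * (Q (x - 1ℚ) * P J x)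

  Poly-W₀ : Poly W₀
  Poly-W₀ = Poly-*x (Poly-*x (Poly-^ B))

  Poly-4x-2 : Poly 4x-2
  Poly-4x-2 = Poly-+ p p
    where p = Poly-- (Poly-+ Poly-id Poly-id) (Poly-const 1ℚ)

  Poly-κ : ∀ J → Poly (κ J)
  Poly-κ []      = Poly-* Poly-4x-2 (Poly-*x (Poly-^ B))
  Poly-κ (_ ∷ _) = Poly-W₀

  Poly-cofactor : ∀ d J → Poly (cofactor d J)
  Poly-cofactor d []      = Poly-^ (B ℕ.∸ d)
  Poly-cofactor d (_ ∷ _) = Poly-*x (Poly-^ (B ℕ.∸ d))

  Poly-cross : ∀ {P Q} → (∀ J → Poly (P J)) → Poly Q → ∀ J → Poly (cross P Q J)
  Poly-cross isP isQ J = Poly--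
    (Poly-* isQ (Poly-+ (Poly-* (Poly-κ J) (Poly-pred (isP J)))
                        (Poly-sumTo B (λ d → Poly-* (Poly-cofactor d J) (Poly-pred (isP (d ∷ J)))))))
    (Poly-* Poly-W₀ (Poly-* (Poly-pred isQ) (isP J)))

  cross-zero : ∀ P Q J x → P J x ≡ 0ℚ → P J (x - 1ℚ) ≡ 0ℚ → children P J x (x - 1ℚ) ≡ 0ℚ → cross P Q J x ≡ 0ℚ
  cross-zero P Q J x p p′ c = trans
    (cong₂ (λ u v → Q x * u - W₀ x * (Q (x - 1ℚ) * v)) (cong₂ (λ u v → κ J x * u + v) p′ c) p)
    (lem (Q x) (κ J x) (W₀ x) (Q (x - 1ℚ)))
    where
    lem : ∀ q k w q′ → q * (k * 0ℚ + 0ℚ) - w * (q′ * 0ℚ) ≡ 0ℚ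
    lem = solve-∀ ℚ-ring

  cross-vanishes : ∀ {L P} Q → VanishesAbove L P → VanishesAbove L (cross P Q)
  cross-vanishes {L} {P} Q van i J L<i inJ x = cross-zero P Q J x (van i J L<i inJ x) (van i J L<i inJ (x - 1ℚ))
    (children-vanish van i J (ℕₚ.<⇒≤ L<i) inJ x (x - 1ℚ))

  -- The crossed relation at n + 1 combines the original ones at n and n + 1; it is null when both
  -- are, hence from one index later on.
  cross-relation : ∀ {L P} Q → VanishesAbove (suc L) P → ∀ n N → suc n ℕ.≤ N →
    relation (suc L) (cross P Q) (suc n) N ≡
    Q (ι (suc n)) * W₀ (ι (suc n)) * relation (suc L) P n N
      + (- (W₀ (ι (suc n)) * Q (ι n))) * relation (suc L) P (suc n) N
  cross-relation {L} {P} Q van n N n<N = begin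
    treeSum (suc L) (λ J → cross P Q J x * Y J (suc n) N)
      ≡⟨ treeSum-cong (suc L) each ⟩
    treeSum (suc L) (λ J → Q x * (S J * Y J (suc n) N) + w * (P J x * Y J (suc n) N))
      ≡⟨ treeSum-+ (suc L) (λ J → Q x * (S J * Y J (suc n) N)) (λ J → w * (P J x * Y J (suc n) N)) ⟩
    treeSum (suc L) (λ J → Q x * (S J * Y J (suc n) N)) + treeSum (suc L) (λ J → w * (P J x * Y J (suc n) N))
      ≡⟨ cong₂ _+_ (treeSum-*ˡ (suc L) (Q x) (λ J → S J * Y J (suc n) N)) (treeSum-*ˡ (suc L) w (λ J → P J x * Y J (suc n) N)) ⟩
    Q x * treeSum (suc L) (λ J → S J * Y J (suc n) N) + w * relation (suc L) P (suc n) N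
      ≡⟨ cong (λ y → Q x * y + w * relation (suc L) P (suc n) N) (relation-shift van n N n<N) ⟨
    Q x * (W₀ x * relation (suc L) P n N) + w * relation (suc L) P (suc n) N
      ≡⟨ cong (_+ w * relation (suc L) P (suc n) N) (sym (ℚₚ.*-assoc (Q x) (W₀ x) (relation (suc L) P n N))) ⟩
    Q x * W₀ x * relation (suc L) P n N + w * relation (suc L) P (suc n) N ∎
    where
    open ≡-Reasoning
    x = ι (suc n)
    w = - (W₀ x * Q (ι n))
    S : List ℕ → ℚ
    S J = shifted P J x (ι n)
    lem : ∀ q s w q′ p y → (q * s - w * (q′ * p)) * y ≡ q * (s * y) + (- (w * q′)) * (p * y)
    lem = solve-∀ ℚ-ring
    each : ∀ i J → In i J → cross P Q J x * Y J (suc n) N ≡ Q x * (S J * Y J (suc n) N) + w * (P J x * Y J (suc n) N)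
    each _ J _ = trans
      (cong (λ y → (Q x * shifted P J x y - W₀ x * (Q y * P J x)) * Y J (suc n) N) (pred-ι n))
      (lem (Q x) (S J) (W₀ x) (Q (ι n)) (P J x) (Y J (suc n) N))

  W₀≢0 : ∀ n → W₀ (ι (suc n)) ≢ 0ℚ
  W₀≢0 n = *-≢0 (ι≢0 n) (*-≢0 (ι≢0 n) (^ℚ≢0 B (ι≢0 n)))

  cofactor≢0 : ∀ d J n → cofactor d J (ι (suc n)) ≢ 0ℚ
  cofactor≢0 d []      n = ^ℚ≢0 (B ℕ.∸ d) (ι≢0 n)
  cofactor≢0 d (_ ∷ _) n = *-≢0 (ι≢0 n) (^ℚ≢0 (B ℕ.∸ d) (ι≢0 n))

  -- The quotients of κ J and W₀ by cofactor d J.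
  κ/cofactor : ℕ → List ℕ → ℚ → ℚ
  κ/cofactor d []      x = 4x-2 x * (x * x ^ℚ d)
  κ/cofactor d (_ ∷ _) x = x * x ^ℚ d

  W₀/cofactor : ℕ → List ℕ → ℚ → ℚ
  W₀/cofactor d []      x = x * (x * x ^ℚ d)
  W₀/cofactor d (_ ∷ _) x = x * x ^ℚ d

  W₀-factor : ∀ {d} J x → d ℕ.≤ B → W₀ x ≡ cofactor d J x * W₀/cofactor d J x
  W₀-factor {d} []      x d≤B = trans (cong (λ y → x * (x * y)) (x^B-split x d≤B)) (lem x (x ^ℚ (B ℕ.∸ d)) (x ^ℚ d))
    where
    lem : ∀ x c p → x * (x * (c * p)) ≡ c * (x * (x * p))
    lem = solve-∀ ℚ-ring
  W₀-factor {d} (_ ∷ _) x d≤B = trans (cong (λ y → x * (x * y)) (x^B-split x d≤B)) (lem x (x ^ℚ (B ℕ.∸ d)) (x ^ℚ d))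
    where
    lem : ∀ x c p → x * (x * (c * p)) ≡ (x * c) * (x * p)
    lem = solve-∀ ℚ-ring

  κ-factor : ∀ {d} J x → d ℕ.≤ B → κ J x ≡ cofactor d J x * κ/cofactor d J x
  κ-factor {d} []      x d≤B = trans (cong (λ y → 4x-2 x * (x * y)) (x^B-split x d≤B)) (lem x (4x-2 x) (x ^ℚ (B ℕ.∸ d)) (x ^ℚ d))
    where
    lem : ∀ x k c p → k * (x * (c * p)) ≡ c * (k * (x * p))
    lem = solve-∀ ℚ-ring
  κ-factor {d} (j ∷ J) x d≤B = W₀-factor (j ∷ J) x d≤B

  cofactor-factor : ∀ {d d*} J x → d ℕ.≤ d* → d* ℕ.≤ B → cofactor d J x ≡ cofactor d* J x * x ^ℚ (d* ℕ.∸ d)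
  cofactor-factor {d} {d*} J x d≤d* d*≤B = go J
    where
    split : B ℕ.∸ d ≡ (B ℕ.∸ d*) ℕ.+ (d* ℕ.∸ d)
    split = trans (cong (ℕ._∸ d) (sym (ℕₚ.m∸n+n≡m d*≤B))) (ℕₚ.+-∸-assoc (B ℕ.∸ d*) d≤d*)
    pow : x ^ℚ (B ℕ.∸ d) ≡ x ^ℚ (B ℕ.∸ d*) * x ^ℚ (d* ℕ.∸ d)
    pow = trans (cong (x ^ℚ_) split) (^ℚ-+ x (B ℕ.∸ d*) (d* ℕ.∸ d))
    go : ∀ J → cofactor d J x ≡ cofactor d* J x * x ^ℚ (d* ℕ.∸ d)
    go []      = pow
    go (_ ∷ _) = trans (cong (x *_) pow) (sym (ℚₚ.*-assoc x (x ^ℚ (B ℕ.∸ d*)) (x ^ℚ (d* ℕ.∸ d))))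

  Poly-κ/cofactor : ∀ d J → Poly (κ/cofactor d J)
  Poly-κ/cofactor d []      = Poly-* Poly-4x-2 (Poly-*x (Poly-^ d))
  Poly-κ/cofactor d (_ ∷ _) = Poly-*x (Poly-^ d)

  Poly-W₀/cofactor : ∀ d J → Poly (W₀/cofactor d J)
  Poly-W₀/cofactor d []      = Poly-*x (Poly-*x (Poly-^ d))
  Poly-W₀/cofactor d (_ ∷ _) = Poly-*x (Poly-^ d)

  κ/cofactor-0 : ∀ d J → κ/cofactor d J 0ℚ ≡ 0ℚ
  κ/cofactor-0 d []      = trans (cong (4x-2 0ℚ *_) (ℚₚ.*-zeroˡ (0ℚ ^ℚ d))) (ℚₚ.*-zeroʳ (4x-2 0ℚ))
  κ/cofactor-0 d (_ ∷ _) = ℚₚ.*-zeroˡ (0ℚ ^ℚ d)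

  W₀/cofactor-0 : ∀ d J → W₀/cofactor d J 0ℚ ≡ 0ℚ
  W₀/cofactor-0 d []      = ℚₚ.*-zeroˡ (0ℚ * 0ℚ ^ℚ d)
  W₀/cofactor-0 d (_ ∷ _) = ℚₚ.*-zeroˡ (0ℚ ^ℚ d)

  -- This coefficient carries the pole to the right of 0; `4x-2` vanishes only at 1/2, so no
  -- positive integer stops it.
  κ/cofactor≢0 : ∀ d J k → κ/cofactor d J (ι (suc k)) ≢ 0ℚ
  κ/cofactor≢0 d (_ ∷ _) k = *-≢0 (ι≢0 k) (^ℚ≢0 d (ι≢0 k))
  κ/cofactor≢0 d []      k = *-≢0 4x-2≢0 (*-≢0 (ι≢0 k) (^ℚ≢0 d (ι≢0 k)))
    where
    lem : ∀ y → ((1ℚ + y) + (1ℚ + y) - 1ℚ) + ((1ℚ + y) + (1ℚ + y) - 1ℚ) ≡ (1ℚ + (y + y)) + (1ℚ + (y + y))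
    lem = solve-∀ ℚ-ring
    pos : 0ℚ < 1ℚ + (ι k + ι k)
    pos = ℚₚ.+-mono-<-≤ 0<1 (0≤+ (0≤ι k) (0≤ι k))
    4x-2≢0 : 4x-2 (ι (suc k)) ≢ 0ℚ
    4x-2≢0 e = <⇒≢0 (ℚₚ.+-mono-< pos pos) (trans (sym (lem (ι k))) e)

  W₀/cofactor≢0 : ∀ d J k → W₀/cofactor d J (- ι (suc k)) ≢ 0ℚ
  W₀/cofactor≢0 d J k = go J
    where
    x = - ι (suc k)
    x≢0 : x ≢ 0ℚ
    x≢0 e = ι≢0 k (ℚₚ.neg-injective {ι (suc k)} {0ℚ} e)
    go : ∀ J → W₀/cofactor d J x ≢ 0ℚ
    go []      = *-≢0 x≢0 (*-≢0 x≢0 (^ℚ≢0 d x≢0))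
    go (_ ∷ _) = *-≢0 x≢0 (^ℚ≢0 d x≢0)

  -- All coefficients of the crossed relation vanish, so the siblings d ∷ J of d₀ ∷ J have coefficients constant
  -- multiples of Q, and the equation at J becomes an equation without rational solution.
  module Contradiction
    {L : ℕ} {P : Coeffs} (isP : ∀ J → Poly (P J)) (van : VanishesAbove (suc L) P)
    {d₀ : ℕ} {J : List ℕ} (d₀<B : d₀ ℕ.< B) (inJ : In L J)
    (cross≡0 : ∀ i K → In i K → ∀ x → cross P (P (d₀ ∷ J)) K x ≡ 0ℚ)
    (m : ℕ) (Q≢0 : ∀ n → m ℕ.≤ n → P (d₀ ∷ J) (ι n) ≢ 0ℚ)
    where

    open ≡-Reasoning

    Q : ℚ → ℚ
    Q = P (d₀ ∷ J)

    isQ : Poly Q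
    isQ = isP (d₀ ∷ J)

    q : ℚ
    q = Q (ι m)

    q≢0 : q ≢ 0ℚ
    q≢0 = Q≢0 m ℕₚ.≤-refl

    c : ℕ → ℚ
    c d = P (d ∷ J) (ι m)

    -- In the top layer the children contribute 0 and `κ` is `W₀`, so the vanishing cross
    -- coefficient says that `P (d ∷ J) / Q` has period 1.
    sibling-periodic : ∀ d → d ℕ.< B → ∀ n → Q (ι (suc n)) * P (d ∷ J) (ι n) ≡ Q (ι n) * P (d ∷ J) (ι (suc n))
    sibling-periodic d d<B n = *-cancelˡ-≢0 (W₀ x) (W₀≢0 n) (begin
      W₀ x * (Q x * P K (ι n))                                             ≡⟨ lem (W₀ x) (Q x) (P K (ι n)) ⟩
      Q x * (W₀ x * P K (ι n) + 0ℚ)                                        ≡⟨ cong₂ (λ y z → Q x * (W₀ x * P K y + z)) (pred-ι n) (children-vanish van (suc L) K ℕₚ.≤-refl (cons d<B inJ) x (x - 1ℚ)) ⟨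
      Q x * shifted P K x (x - 1ℚ)                                         ≡⟨ p-q≡0⇒p≡q (Q x * shifted P K x (x - 1ℚ)) (W₀ x * (Q (x - 1ℚ) * P K x)) (cross≡0 (suc L) K (cons d<B inJ) x) ⟩
      W₀ x * (Q (x - 1ℚ) * P K x)                                          ≡⟨ cong (λ y → W₀ x * (Q y * P K x)) (pred-ι n) ⟩
      W₀ x * (Q (ι n) * P K x)                                             ∎)
      where
      x = ι (suc n)
      K = d ∷ J
      lem : ∀ w q p → w * (q * p) ≡ q * (w * p + 0ℚ)
      lem = solve-∀ ℚ-ring

    sibling-multiple-at : ∀ d → d ℕ.< B → ∀ k → q * P (d ∷ J) (ι (m ℕ.+ k)) ≡ c d * Q (ι (m ℕ.+ k))
    sibling-multiple-at d d<B zero rewrite ℕₚ.+-identityʳ m = ℚₚ.*-comm q (c d)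
    sibling-multiple-at d d<B (suc k) rewrite ℕₚ.+-suc m k = *-cancelˡ-≢0 (Q (ι n)) (Q≢0 n (ℕₚ.m≤m+n m k)) (begin
      Q (ι n) * (q * P K (ι (suc n)))       ≡⟨ lem (Q (ι n)) q (P K (ι (suc n))) ⟩
      q * (Q (ι n) * P K (ι (suc n)))       ≡⟨ cong (q *_) (sibling-periodic d d<B n) ⟨
      q * (Q (ι (suc n)) * P K (ι n))       ≡⟨ lem q (Q (ι (suc n))) (P K (ι n)) ⟩
      Q (ι (suc n)) * (q * P K (ι n))       ≡⟨ cong (Q (ι (suc n)) *_) (sibling-multiple-at d d<B k) ⟩
      Q (ι (suc n)) * (c d * Q (ι n))       ≡⟨ lem₂ (Q (ι (suc n))) (c d) (Q (ι n)) ⟩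
      Q (ι n) * (c d * Q (ι (suc n)))       ∎)
      where
      n = m ℕ.+ k
      K = d ∷ J
      lem : ∀ a b c → a * (b * c) ≡ b * (a * c)
      lem = solve-∀ ℚ-ring
      lem₂ : ∀ a b c → a * (b * c) ≡ c * (b * a)
      lem₂ = solve-∀ ℚ-ring

    -- A rational function of period 1 is constant: the ratio is `c d / q` at every integer from `m`
    -- on, and polynomials that agree there agree everywhere.
    sibling-multiple : ∀ d → d ℕ.< B → ∀ x → q * P (d ∷ J) x ≡ c d * Q x
    sibling-multiple d d<B = eventually-≡⇒≡ m (Poly-scale q (isP (d ∷ J))) (Poly-scale (c d) isQ)
      (λ n m≤n → subst (λ n → q * P (d ∷ J) (ι n) ≡ c d * Q (ι n)) (ℕₚ.m+[n∸m]≡n m≤n) (sibling-multiple-at d d<B (n ℕ.∸ m)))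

    module _ (d* : ℕ) (d*<B : d* ℕ.< B) (c≢0 : c d* ≢ 0ℚ) (zeros : ∀ i → d* ℕ.< i → i ℕ.< B → c i ≡ 0ℚ) where

      d*≤B : d* ℕ.≤ B
      d*≤B = ℕₚ.<⇒≤ d*<B

      -- The inhomogeneous term ∑ c_d x^(-d), multiplied by x^(d*): its value at 0 is the nonzero
      -- coefficient `c d*` of the highest pole.
      N : ℚ → ℚ
      N x = sumTo (λ d → x ^ℚ (d* ℕ.∸ d) * c d) (suc d*)

      isN : Poly N
      isN = Poly-sumTo (suc d*) (λ d → Poly-* (Poly-^ (d* ℕ.∸ d)) (Poly-const (c d)))

      0^ : ∀ {k} → 0 ℕ.< k → 0ℚ ^ℚ k ≡ 0ℚ
      0^ {suc k} _ = ℚₚ.*-zeroˡ (0ℚ ^ℚ k)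

      N-0 : N 0ℚ ≡ c d*
      N-0 = trans (cong₂ _+_
          (sumTo-0 d* (λ d d<d* → trans (cong (_* c d) (0^ (ℕₚ.m<n⇒0<n∸m d<d*))) (ℚₚ.*-zeroˡ (c d))))
          (trans (cong (λ k → 0ℚ ^ℚ k * c d*) (ℕₚ.n∸n≡0 d*)) (ℚₚ.*-identityˡ (c d*))))
        (ℚₚ.+-identityˡ (c d*))

      children-N : ∀ x y → q * children P J x y ≡ cofactor d* J x * (N x * Q y)
      children-N x y = begin
        q * sumTo (λ d → cofactor d J x * P (d ∷ J) y) B
          ≡⟨ sumTo-*ˡ q (λ d → cofactor d J x * P (d ∷ J) y) B ⟨
        sumTo (λ d → q * (cofactor d J x * P (d ∷ J) y)) B
          ≡⟨ sumTo-cong B (λ d d<B → trans (lem₁ q (cofactor d J x) (P (d ∷ J) y)) (trans (cong (cofactor d J x *_) (sibling-multiple d d<B y)) (lem₂ (cofactor d J x) (c d) (Q y)))) ⟩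
        sumTo (λ d → Q y * (cofactor d J x * c d)) B
          ≡⟨ sumTo-truncate (λ d → Q y * (cofactor d J x * c d)) d*<B (λ i l u → trans (cong (λ z → Q y * (cofactor i J x * z)) (zeros i l u)) (lem₃ (Q y) (cofactor i J x))) ⟩
        sumTo (λ d → Q y * (cofactor d J x * c d)) (suc d*)
          ≡⟨ sumTo-cong (suc d*) (λ d d≤d* → trans (cong (λ z → Q y * (z * c d)) (cofactor-factor J x (ℕ.s≤s⁻¹ d≤d*) d*≤B)) (lem₄ (Q y) (cofactor d* J x) (x ^ℚ (d* ℕ.∸ d)) (c d))) ⟩
        sumTo (λ d → (cofactor d* J x * Q y) * (x ^ℚ (d* ℕ.∸ d) * c d)) (suc d*)
          ≡⟨ sumTo-*ˡ (cofactor d* J x * Q y) (λ d → x ^ℚ (d* ℕ.∸ d) * c d) (suc d*) ⟩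
        (cofactor d* J x * Q y) * N x
          ≡⟨ lem₅ (cofactor d* J x) (Q y) (N x) ⟩
        cofactor d* J x * (N x * Q y) ∎
        where
        lem₁ : ∀ a b c → a * (b * c) ≡ b * (a * c)
        lem₁ = solve-∀ ℚ-ring
        lem₂ : ∀ a b c → a * (b * c) ≡ c * (a * b)
        lem₂ = solve-∀ ℚ-ring
        lem₃ : ∀ a b → a * (b * 0ℚ) ≡ 0ℚ
        lem₃ = solve-∀ ℚ-ring
        lem₄ : ∀ a b c d → a * (b * c * d) ≡ (b * a) * (c * d)
        lem₄ = solve-∀ ℚ-ring
        lem₅ : ∀ a b c → a * b * c ≡ a * (c * b)
        lem₅ = solve-∀ ℚ-ring

      α β : ℚ → ℚ
      α x = q * κ/cofactor d* J x
      β x = q * W₀/cofactor d* J x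

      isα : Poly α
      isα = Poly-scale q (Poly-κ/cofactor d* J)

      isβ : Poly β
      isβ = Poly-scale q (Poly-W₀/cofactor d* J)

      -- The vanishing cross coefficient at the parent `J`, with every child rewritten as a multiple
      -- of `Q` and the common factor `cofactor d* J x` cancelled.
      equation-at : ∀ n → let x = ι (suc n) in
        α x * (P J (x - 1ℚ) * Q x) + N x * (Q x * Q (x - 1ℚ)) ≡ β x * (P J x * Q (x - 1ℚ))
      equation-at n = *-cancelˡ-≢0 g (cofactor≢0 d* J n) (begin
        g * (q * k * (p′ * q₁) + N x * (q₁ * q′))                         ≡⟨ lem₁ g q k p′ q₁ (N x) q′ ⟩
        q₁ * (q * (g * k * p′) + g * (N x * q′))                          ≡⟨ cong₂ (λ u v → q₁ * (q * (u * p′) + v)) (κ-factor J x d*≤B) (children-N x (x - 1ℚ)) ⟨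
        q₁ * (q * (κ J x * p′) + q * children P J x (x - 1ℚ))             ≡⟨ lem₂ q₁ q (κ J x * p′) (children P J x (x - 1ℚ)) ⟩
        q * (q₁ * shifted P J x (x - 1ℚ))                                 ≡⟨ cong (q *_) (p-q≡0⇒p≡q (q₁ * shifted P J x (x - 1ℚ)) (W₀ x * (q′ * P J x)) (cross≡0 L J inJ x)) ⟩
        q * (W₀ x * (q′ * P J x))                                         ≡⟨ cong (λ w → q * (w * (q′ * P J x))) (W₀-factor J x d*≤B) ⟩
        q * (g * W₀/cofactor d* J x * (q′ * P J x))                       ≡⟨ lem₃ q g (W₀/cofactor d* J x) q′ (P J x) ⟩
        g * (q * W₀/cofactor d* J x * (P J x * q′))                       ∎)
        where
        x = ι (suc n)
        g = cofactor d* J x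
        k = κ/cofactor d* J x
        p′ = P J (x - 1ℚ)
        q₁ = Q x
        q′ = Q (x - 1ℚ)
        lem₁ : ∀ g q k p′ q₁ n q′ → g * (q * k * (p′ * q₁) + n * (q₁ * q′)) ≡ q₁ * (q * (g * k * p′) + g * (n * q′))
        lem₁ = solve-∀ ℚ-ring
        lem₂ : ∀ a q u v → a * (q * u + q * v) ≡ q * (a * (u + v))
        lem₂ = solve-∀ ℚ-ring
        lem₃ : ∀ q g w q′ p → q * (g * w * (q′ * p)) ≡ g * (q * w * (p * q′))
        lem₃ = solve-∀ ℚ-ring

      equation : ∀ x → α x * (P J (x - 1ℚ) * Q x) + N x * (Q x * Q (x - 1ℚ)) ≡ β x * (P J x * Q (x - 1ℚ))
      equation = eventually-≡⇒≡ 1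
        (Poly-+ (Poly-* isα (Poly-* (Poly-pred (isP J)) isQ)) (Poly-* isN (Poly-* isQ (Poly-pred isQ))))
        (Poly-* isβ (Poly-* (isP J) (Poly-pred isQ)))
        (λ { (suc n) _ → equation-at n })

      impossible : ⊥
      -- `P J / Q` would be a rational solution, so the denominator is identically zero, against its
      -- value at `m`.
      impossible = q≢0 (no-rational-solution (proj₂ isQ) (isP J) isα isβ isN
        (trans (cong (q *_) (κ/cofactor-0 d* J)) (ℚₚ.*-zeroʳ q))
        (trans (cong (q *_) (W₀/cofactor-0 d* J)) (ℚₚ.*-zeroʳ q))
        (λ e → c≢0 (trans (sym N-0) e))
        (λ k → *-≢0 q≢0 (κ/cofactor≢0 d* J k))
        (λ k → *-≢0 q≢0 (W₀/cofactor≢0 d* J k))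
        equation (ι m))

    contradictory : ⊥
    contradictory = let d* , d*<B , c≢0 , zeros = last-nonzero c B d₀ d₀<B q≢0 in impossible d* d*<B c≢0 zeros

  -- Relations are assumed only from some `n₀` on, because every crossing loses one index.
  Independent : ℕ → Set
  Independent L = ∀ P → (∀ J → Poly (P J)) → VanishesAbove L P → ∀ n₀ → (∀ n → n₀ ℕ.≤ n → Null (relation L P n)) →
    ∀ i J → In i J → ∀ x → P J x ≡ 0ℚ

  -- Only `Y []` is left, which does not depend on the truncation, so null means zero.
  independent-zero : Independent 0
  independent-zero P isP van n₀ rel .0 .[] nil x = eventually-zero⇒zero n₀ (isP [])
    (λ n n₀≤n → *-integralʳ (h n n) (Null-const (Null-≡ 0 (λ N _ → sym (ℚₚ.+-identityˡ (P [] (ι n) * h n n))) (rel n n₀≤n))) (h≢0 n n)) x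
  independent-zero P isP van n₀ rel (suc i) J inJ x = van (suc i) J (ℕ.s≤s ℕ.z≤n) inJ x

  -- Inner induction on a list l containing the support of P in the top layer.
  independent-suc : ∀ {L} → Independent L → ∀ l → All (In (suc L)) l → ∀ P → (∀ J → Poly (P J)) → VanishesAbove (suc L) P →
    (∀ J → In (suc L) J → J ∉ l → ∀ x → P J x ≡ 0ℚ) →
    ∀ n₀ → (∀ n → n₀ ℕ.≤ n → Null (relation (suc L) P n)) → ∀ i J → In i J → ∀ x → P J x ≡ 0ℚ
  independent-suc {L} ind [] _ P isP van support n₀ rel = ind P isP van′ n₀
    (λ n n₀≤n → Null-≡ 0 (λ N _ → sym (drop-top n N)) (rel n n₀≤n))
    where
    van′ : VanishesAbove L P
    van′ i J L<i inJ = go (ℕₚ.m≤n⇒m<n∨m≡n L<i)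
      where
      go : suc L ℕ.< i ⊎ suc L ≡ i → ∀ x → P J x ≡ 0ℚ
      go (inj₁ lt)   = van i J lt inJ
      go (inj₂ refl) = support J inJ λ ()
    drop-top : ∀ n N → relation (suc L) P n N ≡ relation L P n N
    drop-top n N = trans (cong (_+_ (relation L P n N)) (layerSum-0 (suc L) (λ J inJ →
        trans (cong (_* Y J n N) (support J inJ (λ ()) (ι n))) (ℚₚ.*-zeroˡ (Y J n N)))))
      (ℚₚ.+-identityʳ (relation L P n N))
  independent-suc {L} ind (J₀ ∷ l) (inJ₀ ∷ all) P isP van support n₀ rel = [ zero-case , nonzero-case inJ₀ ]′ (firstNonroot ι ι-injective (proj₂ (isP J₀)))
    where
    Conclusion : Set
    Conclusion = ∀ i J → In i J → ∀ x → P J x ≡ 0ℚ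

    zero-case : (∀ x → P J₀ x ≡ 0ℚ) → Conclusion
    zero-case P₀≡0 = independent-suc ind l all P isP van support′ n₀ rel
      where
      support′ : ∀ J → In (suc L) J → J ∉ l → ∀ x → P J x ≡ 0ℚ
      support′ J inJ J∉l x with ≡-dec ℕₚ._≟_ J J₀
      ... | yes refl = P₀≡0 x
      ... | no J≢J₀  = support J inJ (λ { (here eq) → J≢J₀ eq ; (there J∈l) → J∉l J∈l }) x

    -- Crossing with the coefficient of `J₀` annihilates the coefficient at `J₀` and preserves the
    -- zeros in the top layer, so the shorter list `l` contains the new support.
    cross≡0 : ∀ i K → In i K → ∀ x → cross P (P J₀) K x ≡ 0ℚ
    cross≡0 = independent-suc ind l all (cross P (P J₀)) (Poly-cross isP (isP J₀)) (cross-vanishes (P J₀) van) support′ (suc n₀) rel′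
      where
      rel′ : ∀ n → suc n₀ ℕ.≤ n → Null (relation (suc L) (cross P (P J₀)) n)
      rel′ (suc n) (ℕ.s≤s n₀≤n) = Null-≡ (suc n) (λ N n<N → cross-relation (P J₀) van n N n<N)
        (Null-+ (Null-* (P J₀ (ι (suc n)) * W₀ (ι (suc n))) (rel n n₀≤n))
                (Null-* (- (W₀ (ι (suc n)) * P J₀ (ι n))) (rel (suc n) (ℕₚ.m≤n⇒m≤1+n n₀≤n))))
      self : ∀ {J} → In (suc L) J → ∀ x → cross P (P J) J x ≡ 0ℚ
      self {d ∷ J} inK x = trans (cong (λ c → P K x * (W₀ x * P K (x - 1ℚ) + c) - W₀ x * (P K (x - 1ℚ) * P K x))
          (children-vanish van (suc L) K ℕₚ.≤-refl inK x (x - 1ℚ)))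
        (lem (P K x) (W₀ x) (P K (x - 1ℚ)))
        where
        K = d ∷ J
        lem : ∀ p w p′ → p * (w * p′ + 0ℚ) - w * (p′ * p) ≡ 0ℚ
        lem = solve-∀ ℚ-ring
      support′ : ∀ J → In (suc L) J → J ∉ l → ∀ x → cross P (P J₀) J x ≡ 0ℚ
      support′ J inJ J∉l x with ≡-dec ℕₚ._≟_ J J₀
      ... | yes refl = self inJ x
      ... | no J≢J₀  = cross-zero P (P J₀) J x (P≡0 x) (P≡0 (x - 1ℚ)) (children-vanish van (suc L) J ℕₚ.≤-refl inJ x (x - 1ℚ))
        where
        P≡0 : ∀ x → P J x ≡ 0ℚ
        P≡0 = support J inJ (λ { (here eq) → J≢J₀ eq ; (there J∈l) → J∉l J∈l })

    nonzero-case : In (suc L) J₀ → (∃ λ i → P J₀ (ι i) ≢ 0ℚ × (∀ j → j ℕ.< i → P J₀ (ι j) ≡ 0ℚ)) → Conclusion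
    -- The bound beyond which `P J₀` has no integer zeros exists only under a double negation, which
    -- is enough since a contradiction is sought.
    nonzero-case (cons d<B inJ) (i , P₀≢0 , _) = ⊥-elim (eventually-nonzero (isP J₀) (λ P₀≡0 → P₀≢0 (P₀≡0 (ι i)))
      (λ (m , nonzero) → Contradiction.contradictory isP van d<B inJ cross≡0 m nonzero))

  independent : ∀ L → Independent L
  independent zero    = independent-zero
  independent (suc L) P isP van = independent-suc (independent L) (layer (suc L)) (All.tabulate (∈layer⇒In (suc L))) P isP van
    (λ J inJ J∉ → contradiction (In⇒∈layer inJ) J∉)

-- Truncated double tails of multiple zeta values

-- Binomial parameter `m` and lower bound `n` are kept apart so that each can be raised separately;
-- the truncated double tail is the diagonal.
Z : ℕ → Composition → ℕ → ℕ → ℚ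
Z N []       m n = h m n
Z N (a ∷ as) m n = sumBetween n (suc N) (λ k → h m k * recip (k ℕ.^ a) * inner as k n)

zetaPartial≡Z : ∀ N a n → zetaPartial N a n ≡ Z N a n n
zetaPartial≡Z N []       n = refl
zetaPartial≡Z N (a ∷ as) n = refl

lastPart : ℕ → Composition → ℕ
lastPart c []       = c
lastPart c (d ∷ ds) = lastPart d ds

initParts : ℕ → Composition → Composition
initParts c []       = []
initParts c (d ∷ ds) = c ∷ initParts d ds

-- Common form of `inner` and `Z`, with `u` the weight of the outermost index; splitting off the
-- smallest index is proved once for both.
innerSum : (ℕ → ℚ) → Composition → ℕ → ℕ → ℚ
innerSum u as n hi = sumBetween n hi (λ k → u k * inner as k n)

innerSum-right-[] : ∀ u n hi → suc n ℕ.< hi → innerSum u [] n hi ≡ innerSum u [] (suc n) hi + u (suc n)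
innerSum-right-[] u n hi lt = trans (sumBetween-first n hi (λ k → u k * 1ℚ) lt)
  (trans (ℚₚ.+-comm (u (suc n) * 1ℚ) (innerSum u [] (suc n) hi)) (cong (_+_ (innerSum u [] (suc n) hi)) (ℚₚ.*-identityʳ (u (suc n)))))

-- The smallest index either exceeds `suc n` or equals it, and then leaves the factor of the last
-- part. The outermost index cannot be `suc n`: no room for `d ∷ ds` would be left below it.
innerSum-right-∷ : ∀ u d ds n hi → suc n ℕ.< hi → innerSum u (d ∷ ds) n hi ≡
  innerSum u (d ∷ ds) (suc n) hi + recip (suc n ℕ.^ lastPart d ds) * innerSum u (initParts d ds) (suc n) hi

inner-right : ∀ c cs n k → suc n ℕ.< k → inner (c ∷ cs) k n ≡
  inner (c ∷ cs) k (suc n) + recip (suc n ℕ.^ lastPart c cs) * inner (initParts c cs) k (suc n)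

innerSum-right-∷ u d ds n hi lt = begin
  innerSum u (d ∷ ds) n hi
    ≡⟨ sumBetween-first n hi (λ k → u k * inner (d ∷ ds) k n) lt ⟩
  u (suc n) * inner (d ∷ ds) (suc n) n + sumBetween (suc n) hi (λ k → u k * inner (d ∷ ds) k n)
    ≡⟨ cong₂ (λ y z → u (suc n) * y + z) (sumBetween-empty n (suc n) (λ k → recip (k ℕ.^ d) * inner ds k n) ℕₚ.≤-refl)
         (sumBetween-cong hi (λ k lt′ → trans (cong (u k *_) (inner-right d ds n k lt′)) (lem₁ (u k) (inner (d ∷ ds) k (suc n)) r (inner (initParts d ds) k (suc n))))) ⟩
  u (suc n) * 0ℚ + sumBetween (suc n) hi (λ k → u k * inner (d ∷ ds) k (suc n) + r * (u k * inner (initParts d ds) k (suc n)))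
    ≡⟨ cong (u (suc n) * 0ℚ +_) (sumBetween-+ (λ k → u k * inner (d ∷ ds) k (suc n)) (λ k → r * (u k * inner (initParts d ds) k (suc n))) hi) ⟩
  u (suc n) * 0ℚ + (innerSum u (d ∷ ds) (suc n) hi + sumBetween (suc n) hi (λ k → r * (u k * inner (initParts d ds) k (suc n))))
    ≡⟨ cong (λ y → u (suc n) * 0ℚ + (innerSum u (d ∷ ds) (suc n) hi + y)) (sumBetween-*ˡ r (λ k → u k * inner (initParts d ds) k (suc n)) hi) ⟩
  u (suc n) * 0ℚ + (innerSum u (d ∷ ds) (suc n) hi + r * innerSum u (initParts d ds) (suc n) hi)
    ≡⟨ lem₂ (u (suc n)) (innerSum u (d ∷ ds) (suc n) hi + r * innerSum u (initParts d ds) (suc n) hi) ⟩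
  innerSum u (d ∷ ds) (suc n) hi + r * innerSum u (initParts d ds) (suc n) hi ∎
  where
  open ≡-Reasoning
  r = recip (suc n ℕ.^ lastPart d ds)
  lem₁ : ∀ u x r y → u * (x + r * y) ≡ u * x + r * (u * y)
  lem₁ = solve-∀ ℚ-ring
  lem₂ : ∀ u y → u * 0ℚ + y ≡ y
  lem₂ = solve-∀ ℚ-ring

inner-right c []       n k lt = trans (innerSum-right-[] (λ i → recip (i ℕ.^ c)) n k lt)
  (cong (_+_ (inner (c ∷ []) k (suc n))) (sym (ℚₚ.*-identityʳ (recip (suc n ℕ.^ c)))))
inner-right c (d ∷ ds) n k lt = innerSum-right-∷ (λ i → recip (i ℕ.^ c)) d ds n k lt

Z-right : ∀ N c cs m n → suc n ℕ.≤ N → Z N (c ∷ cs) m n ≡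
  Z N (c ∷ cs) m (suc n) + recip (suc n) ^ℚ lastPart c cs * Z N (initParts c cs) m (suc n)
Z-right N c [] m n lt = trans (innerSum-right-[] (λ k → h m k * recip (k ℕ.^ c)) n (suc N) (ℕ.s≤s lt))
  (cong (_+_ (Z N (c ∷ []) m (suc n))) (trans (ℚₚ.*-comm (h m (suc n)) (recip (suc n ℕ.^ c))) (cong (_* h m (suc n)) (recip-^ (suc n) c))))
Z-right N c (d ∷ ds) m n lt = trans (innerSum-right-∷ (λ k → h m k * recip (k ℕ.^ c)) d ds n (suc N) (ℕ.s≤s lt))
  (cong (λ y → Z N (c ∷ d ∷ ds) m (suc n) + y * Z N (c ∷ initParts d ds) m (suc n)) (recip-^ (suc n) (lastPart d ds)))

h-step : ∀ m k → h m k ≡ h (suc m) k + recip (suc m) * (ι k * h (suc m) k)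
h-step m k = *-cancelˡ-≢0 (ι (suc m)) (ι≢0 m) (begin
  ι (suc m) * h m k                                                   ≡⟨ ℚₚ.*-comm (ι (suc m)) (h m k) ⟩
  h m k * ι (suc m)                                                   ≡⟨ h-lower m k ⟨
  h (suc m) k * ι (suc (k ℕ.+ m))                                     ≡⟨ cong (λ y → h (suc m) k * (1ℚ + y)) (ι-+ k m) ⟩
  h (suc m) k * (1ℚ + (ι k + ι m))                                    ≡⟨ lem₁ (h (suc m) k) (ι k) (ι m) ⟩
  ι (suc m) * h (suc m) k + 1ℚ * (ι k * h (suc m) k)                  ≡⟨ cong (λ y → ι (suc m) * h (suc m) k + y * (ι k * h (suc m) k)) (ι-recip m) ⟨
  ι (suc m) * h (suc m) k + ι (suc m) * recip (suc m) * (ι k * h (suc m) k) ≡⟨ lem₂ (ι (suc m)) (h (suc m) k) (recip (suc m)) (ι k * h (suc m) k) ⟩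
  ι (suc m) * (h (suc m) k + recip (suc m) * (ι k * h (suc m) k))     ∎)
  where
  open ≡-Reasoning
  lem₁ : ∀ g k m → g * (1ℚ + (k + m)) ≡ (1ℚ + m) * g + 1ℚ * (k * g)
  lem₁ = solve-∀ ℚ-ring
  lem₂ : ∀ x g r y → x * g + x * r * y ≡ x * (g + r * y)
  lem₂ = solve-∀ ℚ-ring

-- By `h-step`, `h m k` is `h (suc m) k` times 1 + k/(m + 1); the factor k lowers the first
-- exponent, which for positive `c` removes a leading 0 of the word.
Z-left : ∀ N c cs m n → Z N (suc c ∷ cs) m n ≡ Z N (suc c ∷ cs) (suc m) n + recip (suc m) * Z N (c ∷ cs) (suc m) n
Z-left N c cs m n = trans (sumBetween-cong (suc N) each)
  (trans (sumBetween-+ (λ k → h (suc m) k * recip (k ℕ.^ suc c) * inner cs k n) (λ k → recip (suc m) * (h (suc m) k * recip (k ℕ.^ c) * inner cs k n)) (suc N))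
    (cong (_+_ (Z N (suc c ∷ cs) (suc m) n)) (sumBetween-*ˡ (recip (suc m)) (λ k → h (suc m) k * recip (k ℕ.^ c) * inner cs k n) (suc N))))
  where
  lem : ∀ g r k p q i → (g + r * (k * g)) * (p * q) * i ≡ g * (p * q) * i + r * (g * ((k * p) * q) * i)
  lem = solve-∀ ℚ-ring
  each : ∀ k → n ℕ.< k → h m k * recip (k ℕ.^ suc c) * inner cs k n ≡
    h (suc m) k * recip (k ℕ.^ suc c) * inner cs k n + recip (suc m) * (h (suc m) k * recip (k ℕ.^ c) * inner cs k n)
  each (suc k) _ = begin
    h m K * recip (K ℕ.^ suc c) * I                                  ≡⟨ cong₂ (λ y z → y * z * I) (h-step m K) (recip-* K (K ℕ.^ c)) ⟩
    (g + r * (ι K * g)) * (recip K * q) * I                          ≡⟨ lem g r (ι K) (recip K) q I ⟩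
    g * (recip K * q) * I + r * (g * ((ι K * recip K) * q) * I)      ≡⟨ cong₂ (λ y z → g * y * I + r * (g * z * I)) (sym (recip-* K (K ℕ.^ c))) (trans (cong (_* q) (ι-recip k)) (ℚₚ.*-identityˡ q)) ⟩
    g * recip (K ℕ.^ suc c) * I + r * (g * q * I)                    ∎
    where
    open ≡-Reasoning
    K = suc k
    g = h (suc m) K
    r = recip (suc m)
    q = recip (K ℕ.^ c)
    I = inner cs K n

h-telescope : ∀ m k → h (suc m) (suc k) * recip (suc k) ≡ recip (suc m) * (h (suc m) k - h (suc m) (suc k))
h-telescope m k = *-cancelˡ-≢0 (ι (suc m) * ι (suc k)) (*-≢0 (ι≢0 m) (ι≢0 k)) (begin
  ι M * ι K * (g′ * recip K)                    ≡⟨ lem₁ (ι M) (ι K) g′ (recip K) ⟩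
  g′ * ι M * (ι K * recip K)                    ≡⟨ cong (g′ * ι M *_) (ι-recip k) ⟩
  g′ * ι M * 1ℚ                                 ≡⟨ lem₂ g′ (ι K) (ι M) ⟩
  g′ * (ι K + ι M) - g′ * ι K                   ≡⟨ cong (λ y → g′ * y - g′ * ι K) (ι-+ K M) ⟨
  g′ * ι (suc (k ℕ.+ M)) - g′ * ι K             ≡⟨ cong (_- g′ * ι K) (h-upper M k) ⟩
  g * ι K - g′ * ι K                            ≡⟨ lem₃ g (ι K) g′ ⟩
  1ℚ * ι K * (g - g′)                           ≡⟨ cong (λ y → y * ι K * (g - g′)) (ι-recip m) ⟨
  ι M * recip M * ι K * (g - g′)                ≡⟨ lem₄ (ι M) (recip M) (ι K) (g - g′) ⟩
  ι M * ι K * (recip M * (g - g′))              ∎)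
  where
  open ≡-Reasoning
  M = suc m
  K = suc k
  g = h M k
  g′ = h M K
  lem₁ : ∀ a b g r → a * b * (g * r) ≡ g * a * (b * r)
  lem₁ = solve-∀ ℚ-ring
  lem₂ : ∀ g k m → g * m * 1ℚ ≡ g * (k + m) - g * k
  lem₂ = solve-∀ ℚ-ring
  lem₃ : ∀ g k g′ → g * k - g′ * k ≡ 1ℚ * k * (g - g′)
  lem₃ = solve-∀ ℚ-ring
  lem₄ : ∀ a b c d → a * b * c * d ≡ a * c * (b * d)
  lem₄ = solve-∀ ℚ-ring

-- By `h-telescope` the sum over the largest index, of exponent 1, telescopes down to the next index
-- and leaves a boundary term at `N`. Writing `N` as `n + t` builds in n ≤ N and allows induction on
-- `t`.
Z-one : ∀ as m n t → let N = n ℕ.+ t; M = suc m in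
  Z N (1 ∷ as) M n + recip M * (h M N * inner as (suc N) n) ≡ recip M * Z N as M n
Z-one as m n zero rewrite ℕₚ.+-identityʳ n = go as
  where
  M = suc m
  lem : ∀ r g → 0ℚ + r * (g * 1ℚ) ≡ r * g
  lem = solve-∀ ℚ-ring
  lem′ : ∀ r g → 0ℚ + r * (g * 0ℚ) ≡ r * 0ℚ
  lem′ = solve-∀ ℚ-ring
  empty : ∀ as → Z n (1 ∷ as) M n ≡ 0ℚ
  empty as = sumBetween-empty n (suc n) (λ k → h M k * recip (k ℕ.^ 1) * inner as k n) ℕₚ.≤-refl
  go : ∀ as → Z n (1 ∷ as) M n + recip M * (h M n * inner as (suc n) n) ≡ recip M * Z n as M n
  go []       = trans (cong (_+ recip M * (h M n * 1ℚ)) (empty [])) (lem (recip M) (h M n))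
  go (c ∷ cs) = trans (cong₂ (λ y z → y + recip M * (h M n * z)) (empty (c ∷ cs)) (sumBetween-empty n (suc n) (λ k → recip (k ℕ.^ c) * inner cs k n) ℕₚ.≤-refl))
    (trans (lem′ (recip M) (h M n)) (cong (recip M *_) (sym (sumBetween-empty n (suc n) (λ k → h M k * recip (k ℕ.^ c) * inner cs k n) ℕₚ.≤-refl))))
Z-one as m n (suc t) rewrite ℕₚ.+-suc n t = go as (Z-one as m n t)
  where
  open ≡-Reasoning
  N = n ℕ.+ t
  M = suc m
  r = recip M
  g = h M N
  g′ = h M (suc N)
  n<1+N : n ℕ.< suc N
  n<1+N = ℕ.s≤s (ℕₚ.m≤m+n n t)
  term : g′ * recip (suc N ℕ.^ 1) ≡ r * (g - g′)
  term = trans (cong (λ y → g′ * recip y) (ℕₚ.*-identityʳ (suc N))) (h-telescope m N)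
  add : ∀ as → Z (suc N) (1 ∷ as) M n ≡ Z N (1 ∷ as) M n + r * (g - g′) * inner as (suc N) n
  add as = trans (sumBetween-last n (suc N) (λ k → h M k * recip (k ℕ.^ 1) * inner as k n) n<1+N)
    (cong (λ y → Z N (1 ∷ as) M n + y * inner as (suc N) n) term)
  lem : ∀ z r g g′ i → z + r * (g - g′) * i + r * (g′ * i) ≡ z + r * (g * i)
  lem = solve-∀ ℚ-ring
  lem′ : ∀ z r g g′ i p → z + r * (g - g′) * i + r * (g′ * (i + p)) ≡ z + r * (g * i) + r * (g′ * p)
  lem′ = solve-∀ ℚ-ring
  lem″ : ∀ r z g p i → r * z + r * (g * (p * i)) ≡ r * (z + g * p * i)
  lem″ = solve-∀ ℚ-ring
  go : ∀ as → Z N (1 ∷ as) M n + r * (g * inner as (suc N) n) ≡ r * Z N as M n →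
       Z (suc N) (1 ∷ as) M n + r * (g′ * inner as (suc (suc N)) n) ≡ r * Z (suc N) as M n
  go [] ih = trans (cong (_+ r * (g′ * 1ℚ)) (add [])) (trans (lem (Z N (1 ∷ []) M n) r g g′ 1ℚ) ih)
  go (c ∷ cs) ih = begin
    Z (suc N) (1 ∷ c ∷ cs) M n + r * (g′ * inner (c ∷ cs) (suc (suc N)) n)
      ≡⟨ cong₂ (λ y z → y + r * (g′ * z)) (add (c ∷ cs)) (sumBetween-last n (suc N) (λ k → recip (k ℕ.^ c) * inner cs k n) n<1+N) ⟩
    Z N (1 ∷ c ∷ cs) M n + r * (g - g′) * I + r * (g′ * (I + p * J))
      ≡⟨ lem′ (Z N (1 ∷ c ∷ cs) M n) r g g′ I (p * J) ⟩
    Z N (1 ∷ c ∷ cs) M n + r * (g * I) + r * (g′ * (p * J))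
      ≡⟨ cong (_+ r * (g′ * (p * J))) ih ⟩
    r * Z N (c ∷ cs) M n + r * (g′ * (p * J))
      ≡⟨ lem″ r (Z N (c ∷ cs) M n) g′ p J ⟩
    r * (Z N (c ∷ cs) M n + g′ * p * J)
      ≡⟨ cong (r *_) (sumBetween-last n (suc N) (λ k → h M k * recip (k ℕ.^ c) * inner cs k n) n<1+N) ⟨
    r * Z (suc N) (c ∷ cs) M n ∎
    where
    I = inner (c ∷ cs) (suc N) n
    J = inner cs (suc N) n
    p = recip (suc N ℕ.^ c)

-- Growth estimates

-- The denominator is at least 1, so the absolute value of the numerator is a bound.
archimedean : ∀ p → ∃ λ K → p ≤ ι K
archimedean p = K , ℚₚ.toℚᵘ-cancel-≤ (ℚᵘₚ.≤-trans {toℚᵘ p} {ℚᵘ.mkℚᵘ (ℤ.+ K) 0} {toℚᵘ (ι K)} (ℚᵘ.*≤* bound) (ℚᵘₚ.≤-reflexive (ℚᵘₚ.≃-sym (ι≃ K))))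
  where
  K = ℤ.∣ ℚᵘ.↥ (toℚᵘ p) ∣
  n≤∣n∣ : ∀ i → i ℤ.≤ ℤ.+ ℤ.∣ i ∣
  n≤∣n∣ (ℤ.+ n)    = ℤₚ.≤-refl
  n≤∣n∣ (ℤ.-[1+ n ]) = ℤ.-≤+
  bound : ℚᵘ.↥ (toℚᵘ p) ℤ.* ℤ.+ 1 ℤ.≤ ℤ.+ K ℤ.* ℚᵘ.↧ (toℚᵘ p)
  bound = ℤₚ.≤-trans (ℤₚ.≤-reflexive (ℤₚ.*-identityʳ (ℚᵘ.↥ (toℚᵘ p))))
    (ℤₚ.≤-trans (n≤∣n∣ (ℚᵘ.↥ (toℚᵘ p)))
      (ℤₚ.≤-trans (ℤ.+≤+ (ℕₚ.m≤m*n K (ℚᵘ.↧ₙ (toℚᵘ p)))) (ℤₚ.≤-reflexive (ℤₚ.pos-* K (ℚᵘ.↧ₙ (toℚᵘ p))))))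

archimedean-* : ∀ A ε → 0ℚ < ε → ∃ λ K → A ≤ ε * ι K
archimedean-* A ε 0<ε = K , ℚₚ.≤-trans (ℚₚ.≤-reflexive (sym cancel)) (*-monoˡ ε (ℚₚ.<⇒≤ 0<ε) (proj₂ found))
  where
  instance
    ε-nz : NonZero ε
    ε-nz = ℚₚ.pos⇒nonZero ε {{positive 0<ε}}
  found = archimedean (1/ ε * A)
  K = proj₁ found
  cancel : ε * (1/ ε * A) ≡ A
  cancel = trans (sym (ℚₚ.*-assoc ε (1/ ε) A)) (trans (cong (_* A) (ℚₚ.*-inverseʳ ε)) (ℚₚ.*-identityˡ A))

recip≤1 : ∀ k → recip k ≤ 1ℚ
recip≤1 zero    = 0≤1
recip≤1 (suc k) = ℚₚ.≤-trans (ℚₚ.≤-reflexive (sym (ℚₚ.*-identityˡ (recip (suc k)))))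
  (ℚₚ.≤-trans (*-monoʳ (recip (suc k)) {1ℚ} (0≤recip (suc k)) (p≤p+q {1ℚ} (0≤ι k))) (ℚₚ.≤-reflexive (ι-recip k)))

ι*recip≤1 : ∀ {m} n → m ℕ.≤ suc n → ι m * recip (suc n) ≤ 1ℚ
ι*recip≤1 n le = ℚₚ.≤-trans (*-monoʳ (recip (suc n)) (0≤recip (suc n)) (ι-mono le)) (ℚₚ.≤-reflexive (ι-recip n))

recip-anti : ∀ {m n} → m ℕ.≤ n → recip (suc n) ≤ recip (suc m)
recip-anti {m} {n} le = ℚₚ.≤-trans (ℚₚ.≤-reflexive (sym (trans (cong (_* recip (suc n)) (recip-ι m)) (ℚₚ.*-identityˡ (recip (suc n))))))
  (ℚₚ.≤-trans (ℚₚ.≤-reflexive (ℚₚ.*-assoc (recip (suc m)) (ι (suc m)) (recip (suc n))))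
    (ℚₚ.≤-trans (*-monoˡ (recip (suc m)) (0≤recip (suc m)) (ι*recip≤1 n (ℕ.s≤s le))) (ℚₚ.≤-reflexive (ℚₚ.*-identityʳ (recip (suc m))))))

^≤1 : ∀ {x} e → 0ℚ ≤ x → x ≤ 1ℚ → x ^ℚ e ≤ 1ℚ
^≤1 zero    _   _   = ℚₚ.≤-refl
^≤1 (suc e) 0≤x x≤1 = *-mono 0≤1 (0≤^ e 0≤x) x≤1 (^≤1 e 0≤x x≤1)

recip-^≤recip : ∀ k {c} → 1 ℕ.≤ c → recip (k ℕ.^ c) ≤ recip k
recip-^≤recip k {suc c} _ = ℚₚ.≤-trans (ℚₚ.≤-reflexive (recip-* k (k ℕ.^ c)))
  (ℚₚ.≤-trans (*-monoˡ (recip k) (0≤recip k) (recip≤1 (k ℕ.^ c))) (ℚₚ.≤-reflexive (ℚₚ.*-identityʳ (recip k))))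

inner-nonneg : ∀ as k n → 0ℚ ≤ inner as k n
inner-nonneg []       k n = 0≤1
inner-nonneg (c ∷ cs) k n = sumBetween-nonneg k (λ i _ → 0≤* (0≤recip (i ℕ.^ c)) (inner-nonneg cs i n))

sumBetween-step≤ : ∀ lo hi f {b} → 0ℚ ≤ b → (lo ℕ.< hi → f hi ≤ b) → sumBetween lo (suc hi) f ≤ sumBetween lo hi f + b
sumBetween-step≤ lo hi f {b} 0≤b fb = go (ℕₚ.<-≤-connex lo hi)
  where
  go : lo ℕ.< hi ⊎ hi ℕ.≤ lo → sumBetween lo (suc hi) f ≤ sumBetween lo hi f + b
  go (inj₁ lt) = ℚₚ.≤-trans (ℚₚ.≤-reflexive (sumBetween-last lo hi f lt)) (ℚₚ.+-monoʳ-≤ (sumBetween lo hi f) (fb lt))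
  go (inj₂ ge) = ℚₚ.≤-trans (ℚₚ.≤-reflexive (trans (sumBetween-empty lo (suc hi) f (ℕ.s≤s ge)) (sym (sumBetween-empty lo hi f (ℕₚ.m≤n⇒m≤1+n ge))))) (p≤p+q 0≤b)

sumBetween-≤ : ∀ lo f {b} → 0ℚ ≤ b → (∀ k → lo ℕ.< k → f k ≤ b) → ∀ hi → sumBetween lo hi f ≤ ι hi * b
sumBetween-≤ lo f {b} 0≤b fb zero     = ℚₚ.≤-reflexive (sym (ℚₚ.*-zeroˡ b))
sumBetween-≤ lo f {b} 0≤b fb (suc hi) = ℚₚ.≤-trans (sumBetween-step≤ lo hi f 0≤b (fb hi))
  (ℚₚ.≤-trans (ℚₚ.+-monoˡ-≤ b (sumBetween-≤ lo f 0≤b fb hi)) (ℚₚ.≤-reflexive (lem (ι hi) b)))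
  where
  lem : ∀ x b → x * b + b ≡ (1ℚ + x) * b
  lem = solve-∀ ℚ-ring

inner≤ι : ∀ as → All (1 ℕ.≤_) as → ∀ k n → inner as (suc k) n ≤ ι (suc k)
inner≤ι []       _             k n = p≤p+q (0≤ι k)
inner≤ι (c ∷ cs) (1≤c ∷ 1≤cs) k n = ℚₚ.≤-trans
  (sumBetween-≤ n (λ i → recip (i ℕ.^ c) * inner cs i n) 0≤1 term≤1 (suc k)) (ℚₚ.≤-reflexive (ℚₚ.*-identityʳ (ι (suc k))))
  where
  term≤1 : ∀ i → n ℕ.< i → recip (i ℕ.^ c) * inner cs i n ≤ 1ℚ
  term≤1 (suc i) _ = ℚₚ.≤-trans (*-mono (0≤recip (suc i)) (inner-nonneg cs (suc i) n) (recip-^≤recip (suc i) 1≤c) (inner≤ι cs 1≤cs i n))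
    (ℚₚ.≤-reflexive (recip-ι i))

-- The nested sums grow at most like a power of log k; growth o(k) is enough against a kernel
-- bounded by 1/(k + 1) and passes easily through the nesting.
Sublinear : (ℕ → ℚ) → Set
Sublinear g = ∀ ε → 0ℚ < ε → ∃ λ A → 0ℚ ≤ A × (∀ k → g k ≤ ε * ι k + A)

inner-sublinear : ∀ as → All (1 ℕ.≤_) as → ∀ n → Sublinear (λ k → inner as k n)
inner-sublinear [] _ n ε 0<ε = 1ℚ , 0≤1 , λ k →
  ℚₚ.≤-trans (p≤p+q (0≤* (ℚₚ.<⇒≤ 0<ε) (0≤ι k))) (ℚₚ.≤-reflexive (ℚₚ.+-comm 1ℚ (ε * ι k)))
inner-sublinear (c ∷ cs) (1≤c ∷ 1≤cs) n ε 0<ε = go (inner-sublinear cs 1≤cs n δ 0<δ)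
  where
  δ = recip 2 * ε
  0<δ = halve ε 0<ε
  0≤δ = ℚₚ.<⇒≤ 0<δ
  f : ℕ → ℚ
  f i = recip (i ℕ.^ c) * inner cs i n
  go : (∃ λ A → 0ℚ ≤ A × (∀ k → inner cs k n ≤ δ * ι k + A)) → ∃ λ A → 0ℚ ≤ A × (∀ k → inner (c ∷ cs) k n ≤ ε * ι k + A)
  go (A , 0≤C , bound) = D , 0≤D , final
    where
    found = archimedean-* A δ 0<δ
    K = proj₁ found
    -- From `K` on the terms are at most ε, because there A/i ≤ δ; the finitely many earlier ones
    -- are at most `δ + A` each and go into the constant.
    D = ι K * (δ + A)
    0≤D = 0≤* (0≤ι K) (0≤+ 0≤δ 0≤C)
    lem : ∀ r δ k A → r * (δ * k + A) ≡ δ * (r * k) + A * r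
    lem = solve-∀ ℚ-ring
    f≤ : ∀ i → f (suc i) ≤ δ + A * recip (suc i)
    f≤ i = ℚₚ.≤-trans (*-mono (0≤recip (suc i)) (inner-nonneg cs (suc i) n) (recip-^≤recip (suc i) 1≤c) (bound (suc i)))
      (ℚₚ.≤-reflexive (trans (lem (recip (suc i)) δ (ι (suc i)) A)
        (cong (_+ A * recip (suc i)) (trans (cong (δ *_) (recip-ι i)) (ℚₚ.*-identityʳ δ)))))
    crude : ∀ i → n ℕ.< i → f i ≤ δ + A
    crude (suc i) _ = ℚₚ.≤-trans (f≤ i) (ℚₚ.+-monoʳ-≤ δ (ℚₚ.≤-trans (*-monoˡ A 0≤C (recip≤1 (suc i))) (ℚₚ.≤-reflexive (ℚₚ.*-identityʳ A))))
    fine : ∀ i → K ℕ.≤ i → n ℕ.< i → f i ≤ ε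
    fine (suc i) K≤i _ = ℚₚ.≤-trans (f≤ i) (ℚₚ.≤-trans (ℚₚ.+-monoʳ-≤ δ
        (ℚₚ.≤-trans (*-monoʳ (recip (suc i)) (0≤recip (suc i)) (proj₂ found))
          (ℚₚ.≤-trans (ℚₚ.≤-reflexive (ℚₚ.*-assoc δ (ι K) (recip (suc i))))
            (ℚₚ.≤-trans (*-monoˡ δ 0≤δ (ι*recip≤1 i K≤i)) (ℚₚ.≤-reflexive (ℚₚ.*-identityʳ δ))))))
      (ℚₚ.≤-reflexive (halves ε)))
    low : ∀ k → k ℕ.≤ K → sumBetween n k f ≤ D
    low k k≤K = ℚₚ.≤-trans (sumBetween-≤ n f (0≤+ 0≤δ 0≤C) crude k) (*-monoʳ (δ + A) (0≤+ 0≤δ 0≤C) (ι-mono k≤K))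
    lem₂ : ∀ e t D → e * t + D + e ≡ e * (1ℚ + t) + D
    lem₂ = solve-∀ ℚ-ring
    lem₃ : ∀ e D → D ≡ e * 0ℚ + D
    lem₃ = solve-∀ ℚ-ring
    high : ∀ t → sumBetween n (t ℕ.+ K) f ≤ ε * ι t + D
    high zero    = ℚₚ.≤-trans (low K ℕₚ.≤-refl) (ℚₚ.≤-reflexive (lem₃ ε D))
    high (suc t) = ℚₚ.≤-trans (sumBetween-step≤ n (t ℕ.+ K) f (ℚₚ.<⇒≤ 0<ε) (fine (t ℕ.+ K) (ℕₚ.m≤n+m K t)))
      (ℚₚ.≤-trans (ℚₚ.+-monoˡ-≤ ε (high t)) (ℚₚ.≤-reflexive (lem₂ ε (ι t) D)))
    final : ∀ k → sumBetween n k f ≤ ε * ι k + D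
    final k = [ below , above ]′ (ℕₚ.≤-total k K)
      where
      below : k ℕ.≤ K → sumBetween n k f ≤ ε * ι k + D
      below k≤K = ℚₚ.≤-trans (low k k≤K) (ℚₚ.≤-trans (p≤p+q (0≤* (ℚₚ.<⇒≤ 0<ε) (0≤ι k))) (ℚₚ.≤-reflexive (ℚₚ.+-comm D (ε * ι k))))
      above : K ℕ.≤ k → sumBetween n k f ≤ ε * ι k + D
      above K≤k = ℚₚ.≤-trans (ℚₚ.≤-reflexive (cong (λ j → sumBetween n j f) (sym (ℕₚ.m∸n+n≡m K≤k))))
        (ℚₚ.≤-trans (high (k ℕ.∸ K)) (ℚₚ.+-monoˡ-≤ D (*-monoˡ ε (ℚₚ.<⇒≤ 0<ε) (ι-mono (ℕₚ.m∸n≤m k K)))))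

-- The ratio of successive values in k is (k + 1)/(k + m + 2), at most (k + 1)/(k + 2). The
-- parameter is a successor because `h 0` is constantly 1.
h≤recip : ∀ m k → h (suc m) k ≤ recip (suc k)
h≤recip m zero    = ℚₚ.≤-reflexive (cong recip (nCn≡1 (suc m)))
h≤recip m (suc k) = begin
  g                                     ≡⟨ ℚₚ.*-identityʳ g ⟨
  g * 1ℚ                                ≡⟨ cong (g *_) (ι-recip (suc k)) ⟨
  g * (ι K * recip K)                   ≡⟨ ℚₚ.*-assoc g (ι K) (recip K) ⟨
  g * ι K * recip K                     ≤⟨ *-monoʳ (recip K) (0≤recip K) (*-monoˡ g (0≤h (suc m) (suc k)) (ι-mono (ℕ.s≤s k<k+m))) ⟩
  g * ι (suc (k ℕ.+ suc m)) * recip K   ≡⟨ cong (_* recip K) (h-upper (suc m) k) ⟩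
  h (suc m) k * ι (suc k) * recip K     ≤⟨ *-monoʳ (recip K) (0≤recip K) (*-monoʳ (ι (suc k)) (0≤ι (suc k)) (h≤recip m k)) ⟩
  recip (suc k) * ι (suc k) * recip K   ≡⟨ cong (_* recip K) (recip-ι k) ⟩
  1ℚ * recip K                          ≡⟨ ℚₚ.*-identityˡ (recip K) ⟩
  recip K                               ∎
  where
  open ℚₚ.≤-Reasoning
  K = suc (suc k)
  g = h (suc m) (suc k)
  k<k+m : suc k ℕ.≤ k ℕ.+ suc m
  k<k+m = ℕₚ.≤-trans (ℕ.s≤s (ℕₚ.m≤m+n k m)) (ℕₚ.≤-reflexive (sym (ℕₚ.+-suc k m)))

boundary-null : ∀ m as → All (1 ℕ.≤_) as → ∀ n → Null (λ N → h (suc m) N * inner as (suc N) n)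
boundary-null m as 1≤as n ε 0<ε = go (inner-sublinear as 1≤as n δ 0<δ)
  where
  -- The estimate below ends in `δ + δ`, which is η, with a weak inequality; `η<ε` makes it strict.
  η = recip 2 * ε
  0<η = halve ε 0<ε
  δ = recip 2 * η
  0<δ = halve η 0<η
  0≤δ = ℚₚ.<⇒≤ 0<δ
  η<ε : η < ε
  η<ε = ℚₚ.<-≤-trans (ℚₚ.≤-<-trans (ℚₚ.≤-reflexive (sym (ℚₚ.+-identityʳ η))) (ℚₚ.+-monoʳ-< η 0<η)) (ℚₚ.≤-reflexive (halves ε))
  go : (∃ λ A → 0ℚ ≤ A × (∀ k → inner as k n ≤ δ * ι k + A)) → Σ ℕ λ M → ∀ N → M ℕ.≤ N → ∣ h (suc m) N * inner as (suc N) n ∣ < ε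
  go (A , 0≤C , bound) = K , small
    where
    found = archimedean-* A δ 0<δ
    K = proj₁ found
    lem : ∀ r δ k A → r * (δ * k + A) ≡ δ * (r * k) + A * r
    lem = solve-∀ ℚ-ring
    small : ∀ N → K ℕ.≤ N → ∣ h (suc m) N * inner as (suc N) n ∣ < ε
    small N K≤N = ℚₚ.≤-<-trans (begin
      ∣ h (suc m) N * inner as (suc N) n ∣          ≡⟨ ℚₚ.0≤p⇒∣p∣≡p (0≤* (0≤h (suc m) N) (inner-nonneg as (suc N) n)) ⟩
      h (suc m) N * inner as (suc N) n              ≤⟨ *-mono (0≤recip (suc N)) (inner-nonneg as (suc N) n) (h≤recip m N) (bound (suc N)) ⟩
      recip (suc N) * (δ * ι (suc N) + A)           ≡⟨ lem (recip (suc N)) δ (ι (suc N)) A ⟩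
      δ * (recip (suc N) * ι (suc N)) + A * recip (suc N) ≡⟨ cong (λ y → δ * y + A * recip (suc N)) (recip-ι N) ⟩
      δ * 1ℚ + A * recip (suc N)                    ≤⟨ ℚₚ.+-monoʳ-≤ (δ * 1ℚ) (*-monoʳ (recip (suc N)) (0≤recip (suc N)) (proj₂ found)) ⟩
      δ * 1ℚ + δ * ι K * recip (suc N)              ≡⟨ cong (_+_ (δ * 1ℚ)) (ℚₚ.*-assoc δ (ι K) (recip (suc N))) ⟩
      δ * 1ℚ + δ * (ι K * recip (suc N))            ≤⟨ ℚₚ.+-monoʳ-≤ (δ * 1ℚ) (*-monoˡ δ 0≤δ (ι*recip≤1 N (ℕₚ.m≤n⇒m≤1+n K≤N))) ⟩
      δ * 1ℚ + δ * 1ℚ                               ≡⟨ cong₂ _+_ (ℚₚ.*-identityʳ δ) (ℚₚ.*-identityʳ δ) ⟩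
      δ + δ                                         ≡⟨ halves η ⟩
      η                                             ∎) η<ε
      where open ℚₚ.≤-Reasoning

Z-one-null : ∀ as → All (1 ℕ.≤_) as → ∀ m n → Null (λ N → Z N (1 ∷ as) (suc m) n - recip (suc m) * Z N as (suc m) n)
Z-one-null as 1≤as m n = Null-≡ n eq (Null-* (- recip (suc m)) (boundary-null m as 1≤as n))
  where
  lem : ∀ z w r b → z + r * b ≡ w → z - w ≡ (- r) * b
  lem z w r b refl = lem′ z r b
    where
    lem′ : ∀ z r b → z - (z + r * b) ≡ (- r) * b
    lem′ = solve-∀ ℚ-ring
  eq : ∀ N → n ℕ.≤ N → Z N (1 ∷ as) (suc m) n - recip (suc m) * Z N as (suc m) n ≡ (- recip (suc m)) * (h (suc m) N * inner as (suc N) n)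
  eq N n≤N = lem (Z N (1 ∷ as) (suc m) n) (recip (suc m) * Z N as (suc m) n) (recip (suc m)) (h (suc m) N * inner as (suc N) n)
    (subst (λ N → Z N (1 ∷ as) (suc m) n + recip (suc m) * (h (suc m) N * inner as (suc N) n) ≡ recip (suc m) * Z N as (suc m) n)
      (ℕₚ.m+[n∸m]≡n n≤N) (Z-one as m n (N ℕ.∸ n)))

sumBetween-telescope : ∀ {f g : ℕ → ℚ} lo → (∀ k → 0ℚ ≤ g k) → (∀ k → lo ℕ.≤ k → f (suc k) ≤ g k - g (suc k)) → ∀ hi → sumBetween lo hi f ≤ g lo
sumBetween-telescope {f} {g} lo 0≤g le hi = [ small , large ]′ (ℕₚ.≤-total hi (suc lo))
  where
  small : hi ℕ.≤ suc lo → sumBetween lo hi f ≤ g lo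
  small hi≤ = ℚₚ.≤-trans (ℚₚ.≤-reflexive (sumBetween-empty lo hi f hi≤)) (0≤g lo)
  lem : ∀ s a b → s + (a - b) + b ≡ s + a
  lem = solve-∀ ℚ-ring
  go : ∀ t → sumBetween lo (suc (t ℕ.+ lo)) f + g (t ℕ.+ lo) ≤ g lo
  go zero    = ℚₚ.≤-reflexive (trans (cong (_+ g lo) (sumBetween-empty lo (suc lo) f ℕₚ.≤-refl)) (ℚₚ.+-identityˡ (g lo)))
  go (suc t) = begin
    sumBetween lo (suc (suc k)) f + g (suc k)              ≡⟨ cong (_+ g (suc k)) (sumBetween-last lo (suc k) f (ℕ.s≤s (ℕₚ.m≤n+m lo t))) ⟩
    sumBetween lo (suc k) f + f (suc k) + g (suc k)        ≤⟨ ℚₚ.+-monoˡ-≤ (g (suc k)) (ℚₚ.+-monoʳ-≤ (sumBetween lo (suc k) f) (le k (ℕₚ.m≤n+m lo t))) ⟩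
    sumBetween lo (suc k) f + (g k - g (suc k)) + g (suc k) ≡⟨ lem (sumBetween lo (suc k) f) (g k) (g (suc k)) ⟩
    sumBetween lo (suc k) f + g k                          ≤⟨ go t ⟩
    g lo                                                   ∎
    where
    open ℚₚ.≤-Reasoning
    k = t ℕ.+ lo
  large : suc lo ℕ.≤ hi → sumBetween lo hi f ≤ g lo
  large lo<hi = subst (λ j → sumBetween lo j f ≤ g lo) (trans (sym (ℕₚ.+-suc t lo)) (ℕₚ.m∸n+n≡m lo<hi))
    (ℚₚ.≤-trans (p≤p+q (0≤g (t ℕ.+ lo))) (go t))
    where t = hi ℕ.∸ suc lo

Z-nonneg : ∀ N a m n → 0ℚ ≤ Z N a m n
Z-nonneg N []       m n = 0≤h m n
Z-nonneg N (c ∷ cs) m n = sumBetween-nonneg (suc N) (λ k _ → 0≤* (0≤* (0≤h m k) (0≤recip (k ℕ.^ c))) (inner-nonneg cs k n))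

-- Of the first exponent, at least 2, one factor 1/k makes the kernel telescope and another absorbs
-- the bound k for `inner`. The result is uniform in `N`.
Z-decay : ∀ N a n → Admissible a → Z N a (suc n) (suc n) ≤ recip (suc n)
Z-decay N [] n _ = ℚₚ.≤-trans (h≤recip n (suc n)) (recip-anti (ℕₚ.n≤1+n n))
Z-decay N (suc (suc c) ∷ cs) n (_ , 1≤cs) = ℚₚ.≤-trans
  (sumBetween-telescope M (λ k → 0≤* (0≤recip M) (0≤h M k)) (λ k _ → term k) (suc N))
  (ℚₚ.≤-trans (*-monoˡ (recip M) (0≤recip M) (ℚₚ.≤-trans (h≤recip n M) (recip≤1 (suc M)))) (ℚₚ.≤-reflexive (ℚₚ.*-identityʳ (recip M))))
  where
  M = suc n
  open ℚₚ.≤-Reasoning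
  lem₁ : ∀ g r q i → g * (r * q) * i ≡ g * r * (q * i)
  lem₁ = solve-∀ ℚ-ring
  lem₂ : ∀ r a b → r * (a - b) ≡ r * a - r * b
  lem₂ = solve-∀ ℚ-ring
  term : ∀ k → h M (suc k) * recip (suc k ℕ.^ suc (suc c)) * inner cs (suc k) M ≤ recip M * h M k - recip M * h M (suc k)
  term k = begin
    g * recip (K ℕ.^ suc (suc c)) * I             ≡⟨ cong (λ y → g * y * I) (recip-* K (K ℕ.^ suc c)) ⟩
    g * (recip K * recip (K ℕ.^ suc c)) * I       ≡⟨ lem₁ g (recip K) (recip (K ℕ.^ suc c)) I ⟩
    g * recip K * (recip (K ℕ.^ suc c) * I)       ≤⟨ *-monoˡ (g * recip K) (0≤* (0≤h M K) (0≤recip K))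
                                                       (*-mono (0≤recip K) (inner-nonneg cs K M) (recip-^≤recip K {suc c} (ℕ.s≤s ℕ.z≤n)) (inner≤ι cs 1≤cs k M)) ⟩
    g * recip K * (recip K * ι K)                 ≡⟨ cong (g * recip K *_) (recip-ι k) ⟩
    g * recip K * 1ℚ                              ≡⟨ ℚₚ.*-identityʳ (g * recip K) ⟩
    g * recip K                                   ≡⟨ h-telescope n k ⟩
    recip M * (h M k - g)                         ≡⟨ lem₂ (recip M) (h M k) g ⟩
    recip M * h M k - recip M * g                 ∎
    where
    K = suc k
    g = h M K
    I = inner cs K M
Z-decay N (suc zero ∷ cs) n (ℕ.s≤s () , _)
Z-decay N (zero ∷ cs) n (() , _)

-- The ratio 4 - 2/(n + 1) of consecutive central binomial coefficients is at least 2, so the sum of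
-- all later reciprocals is at most `h n n`.
h-diagonal-≤ : ∀ n → h (suc n) (suc n) ≤ h n n - h (suc n) (suc n)
h-diagonal-≤ n = 0≤q-p⇒p≤q (ℚₚ.*-cancelˡ-≤-pos (ι (suc n)) {{positive (0<ι n)}}
  (ℚₚ.≤-trans (ℚₚ.≤-reflexive (ℚₚ.*-zeroʳ (ι (suc n)))) (ℚₚ.≤-trans (0≤* (0≤+ (0≤ι n) (0≤ι n)) (0≤h (suc n) (suc n))) (ℚₚ.≤-reflexive (sym eq)))))
  where
  g = h (suc n) (suc n)
  lem₁ : ∀ x a g → x * (a - g - g) ≡ x * a - x * (g + g)
  lem₁ = solve-∀ ℚ-ring
  lem₂ : ∀ y g → (((1ℚ + y) + (1ℚ + y) - 1ℚ) + ((1ℚ + y) + (1ℚ + y) - 1ℚ)) * g - (1ℚ + y) * (g + g) ≡ (y + y) * g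
  lem₂ = solve-∀ ℚ-ring
  eq : ι (suc n) * (h n n - g - g) ≡ (ι n + ι n) * g
  eq = trans (lem₁ (ι (suc n)) (h n n) g) (trans (cong (_- ι (suc n) * (g + g)) (h-diagonal n)) (lem₂ (ι n) g))

Y-nonneg : ∀ J n N → 0ℚ ≤ Y J n N
Y-nonneg []      n N = 0≤h n n
Y-nonneg (d ∷ J) n N = sumBetween-nonneg (suc N) (λ m _ → 0≤* (0≤^ (exponent d J) (0≤recip m)) (Y-nonneg J m N))

Y≤h : ∀ J n N → Y J n N ≤ h n n
Y≤h []      n N = ℚₚ.≤-refl
Y≤h (d ∷ J) n N = sumBetween-telescope n (λ k → 0≤h k k) (λ k _ → term k) (suc N)
  where
  term : ∀ k → recip (suc k) ^ℚ exponent d J * Y J (suc k) N ≤ h k k - h (suc k) (suc k)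
  term k = ℚₚ.≤-trans (*-mono 0≤1 (Y-nonneg J (suc k) N) (^≤1 (exponent d J) (0≤recip (suc k)) (recip≤1 (suc k))) (Y≤h J (suc k) N))
    (ℚₚ.≤-trans (ℚₚ.≤-reflexive (ℚₚ.*-identityˡ (h (suc k) (suc k)))) (h-diagonal-≤ k))

Y-decay : ∀ J n N → Y J (suc n) N ≤ recip (suc n)
Y-decay J n N = ℚₚ.≤-trans (Y≤h J (suc n) N) (ℚₚ.≤-trans (h≤recip n (suc n)) (recip-anti (ℕₚ.n≤1+n n)))

Decay : (ℕ → ℕ → ℚ) → Set
Decay D = ∃ λ K → ∀ n N → ∣ D (suc n) N ∣ ≤ K * recip (suc n)

Decay-nonneg : ∀ {D} → (∀ n N → 0ℚ ≤ D n N) → (∀ n N → D (suc n) N ≤ recip (suc n)) → Decay D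
Decay-nonneg 0≤D le = 1ℚ , λ n N → ℚₚ.≤-trans (ℚₚ.≤-reflexive (ℚₚ.0≤p⇒∣p∣≡p (0≤D (suc n) N)))
  (ℚₚ.≤-trans (le n N) (ℚₚ.≤-reflexive (sym (ℚₚ.*-identityˡ (recip (suc n))))))

Decay-+ : ∀ {D E} → Decay D → Decay E → Decay (λ n N → D n N + E n N)
Decay-+ {D} {E} (K , dD) (K′ , dE) = K + K′ , λ n N → ℚₚ.≤-trans (ℚₚ.∣p+q∣≤∣p∣+∣q∣ (D (suc n) N) (E (suc n) N))
  (ℚₚ.≤-trans (ℚₚ.+-mono-≤ (dD n N) (dE n N)) (ℚₚ.≤-reflexive (sym (ℚₚ.*-distribʳ-+ (recip (suc n)) K K′))))

Decay-* : ∀ c {D} → Decay D → Decay (λ n N → c * D n N)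
Decay-* c {D} (K , dD) = ∣ c ∣ * K , λ n N → ℚₚ.≤-trans (ℚₚ.≤-reflexive (ℚₚ.∣p*q∣≡∣p∣*∣q∣ c (D (suc n) N)))
  (ℚₚ.≤-trans (*-monoˡ ∣ c ∣ (ℚₚ.0≤∣p∣ c) (dD n N)) (ℚₚ.≤-reflexive (sym (ℚₚ.*-assoc ∣ c ∣ K (recip (suc n))))))

Decay-sumTo : ∀ {D : ℕ → ℕ → ℕ → ℚ} k → (∀ i → Decay (D i)) → Decay (λ n N → sumTo (λ i → D i n N) k)
Decay-sumTo zero    dec = 0ℚ , λ n N → ℚₚ.≤-reflexive (sym (ℚₚ.*-zeroˡ (recip (suc n))))
Decay-sumTo {D} (suc k) dec = Decay-+ {λ n N → sumTo (λ i → D i n N) k} {D k} (Decay-sumTo {D} k dec) (dec k)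

-- The decay in n is uniform in N, so it survives the passage to the limit N → ∞.
stationary⇒null : ∀ {D} → Decay D → (∀ n → Null (λ N → D n N - D (suc n) N)) → ∀ n → Null (D n)
stationary⇒null {D} (K , dec) step n ε 0<ε = go (archimedean-* K δ 0<δ)
  where
  δ = recip 2 * ε
  0<δ = halve ε 0<ε
  lem₁ : ∀ a → 0ℚ ≡ a - a
  lem₁ = solve-∀ ℚ-ring
  lem₂ : ∀ a b c → a - c ≡ (a - b) + (b - c)
  lem₂ = solve-∀ ℚ-ring
  lem₃ : ∀ a b → a ≡ (a - b) + b
  lem₃ = solve-∀ ℚ-ring
  far : ∀ t → Null (λ N → D n N - D (t ℕ.+ n) N)
  far zero    = Null-≡ 0 (λ N _ → sym (lem₁ (D n N))) Null-0
  far (suc t) = Null-≡ 0 (λ N _ → lem₂ (D n N) (D (t ℕ.+ n) N) (D (suc (t ℕ.+ n)) N)) (Null-+ (far t) (step (t ℕ.+ n)))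
  go : (∃ λ M → K ≤ δ * ι M) → Σ ℕ λ M → ∀ N → M ℕ.≤ N → ∣ D n N ∣ < ε
  go (T , K≤) = proj₁ near , λ N le → ℚₚ.≤-<-trans (bound N) (ℚₚ.<-≤-trans (ℚₚ.+-monoˡ-< δ (proj₂ near N le)) (ℚₚ.≤-reflexive (halves ε)))
    where
    m = T ℕ.+ n
    near = far (suc T) δ 0<δ
    small : ∀ N → ∣ D (suc m) N ∣ ≤ δ
    small N = ℚₚ.≤-trans (dec m N) (ℚₚ.≤-trans (*-monoʳ (recip (suc m)) (0≤recip (suc m)) K≤)
      (ℚₚ.≤-trans (ℚₚ.≤-reflexive (ℚₚ.*-assoc δ (ι T) (recip (suc m))))
        (ℚₚ.≤-trans (*-monoˡ δ (ℚₚ.<⇒≤ 0<δ) (ι*recip≤1 m (ℕₚ.m≤n⇒m≤1+n (ℕₚ.m≤m+n T n)))) (ℚₚ.≤-reflexive (ℚₚ.*-identityʳ δ)))))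
    bound : ∀ N → ∣ D n N ∣ ≤ ∣ D n N - D (suc m) N ∣ + δ
    bound N = ℚₚ.≤-trans (ℚₚ.≤-reflexive (cong ∣_∣ (lem₃ (D n N) (D (suc m) N))))
      (ℚₚ.≤-trans (ℚₚ.∣p+q∣≤∣p∣+∣q∣ (D n N - D (suc m) N) (D (suc m) N)) (ℚₚ.+-monoʳ-≤ ∣ D n N - D (suc m) N ∣ (small N)))

-- The recurrence satisfied by the diagonal double tails

weight : Composition → ℕ
weight []       = 0
weight (c ∷ cs) = c ℕ.+ weight cs

ones : Composition → ℕ
ones (suc zero ∷ cs) = suc (ones cs)
ones _               = 0

dropOnes : Composition → Composition
dropOnes []                 = []
dropOnes (zero ∷ cs)        = zero ∷ cs
dropOnes (suc zero ∷ cs)    = dropOnes cs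
dropOnes (suc (suc c) ∷ cs) = suc (suc c) ∷ cs

-- lower removes the leading 0 of the word and all the 1s following it; lowerDegree counts the removed letters.
lowerDegree : Composition → ℕ
lowerDegree (suc (suc zero) ∷ cs)    = suc (suc (ones cs))
lowerDegree (suc (suc (suc c)) ∷ cs) = 1
lowerDegree _                        = 0

lower : Composition → Composition
lower (suc (suc zero) ∷ cs)    = dropOnes cs
lower (suc (suc (suc c)) ∷ cs) = suc (suc c) ∷ cs
lower _                        = []

-- In general these are the degrees p + 1, q + 1, p + q + 2 with s, r, u. For a single part, the
-- defaults `lowerDegree [] = 0` and `lower [] = []` make the last two terms coincide, which matches
-- `h n (suc n)` being twice `h (suc n) (suc n)`.
terms : Composition → List (ℕ × Composition)
terms []       = []
terms (c ∷ cs) =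
  (lowerDegree (c ∷ cs) , lower (c ∷ cs)) ∷
  (lastPart c cs , initParts c cs) ∷
  (lastPart c cs ℕ.+ lowerDegree (initParts c cs) , lower (initParts c cs)) ∷ []

sumTerms : (ℕ → Composition → ℚ) → List (ℕ × Composition) → ℚ
sumTerms f []             = 0ℚ
sumTerms f ((j , t) ∷ ts) = f j t + sumTerms f ts

dropOnes-null : ∀ as → All (1 ℕ.≤_) as → ∀ m n →
  Null (λ N → Z N as (suc m) n - recip (suc m) ^ℚ ones as * Z N (dropOnes as) (suc m) n)
dropOnes-null [] _ m n = Null-≡ 0 (λ N _ → lem (h (suc m) n)) Null-0
  where
  lem : ∀ z → z - 1ℚ * z ≡ 0ℚ
  lem = solve-∀ ℚ-ring
dropOnes-null (suc zero ∷ cs) (_ ∷ 1≤cs) m n =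
  Null-≡ 0 (λ N _ → lem (Z N (1 ∷ cs) (suc m) n) (recip (suc m)) (Z N cs (suc m) n) (recip (suc m) ^ℚ ones cs) (Z N (dropOnes cs) (suc m) n))
    (Null-+ (Z-one-null cs 1≤cs m n) (Null-* (recip (suc m)) (dropOnes-null cs 1≤cs m n)))
  where
  lem : ∀ z r w p y → z - r * p * y ≡ (z - r * w) + r * (w - p * y)
  lem = solve-∀ ℚ-ring
dropOnes-null (suc (suc c) ∷ cs) _ m n = Null-≡ 0 (λ N _ → lem (Z N (suc (suc c) ∷ cs) (suc m) n)) Null-0
  where
  lem : ∀ z → z - 1ℚ * z ≡ 0ℚ
  lem = solve-∀ ℚ-ring
dropOnes-null (zero ∷ cs) (() ∷ _) m n

h-off-diagonal : ∀ n → h n (suc n) ≡ h (suc n) (suc n) + h (suc n) (suc n)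
h-off-diagonal n = *-cancelˡ-≢0 (ι (suc n)) (ι≢0 n) (begin
  ι (suc n) * h n (suc n)                                       ≡⟨ ℚₚ.*-comm (ι (suc n)) (h n (suc n)) ⟩
  h n (suc n) * ι (suc n)                                       ≡⟨ h-lower n (suc n) ⟨
  h (suc n) (suc n) * ι (suc (suc n ℕ.+ n))                     ≡⟨ cong (λ k → h (suc n) (suc n) * ι k) (sym (ℕₚ.+-suc (suc n) n)) ⟩
  h (suc n) (suc n) * ι (suc n ℕ.+ suc n)                       ≡⟨ cong (h (suc n) (suc n) *_) (ι-+ (suc n) (suc n)) ⟩
  h (suc n) (suc n) * (ι (suc n) + ι (suc n))                   ≡⟨ lem (ι (suc n)) (h (suc n) (suc n)) ⟩
  ι (suc n) * (h (suc n) (suc n) + h (suc n) (suc n))           ∎)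
  where
  open ≡-Reasoning
  lem : ∀ x y → y * (x + x) ≡ x * (y + y)
  lem = solve-∀ ℚ-ring

-- For a first part at least 3, `Z-left` alone suffices and is exact. For 2 it leaves exponent 1,
-- and telescoping then consumes the whole run of 1s, up to null boundary terms.
lower-null : ∀ a → Admissible a → ∀ n → Null (λ N → Z N a n (suc n) -
  (Z N a (suc n) (suc n) + recip (suc n) ^ℚ lowerDegree a * Z N (lower a) (suc n) (suc n)))
lower-null [] _ n = Null-≡ 0 (λ N _ → trans (cong (_- (h (suc n) (suc n) + 1ℚ * h (suc n) (suc n))) (h-off-diagonal n)) (lem (h (suc n) (suc n)))) Null-0
  where
  lem : ∀ g → (g + g) - (g + 1ℚ * g) ≡ 0ℚ
  lem = solve-∀ ℚ-ring
lower-null (suc (suc zero) ∷ cs) (_ , 1≤cs) n = Null-≡ 0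
  (λ N _ → trans (cong (_- (Z N (2 ∷ cs) (suc n) (suc n) + r * (r * p) * Z N (dropOnes cs) (suc n) (suc n))) (Z-left N 1 cs n (suc n)))
    (lem (Z N (2 ∷ cs) (suc n) (suc n)) r (Z N (1 ∷ cs) (suc n) (suc n)) (Z N cs (suc n) (suc n)) p (Z N (dropOnes cs) (suc n) (suc n))))
  (Null-+ (Null-* r (Z-one-null cs 1≤cs n (suc n))) (Null-* (r * r) (dropOnes-null cs 1≤cs n (suc n))))
  where
  r = recip (suc n)
  p = r ^ℚ ones cs
  lem : ∀ z r w y p x → z + r * w - (z + r * (r * p) * x) ≡ r * (w - r * y) + r * r * (y - p * x)
  lem = solve-∀ ℚ-ring
lower-null (suc (suc (suc c)) ∷ cs) _ n = Null-≡ 0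
  (λ N _ → trans (cong (_- (Z N (suc (suc (suc c)) ∷ cs) (suc n) (suc n) + r * 1ℚ * Z N (suc (suc c) ∷ cs) (suc n) (suc n))) (Z-left N (suc (suc c)) cs n (suc n)))
    (lem (Z N (suc (suc (suc c)) ∷ cs) (suc n) (suc n)) r (Z N (suc (suc c) ∷ cs) (suc n) (suc n))))
  Null-0
  where
  r = recip (suc n)
  lem : ∀ z r w → z + r * w - (z + r * 1ℚ * w) ≡ 0ℚ
  lem = solve-∀ ℚ-ring
lower-null (suc zero ∷ cs) (ℕ.s≤s () , _) n
lower-null (zero ∷ cs) (() , _) n

initParts-positive : ∀ c cs → 1 ℕ.≤ c → All (1 ℕ.≤_) cs → All (1 ℕ.≤_) (initParts c cs)
initParts-positive c []       _   _             = []
initParts-positive c (d ∷ ds) 1≤c (1≤d ∷ 1≤ds) = 1≤c ∷ initParts-positive d ds 1≤d 1≤ds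

initParts-admissible : ∀ c cs → Admissible (c ∷ cs) → Admissible (initParts c cs)
initParts-admissible c []       _                     = tt
initParts-admissible c (d ∷ ds) (2≤c , 1≤d ∷ 1≤ds) = 2≤c , initParts-positive d ds 1≤d 1≤ds

dropOnes-admissible : ∀ cs → All (1 ℕ.≤_) cs → Admissible (dropOnes cs)
dropOnes-admissible []                 _            = tt
dropOnes-admissible (zero ∷ cs)        (() ∷ _)
dropOnes-admissible (suc zero ∷ cs)    (_ ∷ 1≤cs) = dropOnes-admissible cs 1≤cs
dropOnes-admissible (suc (suc c) ∷ cs) (_ ∷ 1≤cs) = ℕ.s≤s (ℕ.s≤s ℕ.z≤n) , 1≤cs

lower-admissible : ∀ a → Admissible a → Admissible (lower a)
lower-admissible []                         _          = tt
lower-admissible (zero ∷ cs)                (() , _)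
lower-admissible (suc zero ∷ cs)            (ℕ.s≤s () , _)
lower-admissible (suc (suc zero) ∷ cs)      (_ , 1≤cs) = dropOnes-admissible cs 1≤cs
lower-admissible (suc (suc (suc c)) ∷ cs)   (_ , 1≤cs) = ℕ.s≤s (ℕ.s≤s ℕ.z≤n) , 1≤cs

ones-weight : ∀ cs → ones cs ℕ.+ weight (dropOnes cs) ≡ weight cs
ones-weight []                 = refl
ones-weight (zero ∷ cs)        = refl
ones-weight (suc zero ∷ cs)    = cong suc (ones-weight cs)
ones-weight (suc (suc c) ∷ cs) = refl

lower-weight : ∀ a → Admissible a → lowerDegree a ℕ.+ weight (lower a) ≡ weight a
lower-weight []                         _          = refl
lower-weight (zero ∷ cs)                (() , _)
lower-weight (suc zero ∷ cs)            (ℕ.s≤s () , _)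
lower-weight (suc (suc zero) ∷ cs)      _          = cong (suc ∘ suc) (ones-weight cs)
lower-weight (suc (suc (suc c)) ∷ cs)   _          = refl

initParts-weight : ∀ c cs → lastPart c cs ℕ.+ weight (initParts c cs) ≡ c ℕ.+ weight cs
initParts-weight c []       = refl
initParts-weight c (d ∷ ds) = trans (sym (ℕₚ.+-assoc (lastPart d ds) c (weight (initParts d ds))))
  (trans (cong (ℕ._+ weight (initParts d ds)) (ℕₚ.+-comm (lastPart d ds) c))
    (trans (ℕₚ.+-assoc c (lastPart d ds) (weight (initParts d ds))) (cong (c ℕ.+_) (initParts-weight d ds))))

lastPart-positive : ∀ c cs → 1 ℕ.≤ c → All (1 ℕ.≤_) cs → 1 ℕ.≤ lastPart c cs
lastPart-positive c []       1≤c _            = 1≤c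
lastPart-positive c (d ∷ ds) _   (1≤d ∷ 1≤ds) = lastPart-positive d ds 1≤d 1≤ds

TermOf : Composition → ℕ × Composition → Set
TermOf a (j , t) = Admissible t × j ℕ.+ weight t ≡ weight a × 1 ℕ.≤ j

terms-spec : ∀ c cs → Admissible (c ∷ cs) → All (TermOf (c ∷ cs)) (terms (c ∷ cs))
terms-spec c cs adm@(2≤c , 1≤cs) =
  (lower-admissible (c ∷ cs) adm , lower-weight (c ∷ cs) adm , lowerDegree-positive c 2≤c) ∷
  (init-adm , initParts-weight c cs , last-pos) ∷
  (lower-admissible (initParts c cs) init-adm ,
    trans (ℕₚ.+-assoc (lastPart c cs) (lowerDegree (initParts c cs)) (weight (lower (initParts c cs))))
      (trans (cong (lastPart c cs ℕ.+_) (lower-weight (initParts c cs) init-adm)) (initParts-weight c cs)) ,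
    ℕₚ.≤-trans last-pos (ℕₚ.m≤m+n (lastPart c cs) (lowerDegree (initParts c cs)))) ∷ []
  where
  init-adm = initParts-admissible c cs adm
  last-pos = lastPart-positive c cs (ℕₚ.≤-trans (ℕ.s≤s ℕ.z≤n) 2≤c) 1≤cs
  lowerDegree-positive : ∀ c → 2 ℕ.≤ c → 1 ℕ.≤ lowerDegree (c ∷ cs)
  lowerDegree-positive (suc (suc zero))    _ = ℕ.s≤s ℕ.z≤n
  lowerDegree-positive (suc (suc (suc c))) _ = ℕ.s≤s ℕ.z≤n
  lowerDegree-positive (suc zero) (ℕ.s≤s ())

-- `Z-right` raises the lower bound while the binomial parameter is still `n`; `lower-null` then
-- raises that parameter in both resulting tails.
Z-recurrence : ∀ c cs → Admissible (c ∷ cs) → ∀ n → Null (λ N → Z N (c ∷ cs) n n -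
  (Z N (c ∷ cs) (suc n) (suc n) + sumTerms (λ j t → recip (suc n) ^ℚ j * Z N t (suc n) (suc n)) (terms (c ∷ cs))))
Z-recurrence c cs adm n = Null-≡ (suc n) eq
  (Null-+ (lower-null (c ∷ cs) adm n) (Null-* s (lower-null a′ (initParts-admissible c cs adm) n)))
  where
  a = c ∷ cs
  a′ = initParts c cs
  r = recip (suc n)
  s = r ^ℚ lastPart c cs
  p = r ^ℚ lowerDegree a
  p′ = r ^ℚ lowerDegree a′
  lem : ∀ A s B A′ p A″ B′ p′ B″ → A + s * B - (A′ + (p * A″ + (s * B′ + (s * p′ * B″ + 0ℚ)))) ≡ (A - (A′ + p * A″)) + s * (B - (B′ + p′ * B″))
  lem = solve-∀ ℚ-ring
  eq : ∀ N → suc n ℕ.≤ N → Z N a n n - (Z N a (suc n) (suc n) + sumTerms (λ j t → r ^ℚ j * Z N t (suc n) (suc n)) (terms a)) ≡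
    (Z N a n (suc n) - (Z N a (suc n) (suc n) + p * Z N (lower a) (suc n) (suc n))) +
    s * (Z N a′ n (suc n) - (Z N a′ (suc n) (suc n) + p′ * Z N (lower a′) (suc n) (suc n)))
  eq N n<N = trans
    (cong₂ (λ y w → y - (Z N a (suc n) (suc n) + (p * Z N (lower a) (suc n) (suc n) + (s * Z N a′ (suc n) (suc n) + (w * Z N (lower a′) (suc n) (suc n) + 0ℚ)))))
      (Z-right N c cs n n n<N) (^ℚ-+ r (lastPart c cs) (lowerDegree a′)))
    (lem (Z N a n (suc n)) s (Z N a′ n (suc n)) (Z N a (suc n) (suc n)) p (Z N (lower a) (suc n) (suc n)) (Z N a′ (suc n) (suc n)) p′ (Z N (lower a′) (suc n) (suc n)))

-- Expansion into Apéry-like sums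

-- component j f ts sums f over the terms of degree j; φ J a is the multiplicity of Y J in the expansion of a.
component : ℕ → (Composition → ℕ) → List (ℕ × Composition) → ℕ
component j f []             = 0
component j f ((i , t) ∷ ts) = (if i ℕ.≡ᵇ j then f t else 0) ℕ.+ component j f ts

φ : List ℕ → Composition → ℕ
φ []      []      = 1
φ []      (_ ∷ _) = 0
φ (d ∷ J) a       = component (exponent d J) (φ J) (terms a)

≡ᵇ-refl : ∀ k → (k ℕ.≡ᵇ k) ≡ true
≡ᵇ-refl zero    = refl
≡ᵇ-refl (suc k) = ≡ᵇ-refl k

≢⇒≡ᵇ-false : ∀ {k d} → k ≢ d → (k ℕ.≡ᵇ d) ≡ false
≢⇒≡ᵇ-false {zero}  {zero}  k≢d = contradiction refl k≢d
≢⇒≡ᵇ-false {zero}  {suc d} _   = refl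
≢⇒≡ᵇ-false {suc k} {zero}  _   = refl
≢⇒≡ᵇ-false {suc k} {suc d} k≢d = ≢⇒≡ᵇ-false (k≢d ∘ cong suc)

sumTo-delta : ∀ (f : ℕ → ℚ) v k B → k ℕ.< B → sumTo (λ d → ι (if k ℕ.≡ᵇ d then v else 0) * f d) B ≡ f k * ι v
sumTo-delta f v k (suc B) k<B = go (ℕₚ.m≤n⇒m<n∨m≡n (ℕ.s≤s⁻¹ k<B))
  where
  term : ℕ → ℚ
  term d = ι (if k ℕ.≡ᵇ d then v else 0) * f d
  off : ∀ {d} → k ≢ d → term d ≡ 0ℚ
  off {d} k≢d = trans (cong (λ b → ι (if b then v else 0) * f d) (≢⇒≡ᵇ-false k≢d)) (ℚₚ.*-zeroˡ (f d))
  on : term k ≡ f k * ι v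
  on = trans (cong (λ b → ι (if b then v else 0) * f k) (≡ᵇ-refl k)) (ℚₚ.*-comm (ι v) (f k))
  go : k ℕ.< B ⊎ k ≡ B → sumTo term (suc B) ≡ f k * ι v
  go (inj₁ lt) = trans (cong₂ _+_ (sumTo-delta f v k B lt) (off (ℕₚ.<⇒≢ lt))) (ℚₚ.+-identityʳ (f k * ι v))
  go (inj₂ refl) = trans (cong₂ _+_ (sumTo-0 k (λ d d<k → off (λ k≡d → ℕₚ.<⇒≢ d<k (sym k≡d)))) on) (ℚₚ.+-identityˡ (f k * ι v))

admissible-weight : ∀ c cs → Admissible (c ∷ cs) → 2 ℕ.≤ weight (c ∷ cs)
admissible-weight c cs (2≤c , _) = ℕₚ.≤-trans 2≤c (ℕₚ.m≤m+n c (weight cs))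

module Expansion (B : ℕ) where

  open Layers B

  tree : ℕ → Composition → ℕ → ℕ → ℚ
  tree L a n N = treeSum L (λ J → ι (φ J a) * Y J n N)

  -- The conditions under which a term of degree `j` is met by some digit below `B`; the last one
  -- reflects that the exponent next to the binomial coefficient is at least 2.
  Admits : ℕ × Composition → Set
  Admits (j , t) = 1 ℕ.≤ j × j ℕ.≤ B × (t ≡ [] → 2 ℕ.≤ j)

  term-coefficient : ∀ r J {j t} → Admits (j , t) →
    sumTo (λ d → ι (if j ℕ.≡ᵇ exponent d J then φ J t else 0) * r ^ℚ exponent d J) B ≡ r ^ℚ j * ι (φ J t)
  term-coefficient r [] {j} {x ∷ xs} _ = trans (sumTo-0 B (λ d _ → zero-term d (j ℕ.≡ᵇ suc (suc d)))) (sym (ℚₚ.*-zeroʳ (r ^ℚ j)))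
    where
    zero-term : ∀ d b → ι (if b then 0 else 0) * r ^ℚ suc (suc d) ≡ 0ℚ
    zero-term d true  = ℚₚ.*-zeroˡ (r ^ℚ suc (suc d))
    zero-term d false = ℚₚ.*-zeroˡ (r ^ℚ suc (suc d))
  term-coefficient r [] {suc (suc k)} {[]} (_ , k<B , _) = sumTo-delta (λ d → r ^ℚ suc (suc d)) 1 k B (ℕₚ.<⇒≤ k<B)
  term-coefficient r [] {suc zero} {[]} (_ , _ , 2≤j) with 2≤j refl
  ... | ℕ.s≤s ()
  term-coefficient r [] {zero} {[]} (() , _)
  term-coefficient r (i ∷ J) {suc k} {t} (_ , k<B , _) = sumTo-delta (λ d → r ^ℚ suc d) (φ (i ∷ J) t) k B k<B
  term-coefficient r (i ∷ J) {zero} (() , _)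

  coefficient : ∀ r J ts → All Admits ts →
    sumTo (λ d → ι (component (exponent d J) (φ J) ts) * r ^ℚ exponent d J) B ≡ sumTerms (λ j t → r ^ℚ j * ι (φ J t)) ts
  coefficient r J [] _ = sumTo-0 B (λ d _ → ℚₚ.*-zeroˡ (r ^ℚ exponent d J))
  coefficient r J ((j , t) ∷ ts) (ok ∷ oks) = trans
    (sumTo-cong B (λ d _ → trans (cong (_* r ^ℚ exponent d J) (ι-+ (x d) (y d))) (ℚₚ.*-distribʳ-+ (r ^ℚ exponent d J) (ι (x d)) (ι (y d)))))
    (trans (sumTo-+ (λ d → ι (x d) * r ^ℚ exponent d J) (λ d → ι (y d) * r ^ℚ exponent d J) B)
      (cong₂ _+_ (term-coefficient r J ok) (coefficient r J ts oks)))
    where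
    x y : ℕ → ℕ
    x d = if j ℕ.≡ᵇ exponent d J then φ J t else 0
    y d = component (exponent d J) (φ J) ts

  treeSum-terms : ∀ L (g : ℕ → ℚ) ts n N →
    treeSum L (λ J → sumTerms (λ j t → g j * ι (φ J t)) ts * Y J n N) ≡ sumTerms (λ j t → g j * tree L t n N) ts
  treeSum-terms L g [] n N = trans (treeSum-*ˡ L 0ℚ (λ J → Y J n N)) (ℚₚ.*-zeroˡ (treeSum L (λ J → Y J n N)))
  treeSum-terms L g ((j , t) ∷ ts) n N = trans
    (treeSum-cong L (λ _ J _ → lem (g j) (ι (φ J t)) (rest J) (Y J n N)))
    (trans (treeSum-+ L (λ J → g j * (ι (φ J t) * Y J n N)) (λ J → rest J * Y J n N))
      (cong₂ _+_ (treeSum-*ˡ L (g j) (λ J → ι (φ J t) * Y J n N)) (treeSum-terms L g ts n N)))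
    where
    rest : List ℕ → ℚ
    rest J = sumTerms (λ j t → g j * ι (φ J t)) ts
    lem : ∀ g p s y → (g * p + s) * y ≡ g * (p * y) + s * y
    lem = solve-∀ ℚ-ring

  -- `Y-step` splits off heads, and `φ` at `d ∷ J` sorts the terms of the composition by exactly the
  -- exponent split off; removing a head costs one level of depth.
  tree-recurrence : ∀ L c cs → All Admits (terms (c ∷ cs)) → ∀ n N → suc n ℕ.≤ N → tree (suc L) (c ∷ cs) n N ≡
    tree (suc L) (c ∷ cs) (suc n) N + sumTerms (λ j t → recip (suc n) ^ℚ j * tree L t (suc n) N) (terms (c ∷ cs))
  tree-recurrence L c cs ok n N n<N = begin
    treeSum (suc L) (λ J → ι (φ J a) * Y J n N)
      ≡⟨ treeSum-cong (suc L) (λ _ J _ → each J) ⟩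
    treeSum (suc L) (λ J → ι (φ J a) * Y J (suc n) N + rest J)
      ≡⟨ treeSum-+ (suc L) (λ J → ι (φ J a) * Y J (suc n) N) rest ⟩
    tree (suc L) a (suc n) N + treeSum (suc L) rest
      ≡⟨ cong (_+_ (tree (suc L) a (suc n) N)) regroup ⟩
    tree (suc L) a (suc n) N + sumTerms (λ j t → r ^ℚ j * tree L t (suc n) N) (terms a) ∎
    where
    open ≡-Reasoning
    a = c ∷ cs
    r = recip (suc n)
    rest : List ℕ → ℚ
    rest []      = 0ℚ
    rest (d ∷ J) = Y J (suc n) N * (ι (φ (d ∷ J) a) * r ^ℚ exponent d J)
    lem₀ : ∀ x y → 0ℚ * x ≡ 0ℚ * y + 0ℚ
    lem₀ = solve-∀ ℚ-ring
    lem : ∀ f y p z → f * (y + p * z) ≡ f * y + z * (f * p)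
    lem = solve-∀ ℚ-ring
    each : ∀ J → ι (φ J a) * Y J n N ≡ ι (φ J a) * Y J (suc n) N + rest J
    each []      = lem₀ (h n n) (h (suc n) (suc n))
    each (d ∷ J) = trans (cong (ι (φ (d ∷ J) a) *_) (Y-step d J n N n<N))
      (lem (ι (φ (d ∷ J) a)) (Y (d ∷ J) (suc n) N) (r ^ℚ exponent d J) (Y J (suc n) N))
    sum-rest : ∀ J → sumTo (λ d → rest (d ∷ J)) B ≡ sumTerms (λ j t → r ^ℚ j * ι (φ J t)) (terms a) * Y J (suc n) N
    sum-rest J = trans (sumTo-*ˡ (Y J (suc n) N) (λ d → ι (φ (d ∷ J) a) * r ^ℚ exponent d J) B)
      (trans (cong (Y J (suc n) N *_) (coefficient r J (terms a) ok)) (ℚₚ.*-comm (Y J (suc n) N) (sumTerms (λ j t → r ^ℚ j * ι (φ J t)) (terms a))))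
    regroup : treeSum (suc L) rest ≡ sumTerms (λ j t → r ^ℚ j * tree L t (suc n) N) (terms a)
    regroup = trans (treeSum-children L rest) (trans (ℚₚ.+-identityˡ (treeSum L (λ J → sumTo (λ d → rest (d ∷ J)) B)))
      (trans (treeSum-cong L (λ _ J _ → sum-rest J)) (treeSum-terms L (r ^ℚ_) (terms a) (suc n) N)))

  tree-[] : ∀ L n N → tree L [] n N ≡ h n n
  tree-[] L n N = trans (sumTo-first (λ i → layerSum i f) L)
    (trans (cong₂ _+_ (ℚₚ.*-identityˡ (h n n)) (sumTo-0 L (λ i _ → layerSum-0 (suc i) vanish))) (ℚₚ.+-identityʳ (h n n)))
    where
    f : List ℕ → ℚ
    f J = ι (φ J []) * Y J n N
    vanish : ∀ {i} J → In (suc i) J → f J ≡ 0ℚ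
    vanish (d ∷ J) _ = ℚₚ.*-zeroˡ (Y (d ∷ J) n N)

  Decay-layerSum : ∀ {D : List ℕ → ℕ → ℕ → ℚ} i → (∀ J → Decay (D J)) → Decay (λ n N → layerSum i (λ J → D J n N))
  Decay-layerSum zero    dec = dec []
  Decay-layerSum {D} (suc i) dec = Decay-layerSum {λ J n N → sumTo (λ d → D (d ∷ J) n N) B} i
    (λ J → Decay-sumTo {λ d → D (d ∷ J)} B (λ d → dec (d ∷ J)))

  Decay-tree : ∀ L a → Decay (tree L a)
  Decay-tree L a = Decay-sumTo {λ i n N → layerSum i (λ J → ι (φ J a) * Y J n N)} (suc L)
    (λ i → Decay-layerSum {λ J n N → ι (φ J a) * Y J n N} i
      (λ J → Decay-* (ι (φ J a)) {Y J} (Decay-nonneg (Y-nonneg J) (Y-decay J))))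

  terms-admit : ∀ c cs → Admissible (c ∷ cs) → weight (c ∷ cs) ℕ.≤ B → All Admits (terms (c ∷ cs))
  terms-admit c cs adm w≤B = All.map (λ {x} → admit x) (terms-spec c cs adm)
    where
    admit : ∀ x → TermOf (c ∷ cs) x → Admits x
    admit (j , t) (_ , eq , 1≤j) = 1≤j , ℕₚ.≤-trans (ℕₚ.m+n≤o⇒m≤o j (ℕₚ.≤-reflexive eq)) w≤B ,
      λ { refl → subst (2 ℕ.≤_) (trans (sym eq) (ℕₚ.+-identityʳ j)) (admissible-weight c cs adm) }

  -- Tail and tree satisfy the same recurrence, up to null sequences and the induction hypothesis
  -- for the lighter terms, so their difference is stationary in n; uniform decay makes it null.
  expansion : ∀ L a → Admissible a → weight a ℕ.≤ L → weight a ℕ.≤ B → ∀ n → Null (λ N → Z N a n n - tree L a n N)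
  expansion L [] _ _ _ n = Null-≡ 0 (λ N _ → p≡q⇒p-q≡0 (sym (tree-[] L n N))) Null-0
  expansion zero (c ∷ cs) adm w≤L _ n with ℕₚ.≤-trans (admissible-weight c cs adm) w≤L
  ... | ()
  expansion (suc L) (c ∷ cs) adm w≤L w≤B = stationary⇒null decay step
    where
    a = c ∷ cs
    D : ℕ → ℕ → ℚ
    D n N = Z N a n n - tree (suc L) a n N
    lem₀ : ∀ u v → u + (- 1ℚ) * v ≡ u - v
    lem₀ = solve-∀ ℚ-ring
    decay : Decay D
    decay = let K , dec = Decay-+ {λ n N → Z N a n n} {λ n N → (- 1ℚ) * tree (suc L) a n N}
                  (Decay-nonneg (λ n N → Z-nonneg N a n n) (λ n N → Z-decay N a n adm))
                  (Decay-* (- 1ℚ) {tree (suc L) a} (Decay-tree (suc L) a))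
            in K , λ n N → subst (λ y → ∣ y ∣ ≤ K * recip (suc n)) (lem₀ (Z N a (suc n) (suc n)) (tree (suc L) a (suc n) N)) (dec n N)
    terms-null : ∀ n ts → All (TermOf a) ts → Null (λ N →
      sumTerms (λ j t → recip (suc n) ^ℚ j * Z N t (suc n) (suc n)) ts - sumTerms (λ j t → recip (suc n) ^ℚ j * tree L t (suc n) N) ts)
    terms-null n [] _ = Null-0
    terms-null n ((j , t) ∷ ts) ((t-adm , eq , 1≤j) ∷ oks) = Null-≡ 0
      (λ N _ → lem (recip (suc n) ^ℚ j) (Z N t (suc n) (suc n)) (tree L t (suc n) N)
        (sumTerms (λ j t → recip (suc n) ^ℚ j * Z N t (suc n) (suc n)) ts) (sumTerms (λ j t → recip (suc n) ^ℚ j * tree L t (suc n) N) ts))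
      (Null-+ (Null-* (recip (suc n) ^ℚ j) (expansion L t t-adm t≤L t≤B (suc n))) (terms-null n ts oks))
      where
      lem : ∀ r z y s u → r * z + s - (r * y + u) ≡ r * (z - y) + (s - u)
      lem = solve-∀ ℚ-ring
      t<a : weight t ℕ.< weight a
      t<a = ℕₚ.≤-trans (ℕₚ.+-monoˡ-≤ (weight t) 1≤j) (ℕₚ.≤-reflexive eq)
      t≤L = ℕ.s≤s⁻¹ (ℕₚ.≤-trans t<a w≤L)
      t≤B = ℕₚ.≤-trans (ℕₚ.<⇒≤ t<a) w≤B
    step : ∀ n → Null (λ N → D n N - D (suc n) N)
    step n = Null-≡ (suc n) eq (Null-+ (Z-recurrence c cs adm n) (terms-null n (terms a) (terms-spec c cs adm)))
      where
      zs ys : ℕ → ℚ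
      zs N = sumTerms (λ j t → recip (suc n) ^ℚ j * Z N t (suc n) (suc n)) (terms a)
      ys N = sumTerms (λ j t → recip (suc n) ^ℚ j * tree L t (suc n) N) (terms a)
      lem : ∀ z z′ y′ s u → (z - (y′ + u)) - (z′ - y′) ≡ (z - (z′ + s)) + (s - u)
      lem = solve-∀ ℚ-ring
      eq : ∀ N → suc n ℕ.≤ N → D n N - D (suc n) N ≡ (Z N a n n - (Z N a (suc n) (suc n) + zs N)) + (zs N - ys N)
      eq N n<N = trans (cong (λ y → (Z N a n n - y) - D (suc n) N) (tree-recurrence L c cs (terms-admit c cs adm w≤B) n N n<N))
        (lem (Z N a n n) (Z N a (suc n) (suc n)) (tree (suc L) a (suc n) N) (zs N) (ys N))

-- Words and duality

dualWord-∷ : ∀ b w → dualWord (b ∷ w) ≡ dualWord w ++ [ not b ]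
dualWord-∷ b w = unfold-reverse (not b) (map not w)

dualWord-++ : ∀ v w → dualWord (v ++ w) ≡ dualWord w ++ dualWord v
dualWord-++ v w = trans (cong reverse (map-++ not v w)) (reverse-++ (map not v) (map not w))

dualWord-involutive : ∀ w → dualWord (dualWord w) ≡ w
dualWord-involutive []      = refl
dualWord-involutive (b ∷ w) = trans (cong dualWord (dualWord-∷ b w)) (trans (dualWord-++ (dualWord w) [ not b ])
  (cong₂ _∷_ (not-involutive b) (dualWord-involutive w)))

replicate-snoc : ∀ {A : Set} k (b : A) → replicate k b ++ [ b ] ≡ b ∷ replicate k b
replicate-snoc zero    b = refl
replicate-snoc (suc k) b = cong (b ∷_) (replicate-snoc k b)

dualWord-replicate : ∀ k b → dualWord (replicate k b) ≡ replicate k (not b)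
dualWord-replicate zero    b = refl
dualWord-replicate (suc k) b = trans (dualWord-∷ b (replicate k b)) (trans (cong (_++ [ not b ]) (dualWord-replicate k b)) (replicate-snoc k (not b)))

0^⟨_⟩1 : ℕ → List Bool
0^⟨ q ⟩1 = replicate q false ++ [ true ]

01^_ : ℕ → List Bool
01^ p = false ∷ replicate p true

dualWord-0^1 : ∀ q → dualWord (0^⟨ q ⟩1) ≡ 01^ q
dualWord-0^1 q = trans (dualWord-++ (replicate q false) [ true ]) (cong (false ∷_) (dualWord-replicate q false))

dualWord-01^ : ∀ p → dualWord (01^ p) ≡ 0^⟨ p ⟩1
dualWord-01^ p = trans (cong dualWord (sym (dualWord-0^1 p))) (dualWord-involutive (0^⟨ p ⟩1))

sandwich : ℕ → List Bool → ℕ → List Bool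
sandwich p x q = 01^ p ++ (x ++ 0^⟨ q ⟩1)

dualWord-sandwich : ∀ p x q → dualWord (sandwich p x q) ≡ sandwich q (dualWord x) p
dualWord-sandwich p x q = trans (dualWord-++ (01^ p) (x ++ 0^⟨ q ⟩1))
  (trans (cong₂ _++_ (trans (dualWord-++ x (0^⟨ q ⟩1)) (cong (_++ dualWord x) (dualWord-0^1 q))) (dualWord-01^ p))
    (++-assoc (01^ q) (dualWord x) (0^⟨ p ⟩1)))

commutes-with-01⇒self-dual : ∀ x → x ++ (false ∷ true ∷ []) ≡ false ∷ true ∷ x → dualWord x ≡ x
commutes-with-01⇒self-dual []              _  = refl
commutes-with-01⇒self-dual (false ∷ [])    eq with ∷-injectiveˡ (∷-injectiveʳ eq)
... | ()
commutes-with-01⇒self-dual (true ∷ [])     eq with ∷-injectiveˡ eq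
... | ()
commutes-with-01⇒self-dual (true ∷ _ ∷ x)  eq with ∷-injectiveˡ eq
... | ()
commutes-with-01⇒self-dual (false ∷ false ∷ x) eq with ∷-injectiveˡ (∷-injectiveʳ eq)
... | ()
commutes-with-01⇒self-dual (false ∷ true ∷ x) eq = trans (dualWord-++ (false ∷ true ∷ []) x)
  (trans (cong (_++ (false ∷ true ∷ [])) (commutes-with-01⇒self-dual x eq′)) eq′)
  where
  eq′ : x ++ (false ∷ true ∷ []) ≡ false ∷ true ∷ x
  eq′ = ∷-injectiveʳ (∷-injectiveʳ eq)

count : List Bool → ℕ
count []          = 0
count (true ∷ w)  = suc (count w)
count (false ∷ w) = count w

count-++ : ∀ v w → count (v ++ w) ≡ count v ℕ.+ count w
count-++ []          w = refl
count-++ (true ∷ v)  w = cong suc (count-++ v w)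
count-++ (false ∷ v) w = count-++ v w

count-0^1 : ∀ q → count (0^⟨ q ⟩1) ≡ 1
count-0^1 zero    = refl
count-0^1 (suc q) = count-0^1 q

count-01^ : ∀ p → count (01^ p) ≡ p
count-01^ zero    = refl
count-01^ (suc p) = cong suc (count-01^ p)

-- Comparing the numbers of 1s forces k = 1.
conjugate⇒self-dual : ∀ x k → x ++ 0^⟨ k ⟩1 ≡ 01^ k ++ x → dualWord x ≡ x
conjugate⇒self-dual x k eq = commutes-with-01⇒self-dual x (subst (λ k → x ++ 0^⟨ k ⟩1 ≡ 01^ k ++ x) k≡1 eq)
  where
  open ≡-Reasoning
  k≡1 : k ≡ 1
  k≡1 = ℕₚ.+-cancelʳ-≡ (count x) k 1 (begin
    k ℕ.+ count x                  ≡⟨ cong (ℕ._+ count x) (count-01^ k) ⟨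
    count (01^ k) ℕ.+ count x      ≡⟨ count-++ (01^ k) x ⟨
    count (01^ k ++ x)             ≡⟨ cong count eq ⟨
    count (x ++ 0^⟨ k ⟩1)            ≡⟨ count-++ x (0^⟨ k ⟩1) ⟩
    count x ℕ.+ count (0^⟨ k ⟩1)     ≡⟨ cong (count x ℕ.+_) (count-0^1 k) ⟩
    count x ℕ.+ 1                  ≡⟨ ℕₚ.+-comm (count x) 1 ⟩
    1 ℕ.+ count x                  ∎)

fromWordAux-replicate : ∀ k m w → fromWordAux k (replicate m false ++ true ∷ w) ≡ suc (m ℕ.+ k) ∷ fromWord w
fromWordAux-replicate k zero    w = refl
fromWordAux-replicate k (suc m) w = trans (fromWordAux-replicate (suc k) m w) (cong (λ j → suc j ∷ fromWord w) (ℕₚ.+-suc m k))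

fromWord-word : ∀ a → All (1 ℕ.≤_) a → fromWord (word a) ≡ a
fromWord-word []            _             = refl
fromWord-word (suc c ∷ cs) (_ ∷ 1≤cs) = trans (cong fromWord (++-assoc (replicate c false) [ true ] (word cs)))
  (trans (fromWordAux-replicate 0 c (word cs)) (cong₂ (λ j as → suc j ∷ as) (ℕₚ.+-identityʳ c) (fromWord-word cs 1≤cs)))

admissible⇒positive : ∀ a → Admissible a → All (1 ℕ.≤_) a
admissible⇒positive []       _             = []
admissible⇒positive (c ∷ cs) (2≤c , 1≤cs) = ℕₚ.≤-trans (ℕ.s≤s ℕ.z≤n) 2≤c ∷ 1≤cs

word-initParts : ∀ c cs → word (c ∷ cs) ≡ word (initParts c cs) ++ 0^⟨ lastPart c cs ℕ.∸ 1 ⟩1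
word-initParts c []       = ++-identityʳ (0^⟨ c ℕ.∸ 1 ⟩1)
word-initParts c (d ∷ ds) = trans (cong (0^⟨ c ℕ.∸ 1 ⟩1 ++_) (word-initParts d ds))
  (sym (++-assoc (0^⟨ c ℕ.∸ 1 ⟩1) (word (initParts d ds)) (0^⟨ lastPart d ds ℕ.∸ 1 ⟩1)))

word-dropOnes : ∀ cs → word cs ≡ replicate (ones cs) true ++ word (dropOnes cs)
word-dropOnes []                 = refl
word-dropOnes (zero ∷ cs)        = refl
word-dropOnes (suc zero ∷ cs)    = cong (true ∷_) (word-dropOnes cs)
word-dropOnes (suc (suc c) ∷ cs) = refl

word-lower : ∀ c cs → 2 ℕ.≤ c → word (c ∷ cs) ≡ 01^ (lowerDegree (c ∷ cs) ℕ.∸ 1) ++ word (lower (c ∷ cs))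
word-lower (suc zero)          cs (ℕ.s≤s ())
word-lower (suc (suc zero))    cs _ = cong (λ w → false ∷ true ∷ w) (word-dropOnes cs)
word-lower (suc (suc (suc c))) cs _ = refl

-- Coefficients of the expansion determine the word up to duality

component-hit : ∀ j f t ts → component j f ((j , t) ∷ ts) ≡ f t ℕ.+ component j f ts
component-hit j f t ts = cong (λ b → (if b then f t else 0) ℕ.+ component j f ts) (≡ᵇ-refl j)

component-miss : ∀ {i j} f t ts → i ≢ j → component j f ((i , t) ∷ ts) ≡ component j f ts
component-miss {i} {j} f t ts i≢j = cong (λ b → (if b then f t else 0) ℕ.+ component j f ts) (≢⇒≡ᵇ-false i≢j)

-- Values are natural numbers, so other terms of the same degree cannot cancel this one.
component-∈ : ∀ {j t} f ts → (j , t) ∈ ts → f t ℕ.≤ component j f ts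
component-∈ {j} {t} f (_ ∷ ts) (here refl) = ℕₚ.≤-trans (ℕₚ.m≤m+n (f t) (component j f ts)) (ℕₚ.≤-reflexive (sym (component-hit j f t ts)))
component-∈ {j} f ((i , s) ∷ ts) (there t∈) = ℕₚ.≤-trans (component-∈ f ts t∈) (ℕₚ.m≤n+m (component j f ts) (if i ℕ.≡ᵇ j then f s else 0))

component-≢0 : ∀ {j} f ts → component j f ts ≢ 0 → ∃ λ t → (j , t) ∈ ts × f t ≢ 0
component-≢0 f [] ≢0 = contradiction refl ≢0
component-≢0 {j} f ((i , t) ∷ ts) ≢0 with i ℕₚ.≟ j
... | no i≢j = let s , s∈ , fs = component-≢0 f ts (λ e → ≢0 (trans (component-miss f t ts i≢j) e)) in s , there s∈ , fs
... | yes refl with f t ℕₚ.≟ 0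
...   | no ft≢0 = t , here refl , ft≢0
...   | yes ft≡0 = let s , s∈ , fs = component-≢0 f ts (λ e → ≢0 (trans (component-hit j f t ts) (cong₂ ℕ._+_ ft≡0 e))) in s , there s∈ , fs

size : List ℕ → ℕ
size []      = 0
size (d ∷ J) = exponent d J ℕ.+ size J

weight≡0 : ∀ a → Admissible a → weight a ≡ 0 → a ≡ []
weight≡0 []       _   _  = refl
weight≡0 (c ∷ cs) adm eq = contradiction (ℕₚ.≤-trans (admissible-weight c cs adm) (ℕₚ.≤-reflexive eq)) λ ()

term∈ : ∀ a {j t} → Admissible a → (j , t) ∈ terms a → TermOf a (j , t)
term∈ (c ∷ cs) adm t∈ = All.lookup (terms-spec c cs adm) t∈

-- The recurrence is homogeneous: degree and weight of each term add up to the weight of `a`. Hence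
-- any nonzero coefficient reveals the weight, and the lists that occur have bounded length.
φ-size : ∀ J a → Admissible a → φ J a ≢ 0 → size J ≡ weight a
φ-size []      []      _   _  = refl
φ-size []      (_ ∷ _) _   ≢0 = contradiction refl ≢0
φ-size (d ∷ J) a       adm ≢0 =
  let t , t∈ , φt≢0 = component-≢0 (φ J) (terms a) ≢0
      t-adm , eq , _ = term∈ a adm t∈
  in trans (cong (exponent d J ℕ.+_) (φ-size J t t-adm φt≢0)) eq

φ-nonzero : ∀ n a → Admissible a → weight a ℕ.≤ n → ∃ λ J → φ J a ≢ 0
φ-nonzero n       []       _   _   = [] , λ ()
φ-nonzero zero    (c ∷ cs) adm w≤n = contradiction (ℕₚ.≤-trans (admissible-weight c cs adm) w≤n) λ ()
φ-nonzero (suc n) (c ∷ cs) adm w≤n = extend (φ-nonzero n t t-adm t≤n)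
  where
  t = initParts c cs
  j = lastPart c cs
  t∈ : (j , t) ∈ terms (c ∷ cs)
  t∈ = there (here refl)
  t-adm = proj₁ (term∈ (c ∷ cs) adm t∈)
  eq = proj₁ (proj₂ (term∈ (c ∷ cs) adm t∈))
  1≤j = proj₂ (proj₂ (term∈ (c ∷ cs) adm t∈))
  t≤n : weight t ℕ.≤ n
  t≤n = ℕ.s≤s⁻¹ (ℕₚ.≤-trans (ℕₚ.≤-trans (ℕₚ.+-monoˡ-≤ (weight t) 1≤j) (ℕₚ.≤-reflexive eq)) w≤n)
  nonzero : ∀ {i} J → i ≡ j → φ J t ≢ 0 → component i (φ J) (terms (c ∷ cs)) ≢ 0
  nonzero J refl φt≢0 e = φt≢0 (ℕₚ.n≤0⇒n≡0 (ℕₚ.≤-trans (component-∈ (φ J) (terms (c ∷ cs)) t∈) (ℕₚ.≤-reflexive e)))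
  extend : (∃ λ J → φ J t ≢ 0) → ∃ λ J → φ J (c ∷ cs) ≢ 0
  -- `j ∸ 1` and, for the empty list, `j ∸ 2` invert `exponent`. In the latter case `t` has weight
  -- 0, so `j` is the whole weight and at least 2.
  extend (i ∷ J , φt≢0) = (j ℕ.∸ 1) ∷ i ∷ J , nonzero (i ∷ J) (ℕₚ.m+[n∸m]≡n 1≤j) φt≢0
  extend ([] , φt≢0) = (j ℕ.∸ 2) ∷ [] , nonzero [] (ℕₚ.m+[n∸m]≡n 2≤j) φt≢0
    where
    2≤j : 2 ℕ.≤ j
    2≤j = ℕₚ.≤-trans (admissible-weight c cs adm) (ℕₚ.≤-reflexive (trans (sym eq)
      (trans (cong (j ℕ.+_) (sym (φ-size [] t t-adm φt≢0))) (ℕₚ.+-identityʳ j))))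

SameExpansion : Composition → Composition → Set
SameExpansion a b = ∀ J → φ J a ≡ φ J b

SameExpansion-sym : ∀ {a b} → SameExpansion a b → SameExpansion b a
SameExpansion-sym same J = sym (same J)

same-weight : ∀ a b → Admissible a → Admissible b → SameExpansion a b → weight a ≡ weight b
same-weight a b a-adm b-adm same =
  let J , φ≢0 = φ-nonzero (weight a) a a-adm ℕₚ.≤-refl
  in trans (sym (φ-size J a a-adm φ≢0)) (φ-size J b b-adm (λ e → φ≢0 (trans (same J) e)))

-- `SameExpansion` does not test degree 1 at the empty list, since `exponent d []` is at least 2; a
-- nonzero component there would force weight 1.
no-unit-component : ∀ c cs → Admissible (c ∷ cs) → component 1 (φ []) (terms (c ∷ cs)) ≡ 0
no-unit-component c cs adm with component 1 (φ []) (terms (c ∷ cs)) ℕₚ.≟ 0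
... | yes eq = eq
... | no ≢0 = contradiction absurd λ { (ℕ.s≤s ()) }
  where
  found = component-≢0 (φ []) (terms (c ∷ cs)) ≢0
  t = proj₁ found
  spec = term∈ (c ∷ cs) adm (proj₁ (proj₂ found))
  absurd : 2 ℕ.≤ 1
  absurd = ℕₚ.≤-trans (admissible-weight c cs adm) (ℕₚ.≤-reflexive (trans (sym (proj₁ (proj₂ spec)))
    (cong suc (sym (φ-size [] t (proj₁ spec) (proj₂ (proj₂ found)))))))

same-components : ∀ c cs d ds → Admissible (c ∷ cs) → Admissible (d ∷ ds) → SameExpansion (c ∷ cs) (d ∷ ds) →
  ∀ j J → 1 ℕ.≤ j → component j (φ J) (terms (c ∷ cs)) ≡ component j (φ J) (terms (d ∷ ds))
same-components c cs d ds a-adm b-adm same (suc j)       (i ∷ J) _ = same (j ∷ i ∷ J)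
same-components c cs d ds a-adm b-adm same (suc (suc j)) []      _ = same (j ∷ [])
same-components c cs d ds a-adm b-adm same (suc zero)    []      _ =
  trans (no-unit-component c cs a-adm) (sym (no-unit-component d ds b-adm))

-- Every term has some nonzero coefficient, and without cancellation it survives in the component of
-- its degree; the same component of the other composition is then nonzero and contains a term.
same-degrees : ∀ c cs d ds → Admissible (c ∷ cs) → Admissible (d ∷ ds) → SameExpansion (c ∷ cs) (d ∷ ds) →
  ∀ {j t} → (j , t) ∈ terms (c ∷ cs) → ∃ λ s → (j , s) ∈ terms (d ∷ ds)
same-degrees c cs d ds a-adm b-adm same {j} {t} t∈ =
  let t-adm , _ , 1≤j = term∈ (c ∷ cs) a-adm t∈
      J , φt≢0 = φ-nonzero (weight t) t t-adm ℕₚ.≤-refl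
      s , s∈ , _ = component-≢0 (φ J) (terms (d ∷ ds)) (λ e → φt≢0 (ℕₚ.n≤0⇒n≡0 (ℕₚ.≤-trans (component-∈ (φ J) (terms (c ∷ cs)) t∈)
        (ℕₚ.≤-reflexive (trans (same-components c cs d ds a-adm b-adm same j J 1≤j) e)))))
  in s , s∈

-- The word of a is 0 1^p w(u) 0^q 1, and prefix, suffix are the compositions of the words 0 1^p w(u) and w(u) 0^q 1.
record Shape (a : Composition) : Set where
  field
    p q           : ℕ
    u             : Composition
    word≡         : word a ≡ sandwich p (word u) q
    top           : (suc (suc (p ℕ.+ q)) , u) ∈ terms a
    degrees       : ∀ {j t} → (j , t) ∈ terms a → j ≡ suc p ⊎ j ≡ suc q ⊎ j ≡ suc (suc (p ℕ.+ q))
    -- If u = ∅ and p or q is 0, removing letters at one end may use up the whole word, and the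
    -- degree p + 1 need not occur.
    degree-p      : (1 ℕ.≤ p × 1 ℕ.≤ q) ⊎ u ≢ [] → ∃ λ t → (suc p , t) ∈ terms a
    prefix suffix : Composition
    terms≡        : u ≢ [] → terms a ≡ (suc p , suffix) ∷ (suc q , prefix) ∷ (suc (suc (p ℕ.+ q)) , u) ∷ []
    word-prefix   : u ≢ [] → word prefix ≡ 01^ p ++ word u
    word-suffix   : u ≢ [] → word suffix ≡ word u ++ 0^⟨ q ⟩1

empty? : ∀ (a : Composition) → a ≡ [] ⊎ a ≢ []
empty? []      = inj₁ refl
empty? (_ ∷ _) = inj₂ λ ()

-- Dropping the last part shortens the leading run of 1s only if that run reaches the end of the
-- word; here it stops earlier.
ones-initParts : ∀ d ds → dropOnes (initParts d ds) ≢ [] → ones (d ∷ ds) ≡ ones (initParts d ds)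
ones-initParts d             []       ≢[] = contradiction refl ≢[]
ones-initParts zero          (e ∷ es) ≢[] = refl
ones-initParts (suc zero)    (e ∷ es) ≢[] = cong suc (ones-initParts e es ≢[])
ones-initParts (suc (suc d)) (e ∷ es) ≢[] = refl

ones-initParts-last : ∀ d ds → 1 ℕ.≤ d → All (1 ℕ.≤_) ds → dropOnes (initParts d ds) ≡ [] →
  (lastPart d ds ≡ 1 → ones (d ∷ ds) ≡ suc (ones (initParts d ds))) × (2 ℕ.≤ lastPart d ds → ones (d ∷ ds) ≡ ones (initParts d ds))
ones-initParts-last (suc zero)    []       _ _ _ = (λ _ → refl) , λ { (ℕ.s≤s ()) }
ones-initParts-last (suc (suc d)) []       _ _ _ = (λ ()) , λ _ → refl
ones-initParts-last (suc zero)    (e ∷ es) _ (1≤e ∷ 1≤es) eq =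
  let one , many = ones-initParts-last e es 1≤e 1≤es eq in (λ l → cong suc (one l)) , λ l → cong suc (many l)

-- The same block supplies the opening 0 and the closing 0^q 1, so q is c - 2; with at least two
-- parts q is the last part minus 1.
shape-single : ∀ c → 2 ℕ.≤ c → Shape (c ∷ [])
shape-single (suc zero) (ℕ.s≤s ())
shape-single (suc (suc q)) _ = record
  { p = 0 ; q = q ; u = [] ; word≡ = ++-identityʳ (0^⟨ suc q ⟩1) ; top = there (here refl)
  ; degrees = degrees q
  ; degree-p = λ { (inj₁ (() , _)) ; (inj₂ u≢[]) → contradiction refl u≢[] }
  ; prefix = [] ; suffix = []
  ; terms≡ = contradiction refl ; word-prefix = contradiction refl ; word-suffix = contradiction refl }
  where
  degrees : ∀ q {j t} → (j , t) ∈ terms (suc (suc q) ∷ []) → j ≡ 1 ⊎ j ≡ suc q ⊎ j ≡ suc (suc q)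
  degrees zero    (here refl)                 = inj₂ (inj₂ refl)
  degrees (suc q) (here refl)                 = inj₁ refl
  degrees q       (there (here refl))         = inj₂ (inj₂ refl)
  degrees q       (there (there (here refl))) = inj₂ (inj₂ (cong (suc ∘ suc) (ℕₚ.+-identityʳ q)))

shape : ∀ c cs → Admissible (c ∷ cs) → Shape (c ∷ cs)
shape c []       (2≤c , _) = shape-single c 2≤c
shape c (d ∷ ds) adm@(2≤c , 1≤d ∷ 1≤ds) = record
  { p = p ; q = q ; u = u
  ; word≡ = trans (word-initParts c (d ∷ ds)) (trans (cong (_++ 0^⟨ q ⟩1) word-a′) (++-assoc (01^ p) (word u) (0^⟨ q ⟩1)))
  ; top = there (there (here (cong (_, u) (sym deg₃))))
  ; degrees = degrees
  ; degree-p = degree-p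
  ; prefix = a′ ; suffix = lower a
  ; terms≡ = λ u≢[] → cong₂ _∷_ (cong (_, lower a) (trans (deg-lower u≢[]) deg₁′))
      (cong₂ (λ i j → (i , a′) ∷ (j , u) ∷ []) deg₂ deg₃)
  ; word-prefix = λ _ → word-a′
  ; word-suffix = word-suffix
  }
  where
  a = c ∷ d ∷ ds
  a′ = c ∷ initParts d ds
  u = lower a′
  p = lowerDegree a′ ℕ.∸ 1
  q = lastPart d ds ℕ.∸ 1
  positive-degree : ∀ c cs → 2 ℕ.≤ c → suc (lowerDegree (c ∷ cs) ℕ.∸ 1) ≡ lowerDegree (c ∷ cs)
  positive-degree (suc zero)          cs (ℕ.s≤s ())
  positive-degree (suc (suc zero))    cs _ = refl
  positive-degree (suc (suc (suc c))) cs _ = refl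
  deg₁′ : lowerDegree a′ ≡ suc p
  deg₁′ = sym (positive-degree c (initParts d ds) 2≤c)
  deg₂ : lastPart d ds ≡ suc q
  deg₂ = sym (ℕₚ.m+[n∸m]≡n (lastPart-positive d ds 1≤d 1≤ds))
  deg₃ : lastPart d ds ℕ.+ lowerDegree a′ ≡ suc (suc (p ℕ.+ q))
  deg₃ = trans (cong₂ ℕ._+_ deg₂ deg₁′) (cong suc (trans (ℕₚ.+-suc q p) (cong suc (ℕₚ.+-comm q p))))
  word-a′ : word a′ ≡ 01^ p ++ word u
  word-a′ = word-lower c (initParts d ds) 2≤c
  deg-lower : u ≢ [] → lowerDegree a ≡ lowerDegree a′
  deg-lower = go c
    where
    go : ∀ c → lower (c ∷ initParts d ds) ≢ [] → lowerDegree (c ∷ d ∷ ds) ≡ lowerDegree (c ∷ initParts d ds)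
    go zero                _   = refl
    go (suc zero)          _   = refl
    go (suc (suc zero))    ≢[] = cong (suc ∘ suc) (ones-initParts d ds ≢[])
    go (suc (suc (suc c))) _   = refl
  deg-lower-[] : u ≡ [] → (lastPart d ds ≡ 1 → lowerDegree a ≡ suc (lowerDegree a′)) × (2 ℕ.≤ lastPart d ds → lowerDegree a ≡ lowerDegree a′)
  deg-lower-[] = go c 2≤c
    where
    go : ∀ c → 2 ℕ.≤ c → lower (c ∷ initParts d ds) ≡ [] →
      (lastPart d ds ≡ 1 → lowerDegree (c ∷ d ∷ ds) ≡ suc (lowerDegree (c ∷ initParts d ds))) × (2 ℕ.≤ lastPart d ds → lowerDegree (c ∷ d ∷ ds) ≡ lowerDegree (c ∷ initParts d ds))
    go (suc zero) (ℕ.s≤s ())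
    go (suc (suc zero)) _ eq = let one , many = ones-initParts-last d ds 1≤d 1≤ds eq in (λ l → cong (suc ∘ suc) (one l)) , λ l → cong (suc ∘ suc) (many l)
    go (suc (suc (suc c))) _ ()
  -- The exception is the word 0 1^(p+1), where u = ∅ and q = 0: lowering consumes the final 1 as
  -- well, and the degree p + 2 is then p + q + 2.
  deg-first : lowerDegree a ≡ suc p ⊎ (q ≡ 0 × lowerDegree a ≡ suc (suc p))
  deg-first = [ when-empty , (λ u≢[] → inj₁ (trans (deg-lower u≢[]) deg₁′)) ]′ (empty? u)
    where
    when-empty : u ≡ [] → lowerDegree a ≡ suc p ⊎ (q ≡ 0 × lowerDegree a ≡ suc (suc p))
    when-empty u≡[] = [ (λ l → inj₁ (trans (proj₂ (deg-lower-[] u≡[]) l) deg₁′)) ,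
                        (λ l → inj₂ (cong (ℕ._∸ 1) (sym l) , trans (proj₁ (deg-lower-[] u≡[]) (sym l)) (cong suc deg₁′))) ]′
                      (ℕₚ.m≤n⇒m<n∨m≡n (lastPart-positive d ds 1≤d 1≤ds))
  degrees : ∀ {j t} → (j , t) ∈ terms a → j ≡ suc p ⊎ j ≡ suc q ⊎ j ≡ suc (suc (p ℕ.+ q))
  degrees (here refl) = [ inj₁ , (λ (q≡0 , eq) → inj₂ (inj₂ (trans eq (cong (suc ∘ suc) (sym (trans (cong (p ℕ.+_) q≡0) (ℕₚ.+-identityʳ p))))))) ]′ deg-first
  degrees (there (here refl))         = inj₂ (inj₁ deg₂)
  degrees (there (there (here refl))) = inj₂ (inj₂ deg₃)
  degree-p : (1 ℕ.≤ p × 1 ℕ.≤ q) ⊎ u ≢ [] → ∃ λ t → (suc p , t) ∈ terms a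
  degree-p hyp = lower a , here (cong (_, lower a) (sym (deg hyp)))
    where
    deg : (1 ℕ.≤ p × 1 ℕ.≤ q) ⊎ u ≢ [] → lowerDegree a ≡ suc p
    deg (inj₂ u≢[]) = trans (deg-lower u≢[]) deg₁′
    deg (inj₁ (_ , 1≤q)) = [ id , (λ (q≡0 , _) → contradiction (ℕₚ.≤-trans 1≤q (ℕₚ.≤-reflexive q≡0)) λ ()) ]′ deg-first
  word-suffix : u ≢ [] → word (lower a) ≡ word u ++ 0^⟨ q ⟩1
  word-suffix u≢[] = ++-cancelˡ (01^ p) (word (lower a)) (word u ++ 0^⟨ q ⟩1) (begin
    01^ p ++ word (lower a)                       ≡⟨ cong (λ k → 01^ (k ℕ.∸ 1) ++ word (lower a)) (deg-lower u≢[]) ⟨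
    01^ (lowerDegree a ℕ.∸ 1) ++ word (lower a)   ≡⟨ word-lower c (d ∷ ds) 2≤c ⟨
    word a                                        ≡⟨ word-initParts c (d ∷ ds) ⟩
    word a′ ++ 0^⟨ q ⟩1                             ≡⟨ cong (_++ 0^⟨ q ⟩1) word-a′ ⟩
    (01^ p ++ word u) ++ 0^⟨ q ⟩1                   ≡⟨ ++-assoc (01^ p) (word u) (0^⟨ q ⟩1) ⟩
    01^ p ++ (word u ++ 0^⟨ q ⟩1)                   ∎)
    where open ≡-Reasoning

Matching : ℕ → ℕ → ℕ → ℕ → Set
Matching p q p′ q′ = (p′ ≡ p × q′ ≡ q) ⊎ (p′ ≡ q × q′ ≡ p)

Matching-sym : ∀ {p q p′ q′} → Matching p q p′ q′ → Matching p′ q′ p q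
Matching-sym (inj₁ (refl , refl)) = inj₁ (refl , refl)
Matching-sym (inj₂ (refl , refl)) = inj₂ (refl , refl)

-- The third possibility contradicts the equality of the sums: it would make p larger than p + q.
match-degree : ∀ p q p′ q′ → p ℕ.+ q ≡ p′ ℕ.+ q′ →
  suc p ≡ suc p′ ⊎ suc p ≡ suc q′ ⊎ suc p ≡ suc (suc (p′ ℕ.+ q′)) → Matching p q p′ q′
match-degree p q p′ q′ eq (inj₁ refl) = inj₁ (refl , sym (ℕₚ.+-cancelˡ-≡ p q q′ eq))
match-degree p q p′ q′ eq (inj₂ (inj₁ refl)) = inj₂ (sym (ℕₚ.+-cancelˡ-≡ p q p′ (trans eq (ℕₚ.+-comm p′ p))) , refl)
match-degree p q p′ q′ eq (inj₂ (inj₂ e)) = contradiction (ℕₚ.≤-trans (ℕₚ.m≤m+n p q) (ℕₚ.≤-reflexive eq))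
  (ℕₚ.<⇒≱ (ℕₚ.≤-reflexive (sym (ℕₚ.suc-injective e))))

-- Each pair contains a 0, so the common sum determines it up to order.
match-small : ∀ p q p′ q′ → p ℕ.+ q ≡ p′ ℕ.+ q′ → ¬ (1 ℕ.≤ p × 1 ℕ.≤ q) → ¬ (1 ℕ.≤ p′ × 1 ℕ.≤ q′) → Matching p q p′ q′
match-small zero    q       zero     q′       eq _ _ = inj₁ (refl , sym eq)
match-small zero    q       (suc p′) zero     eq _ _ = inj₂ (trans (sym (ℕₚ.+-identityʳ (suc p′))) (sym eq) , refl)
match-small (suc p) zero    zero     q′       eq _ _ = inj₂ (refl , trans (sym eq) (ℕₚ.+-identityʳ (suc p)))
match-small (suc p) zero    (suc p′) zero     eq _ _ = inj₁ (trans (sym (ℕₚ.+-identityʳ (suc p′))) (trans (sym eq) (ℕₚ.+-identityʳ (suc p))) , refl)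
match-small (suc p) (suc q) _        _        _ ¬pq _ = contradiction (ℕ.s≤s ℕ.z≤n , ℕ.s≤s ℕ.z≤n) ¬pq
match-small _       _       (suc p′) (suc q′) _ _ ¬pq = contradiction (ℕ.s≤s ℕ.z≤n , ℕ.s≤s ℕ.z≤n) ¬pq

both-positive? : ∀ p q → (1 ℕ.≤ p × 1 ℕ.≤ q) ⊎ ¬ (1 ℕ.≤ p × 1 ℕ.≤ q)
both-positive? zero    q       = inj₂ λ { (() , _) }
both-positive? (suc p) zero    = inj₂ λ { (_ , ()) }
both-positive? (suc p) (suc q) = inj₁ (ℕ.s≤s ℕ.z≤n , ℕ.s≤s ℕ.z≤n)

degree-≤ : ∀ {a j t} (A : Shape a) → (j , t) ∈ terms a → j ℕ.≤ suc (suc (Shape.p A ℕ.+ Shape.q A))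
degree-≤ A t∈ with Shape.degrees A t∈
... | inj₁ refl        = ℕ.s≤s (ℕₚ.m≤n⇒m≤1+n (ℕₚ.m≤m+n (Shape.p A) (Shape.q A)))
... | inj₂ (inj₁ refl) = ℕ.s≤s (ℕₚ.m≤n⇒m≤1+n (ℕₚ.m≤n+m (Shape.q A) (Shape.p A)))
... | inj₂ (inj₂ refl) = ℕₚ.≤-refl

p≢1+p+q : ∀ p q → suc p ≢ suc (suc (p ℕ.+ q))
p≢1+p+q p q e = ℕₚ.<⇒≱ (ℕₚ.≤-reflexive (sym (ℕₚ.suc-injective e))) (ℕₚ.m≤m+n p q)

module _ {a : Composition} (A : Shape a) (u≢[] : Shape.u A ≢ []) (f : Composition → ℕ) where
  open Shape A

  component-top : component (suc (suc (p ℕ.+ q))) f (terms a) ≡ f u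
  component-top = trans (cong (component j f) (terms≡ u≢[])) (trans (component-miss f suffix ((suc q , prefix) ∷ (j , u) ∷ []) (p≢1+p+q p q))
    (trans (component-miss f prefix ((j , u) ∷ []) (λ e → p≢1+p+q q p (trans e (cong (suc ∘ suc) (ℕₚ.+-comm p q)))))
      (trans (component-hit j f u []) (ℕₚ.+-identityʳ (f u)))))
    where j = suc (suc (p ℕ.+ q))

  -- For p = q the suffix and the prefix would lie in the same degree, with only the sum of their
  -- coefficients visible.
  component-suffix : p ≢ q → component (suc p) f (terms a) ≡ f suffix
  component-suffix p≢q = trans (cong (component (suc p) f) (terms≡ u≢[])) (trans (component-hit (suc p) f suffix ((suc q , prefix) ∷ (j , u) ∷ []))
    (trans (cong (f suffix ℕ.+_) (trans (component-miss f prefix ((j , u) ∷ []) (λ e → p≢q (sym (ℕₚ.suc-injective e))))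
      (component-miss f u [] (λ e → p≢1+p+q p q (sym e))))) (ℕₚ.+-identityʳ (f suffix))))
    where j = suc (suc (p ℕ.+ q))

  component-prefix : p ≢ q → component (suc q) f (terms a) ≡ f prefix
  component-prefix p≢q = trans (cong (component (suc q) f) (terms≡ u≢[])) (trans (component-miss f suffix ((suc q , prefix) ∷ (j , u) ∷ []) (λ e → p≢q (ℕₚ.suc-injective e)))
    (trans (component-hit (suc q) f prefix ((j , u) ∷ [])) (trans (cong (f prefix ℕ.+_)
      (component-miss f u [] (λ e → p≢1+p+q q p (trans (sym e) (cong (suc ∘ suc) (ℕₚ.+-comm p q)))))) (ℕₚ.+-identityʳ (f prefix)))))
    where j = suc (suc (p ℕ.+ q))

-- Induction on the weight.

EqualOrDual : List Bool → List Bool → Set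
EqualOrDual v w = w ≡ v ⊎ w ≡ dualWord v

self-dual-sandwich : ∀ p q {x y} → dualWord x ≡ x → y ≡ x → EqualOrDual (sandwich p x q) (sandwich q y p)
self-dual-sandwich p q {x} dual-x refl = inj₂ (trans (cong (λ z → sandwich q z p) (sym dual-x)) (sym (dualWord-sandwich p x q)))

-- Knowing p and q up to order and u up to duality leaves two mismatched cases: u dualised with p, q
-- in place, and u unchanged with p, q exchanged. The induction hypothesis for the shorter words
-- `suffix` and `prefix` resolves them.
same-expansion⇒equal-or-dual : ∀ n a b → weight a ℕ.≤ n → Admissible a → Admissible b → SameExpansion a b → EqualOrDual (word a) (word b)
same-expansion⇒equal-or-dual n [] b _ a-adm b-adm same =
  inj₁ (cong word (weight≡0 b b-adm (sym (same-weight [] b a-adm b-adm same))))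
same-expansion⇒equal-or-dual n (c ∷ cs) [] _ a-adm b-adm same =
  inj₁ (sym (cong word (weight≡0 (c ∷ cs) a-adm (same-weight (c ∷ cs) [] a-adm b-adm same))))
same-expansion⇒equal-or-dual zero (c ∷ cs) (d ∷ ds) w≤0 a-adm _ _ = contradiction (ℕₚ.≤-trans (admissible-weight c cs a-adm) w≤0) λ ()
same-expansion⇒equal-or-dual (suc n) (c ∷ cs) (d ∷ ds) w≤n a-adm b-adm same =
  subst (λ v → EqualOrDual v (word b)) (sym A.word≡) (subst (EqualOrDual (sandwich A.p (word A.u) A.q)) (sym B.word≡)
    ([ when-empty , when-nonempty ]′ (empty? A.u)))
  where
  a = c ∷ cs
  b = d ∷ ds
  A = shape c cs a-adm
  B = shape d ds b-adm
  module A = Shape A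
  module B = Shape B
  Goal = EqualOrDual (sandwich A.p (word A.u) A.q) (sandwich B.p (word B.u) B.q)

  back : SameExpansion b a
  back = SameExpansion-sym {a} {b} same

  -- p + q + 2 is the largest degree that occurs, and equal expansions have the same degrees.
  sum≡ : A.p ℕ.+ A.q ≡ B.p ℕ.+ B.q
  sum≡ = ℕₚ.≤-antisym
    (ℕ.s≤s⁻¹ (ℕ.s≤s⁻¹ (degree-≤ B (proj₂ (same-degrees c cs d ds a-adm b-adm same A.top)))))
    (ℕ.s≤s⁻¹ (ℕ.s≤s⁻¹ (degree-≤ A (proj₂ (same-degrees d ds c cs b-adm a-adm back B.top)))))

  A-top = term∈ a a-adm A.top
  B-top = term∈ b b-adm B.top

  weight-u : weight A.u ≡ weight B.u
  weight-u = ℕₚ.+-cancelˡ-≡ (suc (suc (A.p ℕ.+ A.q))) (weight A.u) (weight B.u)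
    (trans (proj₁ (proj₂ A-top)) (trans (same-weight a b a-adm b-adm same)
      (trans (sym (proj₁ (proj₂ B-top))) (cong (λ s → suc (suc s) ℕ.+ weight B.u) (sym sum≡)))))

  match-from-A : (1 ℕ.≤ A.p × 1 ℕ.≤ A.q) ⊎ A.u ≢ [] → Matching A.p A.q B.p B.q
  match-from-A hyp = match-degree A.p A.q B.p B.q sum≡ (B.degrees (proj₂ (same-degrees c cs d ds a-adm b-adm same (proj₂ (A.degree-p hyp)))))

  match-from-B : 1 ℕ.≤ B.p × 1 ℕ.≤ B.q → Matching A.p A.q B.p B.q
  match-from-B hyp = Matching-sym (match-degree B.p B.q A.p A.q (sym sum≡)
    (A.degrees (proj₂ (same-degrees d ds c cs b-adm a-adm back (proj₂ (B.degree-p (inj₁ hyp)))))))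

  -- If both pairs contain a 0, no degree p + 1 is guaranteed, and the sum alone decides.
  matching : Matching A.p A.q B.p B.q
  matching = [ (λ hyp → match-from-A (inj₁ hyp)) , (λ ¬A → [ match-from-B , match-small A.p A.q B.p B.q sum≡ ¬A ]′ (both-positive? B.p B.q)) ]′
    (both-positive? A.p A.q)

  when-empty : A.u ≡ [] → Goal
  when-empty u≡[] = subst (λ v → EqualOrDual (sandwich A.p (word v) A.q) (sandwich B.p (word B.u) B.q)) (sym u≡[])
    (subst (λ v → EqualOrDual (sandwich A.p [] A.q) (sandwich B.p (word v) B.q)) (sym v≡[]) (conclude matching))
    where
    v≡[] : B.u ≡ []
    v≡[] = weight≡0 B.u (proj₁ B-top) (trans (sym weight-u) (cong weight u≡[]))
    conclude : ∀ {p q} → Matching A.p A.q p q → EqualOrDual (sandwich A.p [] A.q) (sandwich p [] q)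
    conclude (inj₁ (refl , refl)) = inj₁ refl
    conclude (inj₂ (refl , refl)) = inj₂ (sym (dualWord-sandwich A.p [] A.q))

  when-nonempty : A.u ≢ [] → Goal
  when-nonempty u≢[] = go matching (same-expansion⇒equal-or-dual n A.u B.u (smaller A.top) (proj₁ A-top) (proj₁ B-top) same-u)
    where
    v≢[] : B.u ≢ []
    v≢[] v≡[] = u≢[] (weight≡0 A.u (proj₁ A-top) (trans weight-u (cong weight v≡[])))
    smaller : ∀ {j t} → (j , t) ∈ terms a → weight t ℕ.≤ n
    smaller {j} {t} t∈ = let _ , eq , 1≤j = term∈ a a-adm t∈ in
      ℕ.s≤s⁻¹ (ℕₚ.≤-trans (ℕₚ.≤-trans (ℕₚ.+-monoˡ-≤ (weight t) 1≤j) (ℕₚ.≤-reflexive eq)) w≤n)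
    components : ∀ j J → 1 ℕ.≤ j → component j (φ J) (terms a) ≡ component j (φ J) (terms b)
    components = same-components c cs d ds a-adm b-adm same
    same-u : SameExpansion A.u B.u
    same-u J = trans (sym (component-top A u≢[] (φ J))) (trans (components (suc (suc (A.p ℕ.+ A.q))) J (ℕ.s≤s ℕ.z≤n))
      (trans (cong (λ s → component (suc (suc s)) (φ J) (terms b)) sum≡) (component-top B v≢[] (φ J))))
    suffix∈ : (suc A.p , A.suffix) ∈ terms a
    suffix∈ = subst ((suc A.p , A.suffix) ∈_) (sym (A.terms≡ u≢[])) (here refl)
    suffix′∈ : (suc B.p , B.suffix) ∈ terms b
    suffix′∈ = subst ((suc B.p , B.suffix) ∈_) (sym (B.terms≡ v≢[])) (here refl)
    prefix′∈ : (suc B.q , B.prefix) ∈ terms b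
    prefix′∈ = subst ((suc B.q , B.prefix) ∈_) (sym (B.terms≡ v≢[])) (there (here refl))
    x = word A.u
    y = word B.u

    compare-suffixes : B.p ≡ A.p → B.q ≡ A.q → A.p ≢ A.q → EqualOrDual (x ++ 0^⟨ A.q ⟩1) (y ++ 0^⟨ A.q ⟩1)
    compare-suffixes p≡ q≡ p≢q = subst (λ k → EqualOrDual (x ++ 0^⟨ A.q ⟩1) (y ++ 0^⟨ k ⟩1)) q≡
      (subst (λ v → EqualOrDual v (y ++ 0^⟨ B.q ⟩1)) (A.word-suffix u≢[]) (subst (EqualOrDual (word A.suffix)) (B.word-suffix v≢[])
        (same-expansion⇒equal-or-dual n A.suffix B.suffix (smaller suffix∈) (proj₁ (term∈ a a-adm suffix∈)) (proj₁ (term∈ b b-adm suffix′∈))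
          (λ J → trans (sym (component-suffix A u≢[] (φ J) p≢q)) (trans (components (suc A.p) J (ℕ.s≤s ℕ.z≤n))
            (trans (cong (λ k → component (suc k) (φ J) (terms b)) (sym p≡)) (component-suffix B v≢[] (φ J) (λ e → p≢q (trans (sym p≡) (trans e q≡))))))))))

    compare-crosswise : B.p ≡ A.q → B.q ≡ A.p → A.p ≢ A.q → EqualOrDual (x ++ 0^⟨ A.q ⟩1) (01^ A.q ++ y)
    compare-crosswise p≡ q≡ p≢q = subst (λ k → EqualOrDual (x ++ 0^⟨ A.q ⟩1) (01^ k ++ y)) p≡
      (subst (λ v → EqualOrDual v (01^ B.p ++ y)) (A.word-suffix u≢[]) (subst (EqualOrDual (word A.suffix)) (B.word-prefix v≢[])
        (same-expansion⇒equal-or-dual n A.suffix B.prefix (smaller suffix∈) (proj₁ (term∈ a a-adm suffix∈)) (proj₁ (term∈ b b-adm prefix′∈))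
          (λ J → trans (sym (component-suffix A u≢[] (φ J) p≢q)) (trans (components (suc A.p) J (ℕ.s≤s ℕ.z≤n))
            (trans (cong (λ k → component (suc k) (φ J) (terms b)) (sym q≡)) (component-prefix B v≢[] (φ J) (λ e → p≢q (trans (sym q≡) (trans (sym e) p≡))))))))))

    dual-suffix : ∀ x q → dualWord (x ++ 0^⟨ q ⟩1) ≡ 01^ q ++ dualWord x
    dual-suffix x q = trans (dualWord-++ x (0^⟨ q ⟩1)) (cong (_++ dualWord x) (dualWord-0^1 q))

    -- Equal suffixes cancel to y = x. Dual ones read y 0^q 1 = 0 1^q y because y is the dual of x;
    -- then y is self-dual and again equals x.
    self-dual-A : y ≡ dualWord x → EqualOrDual (x ++ 0^⟨ A.q ⟩1) (y ++ 0^⟨ A.q ⟩1) → y ≡ x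
    self-dual-A y≡ (inj₁ e) = ++-cancelʳ (0^⟨ A.q ⟩1) y x e
    self-dual-A y≡ (inj₂ e) = trans (sym (conjugate⇒self-dual y A.q (trans e (trans (dual-suffix x A.q) (cong (01^ A.q ++_) (sym y≡))))))
      (trans (cong dualWord y≡) (dualWord-involutive x))

    -- With y = x, equality reads x 0^q 1 = 0 1^q x, which forces self-duality; in the dual case
    -- cancelling 0 1^q gives it at once.
    self-dual-B : y ≡ x → EqualOrDual (x ++ 0^⟨ A.q ⟩1) (01^ A.q ++ y) → dualWord x ≡ x
    self-dual-B y≡ (inj₁ e) = conjugate⇒self-dual x A.q (trans (sym e) (cong (01^ A.q ++_) y≡))
    self-dual-B y≡ (inj₂ e) = trans (sym (++-cancelˡ (01^ A.q) y (dualWord x) (trans e (dual-suffix x A.q)))) y≡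

    go : Matching A.p A.q B.p B.q → EqualOrDual x y → Goal
    go (inj₁ (p≡ , q≡)) (inj₁ y≡x) = inj₁ (trans (cong₂ (λ p q → sandwich p y q) p≡ q≡) (cong (λ z → sandwich A.p z A.q) y≡x))
    go (inj₂ (p≡ , q≡)) (inj₂ y≡) = inj₂ (trans (cong₂ (λ p q → sandwich p y q) p≡ q≡)
      (trans (cong (λ z → sandwich A.q z A.p) y≡) (sym (dualWord-sandwich A.p x A.q))))
    -- For p = q the mismatch is only apparent, since exchanging p and q changes nothing; for p ≠ q
    -- the suffix has a degree of its own and can be compared.
    go (inj₁ (p≡ , q≡)) (inj₂ y≡) with A.p ℕₚ.≟ A.q
    ... | yes p≡q = inj₂ (trans (cong₂ (λ p q → sandwich p y q) (trans p≡ p≡q) (trans q≡ (sym p≡q)))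
      (trans (cong (λ z → sandwich A.q z A.p) y≡) (sym (dualWord-sandwich A.p x A.q))))
    ... | no p≢q = inj₁ (trans (cong₂ (λ p q → sandwich p y q) p≡ q≡)
      (cong (λ z → sandwich A.p z A.q) (self-dual-A y≡ (compare-suffixes p≡ q≡ p≢q))))
    go (inj₂ (p≡ , q≡)) (inj₁ y≡x) with A.p ℕₚ.≟ A.q
    ... | yes p≡q = inj₁ (trans (cong₂ (λ p q → sandwich p y q) (trans p≡ (sym p≡q)) (trans q≡ p≡q)) (cong (λ z → sandwich A.p z A.q) y≡x))
    ... | no p≢q = subst (EqualOrDual (sandwich A.p x A.q)) (cong₂ (λ p q → sandwich p y q) (sym p≡) (sym q≡))
      (self-dual-sandwich A.p A.q (self-dual-B y≡x (compare-crosswise p≡ q≡ p≢q)) y≡x)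

-- From equal tails to equal expansions, and the theorem.

length≤size : ∀ J → length J ℕ.≤ size J
length≤size []          = ℕ.z≤n
length≤size (d ∷ [])    = ℕ.s≤s ℕ.z≤n
length≤size (d ∷ i ∷ J) = ℕ.s≤s (ℕₚ.≤-trans (length≤size (i ∷ J)) (ℕₚ.m≤n+m (size (i ∷ J)) d))

digit≤exponent : ∀ d J → d ℕ.≤ exponent d J
digit≤exponent d []      = ℕₚ.m≤n⇒m≤1+n (ℕₚ.n≤1+n d)
digit≤exponent d (_ ∷ _) = ℕₚ.n≤1+n d

In-length : ∀ B J → size J ℕ.< B → Layers.In B (length J) J
In-length B []      _  = Layers.nil
In-length B (d ∷ J) lt = Layers.cons
  (ℕₚ.≤-trans (ℕ.s≤s (ℕₚ.≤-trans (digit≤exponent d J) (ℕₚ.m≤m+n (exponent d J) (size J)))) lt)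
  (In-length B J (ℕₚ.≤-trans (ℕ.s≤s (ℕₚ.m≤n+m (size J) (exponent d J))) lt))

In⇒length : ∀ {B i J} → Layers.In B i J → length J ≡ i
In⇒length Layers.nil          = refl
In⇒length (Layers.cons _ inJ) = cong suc (In⇒length inJ)

-- The relation tested has the constant coefficients φ_J(a) - φ_J(b), so their vanishing may be read
-- off at any argument, here 0.
equal-tails⇒same-expansion : ∀ a b → Admissible a → Admissible b → (∀ n → ZetaEq a b n) → SameExpansion a b
equal-tails⇒same-expansion a b a-adm b-adm eqs J =
  ι-injective (p-q≡0⇒p≡q (ι (φ J a)) (ι (φ J b)) (independent L P (λ K → Poly-const (ι (φ K a) - ι (φ K b))) vanishes 0 (λ n _ → rel n) (length J) J
    (In-length B J (ℕ.s≤s (ℕₚ.m≤n+m (size J) (weight a ℕ.+ weight b)))) 0ℚ))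
  where
  L = weight a ℕ.+ weight b
  -- Large enough for both expansions and for the tested list `J` to have all its digits below `B`.
  B = suc (weight a ℕ.+ weight b ℕ.+ size J)
  open Layers B
  open Elimination B
  open Expansion B
  P : Coeffs
  P K _ = ι (φ K a) - ι (φ K b)
  φ-large : ∀ {i K} c → Admissible c → weight c ℕ.≤ L → L ℕ.< i → In i K → φ K c ≡ 0
  φ-large {i} {K} c c-adm w≤L L<i inK with φ K c ℕₚ.≟ 0
  ... | yes e = e
  ... | no ≢0 = contradiction (ℕₚ.≤-trans (length≤size K) (ℕₚ.≤-trans (ℕₚ.≤-reflexive (φ-size K c c-adm ≢0)) w≤L))
    (ℕₚ.<⇒≱ (ℕₚ.≤-trans L<i (ℕₚ.≤-reflexive (sym (In⇒length inK)))))
  vanishes : VanishesAbove L P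
  vanishes i K L<i inK x = p≡q⇒p-q≡0 (cong ι (trans (φ-large a a-adm (ℕₚ.m≤m+n (weight a) (weight b)) L<i inK)
    (sym (φ-large b b-adm (ℕₚ.m≤n+m (weight b) (weight a)) L<i inK))))
  a≤B : weight a ℕ.≤ B
  a≤B = ℕₚ.m≤n⇒m≤1+n (ℕₚ.≤-trans (ℕₚ.m≤m+n (weight a) (weight b)) (ℕₚ.m≤m+n (weight a ℕ.+ weight b) (size J)))
  b≤B : weight b ℕ.≤ B
  b≤B = ℕₚ.m≤n⇒m≤1+n (ℕₚ.≤-trans (ℕₚ.m≤n+m (weight b) (weight a)) (ℕₚ.m≤m+n (weight a ℕ.+ weight b) (size J)))
  lem₁ : ∀ u v y → (u - v) * y ≡ u * y + (- 1ℚ) * (v * y)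
  lem₁ = solve-∀ ℚ-ring
  lem₂ : ∀ z w s t → s + (- 1ℚ) * t ≡ (z - w) - ((z - s) - (w - t))
  lem₂ = solve-∀ ℚ-ring
  relation≡ : ∀ n N → relation L P n N ≡ tree L a n N + (- 1ℚ) * tree L b n N
  relation≡ n N = trans (treeSum-cong L (λ _ K _ → lem₁ (ι (φ K a)) (ι (φ K b)) (Y K n N)))
    (trans (treeSum-+ L (λ K → ι (φ K a) * Y K n N) (λ K → (- 1ℚ) * (ι (φ K b) * Y K n N)))
      (cong (_+_ (tree L a n N)) (treeSum-*ˡ L (- 1ℚ) (λ K → ι (φ K b) * Y K n N))))
  -- The relation is the difference of the two tails minus the difference of the two expansion
  -- errors.
  rel : ∀ n → Null (relation L P n)
  rel n = Null-≡ 0 (λ N _ → trans (relation≡ n N) (lem₂ (Z N a n n) (Z N b n n) (tree L a n N) (tree L b n N)))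
    (Null-- (Null-≡ 0 (λ N _ → cong₂ _-_ (sym (zetaPartial≡Z N a n)) (sym (zetaPartial≡Z N b n))) (eqs n))
      (Null-- (expansion L a a-adm (ℕₚ.m≤m+n (weight a) (weight b)) a≤B n) (expansion L b b-adm (ℕₚ.m≤n+m (weight b) (weight a)) b≤B n)))

theorem21 : (a b : Composition) → Admissible a → Admissible b →
    (∀ n → ZetaEq a b n) → (b ≡ a) ⊎ (b ≡ dual a)
theorem21 a b a-adm b-adm eqs = conclude
  (same-expansion⇒equal-or-dual (weight a) a b ℕₚ.≤-refl a-adm b-adm (equal-tails⇒same-expansion a b a-adm b-adm eqs))
  where
  decode : ∀ c → Admissible c → fromWord (word c) ≡ c
  decode c c-adm = fromWord-word c (admissible⇒positive c c-adm)
  conclude : EqualOrDual (word a) (word b) → (b ≡ a) ⊎ (b ≡ dual a)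
  conclude (inj₁ e) = inj₁ (trans (sym (decode b b-adm)) (trans (cong fromWord e) (decode a a-adm)))
  conclude (inj₂ e) = inj₂ (trans (sym (decode b b-adm)) (cong fromWord e))
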